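{- Let $\alpha$ be an irrational number with simple continued fraction expansion $\alpha=[b_0;b_1,b_2,\ldots]$ and convergents $p_n/q_n$. Then the irrationality exponent $\mu(\alpha)$ and the irrationality base $\beta(\alpha)$ are given by $$\mu(\alpha)=1+\limsup_{n\to\infty}\frac{\ln q_{n+1}}{\ln q_n}=2+\limsup_{n\to\infty}\frac{\ln b_{n+1}}{\ln q_n},$$ $$\ln\beta(\alpha)=\limsup_{n\to\infty}\frac{\ln q_{n+1}}{q_n}=\limsup_{n\to\infty}\frac{\ln b_{n+1}}{q_n}.$$
   Context: Irrationality exponent: for a real irrational number $\alpha$, $\mu(\alpha)$ is the least real $\mu>0$ such that for every $\varepsilon>0$ there is a positive integer $q(\varepsilon)$ with $\left|\alpha-\frac pq\right|>q^{ -(\mu+\varepsilon)}$ for all integers $p,q$ with $q\ge q(\varepsilon)$; if no such $\mu$ exists, $\mu(\alpha)=\infty$. Irrationality base: $\beta(\alpha)$ is the least real $\beta\ge 1$ such that for every $\varepsilon>0$ there is a positive integer $q(\varepsilon)$ with $\left|\alpha-\frac pq\right|>\frac{1}{(\beta+\varepsilon)^q}$ for all integers $p,q$ with $q\ge q(\varepsilon)$; if no such $\beta$ exists, $\beta(\alpha)=\infty$. Conventions: $b_0$ is an integer, $b_1,b_2,\ldots$ are positive integers, and $[b_0;b_1,b_2,\ldots]=b_0+\cfrac{1}{b_1+\cfrac{1}{b_2+\cdots}}$. The $n$-th convergent $p_n/q_n=[b_0;b_1,\ldots,b_n]$ is in lowest terms with $q_n>0$ (so $q_0=1$, $q_1=b_1$,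 $q_{n+1}=b_{n+1}q_n+q_{n-1}$). The equalities hold in the extended reals, with $\ln\infty=\infty$. -}

module Defs where

open import Data.Nat.Base as ℕ using (ℕ; zero; suc) hiding (module ℕ)
import Data.Nat.Properties as ℕ
open import Data.Integer.Base as ℤ using (ℤ) hiding (module ℤ)
import Data.Integer.Properties as ℤ
open import Data.Rational.Base as ℚ using (ℚ; 0ℚ; 1ℚ; ½) hiding (module ℚ)
import Data.Rational.Properties as ℚ
open import Data.Rational.Unnormalised.Base using (mkℚᵘ; *≡*; *≤*)
import Data.Rational.Unnormalised.Properties as ℚᵘ
open import Data.Rational.Solver using (module +-*-Solver)
open import Data.Empty using (⊥)
open import Data.Unit.Base using (⊤)
open import Data.Product.Base using (Σ-syntax; ∃-syntax; _×_; _,_; proj₁; proj₂)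
open import Data.Sum.Base using (_⊎_; inj₁; inj₂)
open import Relation.Nullary.Negation.Core using (¬_)
open import Relation.Nullary.Negation using (contradiction)
open import Relation.Nullary.Decidable.Core using (yes; no; toWitness)
open import Relation.Binary.PropositionalEquality
  using (_≡_; _≢_; refl; sym; trans; cong; cong₂; subst; subst₂)

module Rational where

  open import Data.Rational.Base using (_+_; _*_; _-_; -_; ∣_∣; _≤_; _<_; _⊓_)
  open +-*-Solver using (solve; _:+_; _:*_; _:-_; :-_; _:=_; con)

  -- The reciprocal, extended by 0⁻¹ = 0.
  inv : ℚ → ℚ
  inv p with p ℚ.≟ 0ℚ
  ... | yes _  = 0ℚ
  ... | no p≢0 = (ℚ.1/ p) {{ℚ.≢-nonZero p≢0}}

  -- sum n f = Σ_{k<n} f k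
  sum : ℕ → (ℕ → ℚ) → ℚ
  sum zero    f = 0ℚ
  sum (suc n) f = sum n f + f n

  -- ½^ n = 2⁻ⁿ
  ½^_ : ℕ → ℚ
  ½^ zero  = 1ℚ
  ½^ suc n = ½ * ½^ n

  fromℕ : ℕ → ℚ
  fromℕ n = ℤ.+ n ℚ./ 1

  -- expTerm t k = tᵏ / k!
  expTerm : ℚ → ℕ → ℚ
  expTerm t zero    = 1ℚ
  expTerm t (suc k) = expTerm t k * (t * inv (fromℕ (suc k)))

  expSum : ℕ → ℚ → ℚ
  expSum n t = sum n (expTerm t)

  -- The left Riemann sum of ∫₁ᵗ ds/s for the partition into 2ⁿ equal parts
  -- of (signed) width w.
  lnSum : ℕ → ℚ → ℚ
  lnSum n t = sum (2 ℕ.^ n) (λ k → w * inv (1ℚ + fromℕ k * w))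
    where w = (t - 1ℚ) * ½^ n

  abstract

    0≤1 : 0ℚ ≤ 1ℚ
    0≤1 = toWitness {a? = 0ℚ ℚ.≤? 1ℚ} _

    0<1 : 0ℚ < 1ℚ
    0<1 = toWitness {a? = 0ℚ ℚ.<? 1ℚ} _

    0<½ : 0ℚ < ½
    0<½ = toWitness {a? = 0ℚ ℚ.<? ½} _

    0≤½ : 0ℚ ≤ ½
    0≤½ = ℚ.<⇒≤ 0<½

    *-monoʳ : ∀ {a b c} → 0ℚ ≤ c → a ≤ b → a * c ≤ b * c
    *-monoʳ {c = c} 0≤c = ℚ.*-monoʳ-≤-nonNeg c {{ℚ.nonNegative 0≤c}}

    *-monoˡ : ∀ {a b c} → 0ℚ ≤ c → a ≤ b → c * a ≤ c * b
    *-monoˡ {c = c} 0≤c = ℚ.*-monoˡ-≤-nonNeg c {{ℚ.nonNegative 0≤c}}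

    *-mono : ∀ {a b c d} → 0ℚ ≤ b → 0ℚ ≤ c → a ≤ b → c ≤ d → a * c ≤ b * d
    *-mono 0≤b 0≤c a≤b c≤d = ℚ.≤-trans (*-monoʳ 0≤c a≤b) (*-monoˡ 0≤b c≤d)

    0≤* : ∀ {a b} → 0ℚ ≤ a → 0ℚ ≤ b → 0ℚ ≤ a * b
    0≤* {a} {b} 0≤a 0≤b = subst (_≤ a * b) (ℚ.*-zeroˡ b) (*-monoʳ 0≤b 0≤a)

    0<* : ∀ {a b} → 0ℚ < a → 0ℚ < b → 0ℚ < a * b
    0<* {a} {b} 0<a 0<b =
      subst (_< a * b) (ℚ.*-zeroˡ b) (ℚ.*-monoˡ-<-pos b {{ℚ.positive 0<b}} 0<a)

    0≤+ : ∀ {a b} → 0ℚ ≤ a → 0ℚ ≤ b → 0ℚ ≤ a + b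
    0≤+ {a} {b} 0≤a 0≤b = subst (_≤ a + b) (ℚ.+-identityˡ 0ℚ) (ℚ.+-mono-≤ 0≤a 0≤b)

    p≤p+ : ∀ {p a} → 0ℚ ≤ a → p ≤ p + a
    p≤p+ {p} {a} 0≤a = subst (_≤ p + a) (ℚ.+-identityʳ p) (ℚ.+-monoʳ-≤ p 0≤a)

    ≤⇒0≤- : ∀ {p q} → p ≤ q → 0ℚ ≤ q - p
    ≤⇒0≤- {p} {q} p≤q =
      subst (_≤ q - p) (ℚ.+-inverseʳ p) (ℚ.+-monoˡ-≤ (- p) p≤q)

    half+half : ∀ p → ½ * p + ½ * p ≡ p
    half+half = solve 1 (λ p → con ½ :* p :+ con ½ :* p := p) refl

    p≤∣p∣ : ∀ p → p ≤ ∣ p ∣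
    p≤∣p∣ p with ℚ.≤-total 0ℚ p
    ... | inj₁ 0≤p = ℚ.≤-reflexive (sym (ℚ.0≤p⇒∣p∣≡p 0≤p))
    ... | inj₂ p≤0 = ℚ.≤-trans p≤0 (ℚ.0≤∣p∣ p)

    ∣-∣≤ : ∀ {p c} → p ≤ c → - p ≤ c → ∣ p ∣ ≤ c
    ∣-∣≤ {p} p≤c -p≤c with ℚ.∣p∣≡p∨∣p∣≡-p p
    ... | inj₁ e = subst (_≤ _) (sym e) p≤c
    ... | inj₂ e = subst (_≤ _) (sym e) -p≤c

    ∣p-q∣-sym : ∀ p q → ∣ p - q ∣ ≡ ∣ q - p ∣
    ∣p-q∣-sym p q = trans
      (cong ∣_∣ (solve 2 (λ p q → p :- q := :- (q :- p)) refl p q))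
      (ℚ.∣-p∣≡∣p∣ (q - p))

    ∣-∣-triangle : ∀ p q r → ∣ p - r ∣ ≤ ∣ p - q ∣ + ∣ q - r ∣
    ∣-∣-triangle p q r = subst (λ z → ∣ z ∣ ≤ ∣ p - q ∣ + ∣ q - r ∣)
      (solve 3 (λ p q r → (p :- q) :+ (q :- r) := p :- r) refl p q r)
      (ℚ.∣p+q∣≤∣p∣+∣q∣ (p - q) (q - r))

    ∣∣p∣-∣q∣∣≤∣p-q∣ : ∀ p q → ∣ ∣ p ∣ - ∣ q ∣ ∣ ≤ ∣ p - q ∣
    ∣∣p∣-∣q∣∣≤∣p-q∣ p q = ∣-∣≤ (half p q)
      (subst₂ _≤_ (solve 2 (λ a b → b :- a := :- (a :- b)) refl ∣ p ∣ ∣ q ∣)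
        (∣p-q∣-sym q p) (half q p))
      where
      half : ∀ p q → ∣ p ∣ - ∣ q ∣ ≤ ∣ p - q ∣
      half p q = subst₂ _≤_
        (cong (λ z → ∣ z ∣ - ∣ q ∣) (solve 2 (λ p q → (p :- q) :+ q := p) refl p q))
        (solve 2 (λ a b → a :+ b :- b := a) refl ∣ p - q ∣ ∣ q ∣)
        (ℚ.+-monoˡ-≤ (- ∣ q ∣) (ℚ.∣p+q∣≤∣p∣+∣q∣ (p - q) q))

    inv-inverse : ∀ {p} → p ≢ 0ℚ → p * inv p ≡ 1ℚ
    inv-inverse {p} p≢0 with p ℚ.≟ 0ℚ
    ... | yes p≡0 = contradiction p≡0 p≢0
    ... | no  p≢0′ = ℚ.*-inverseʳ p {{ℚ.≢-nonZero p≢0′}}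

    >⇒≢ : ∀ {p} → 0ℚ < p → p ≢ 0ℚ
    >⇒≢ 0<p p≡0 = ℚ.<⇒≢ 0<p (sym p≡0)

    0<inv : ∀ {p} → 0ℚ < p → 0ℚ < inv p
    0<inv {p} 0<p with p ℚ.≟ 0ℚ
    ... | yes p≡0 = contradiction p≡0 (>⇒≢ 0<p)
    ... | no  p≢0 = ℚ.positive⁻¹ _ {{ℚ.1/pos⇒pos p {{ℚ.positive 0<p}}}}

    inv-anti : ∀ {p q} → 0ℚ < p → p ≤ q → inv q ≤ inv p
    inv-anti {p} {q} 0<p p≤q = subst₂ _≤_
      (trans (cong (_* inv q) (inv-inverse (>⇒≢ 0<p))) (ℚ.*-identityˡ _))
      (trans (solve 3 (λ a b c → a :* b :* c := a :* c :* b) refl q (inv p) (inv q))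
        (trans (cong (_* inv p) (inv-inverse (>⇒≢ 0<q))) (ℚ.*-identityˡ _)))
      (*-monoʳ (ℚ.<⇒≤ (0<inv 0<q)) (*-monoʳ (ℚ.<⇒≤ (0<inv 0<p)) p≤q))
      where
      0<q : 0ℚ < q
      0<q = ℚ.<-≤-trans 0<p p≤q

    inv-diff : ∀ {a b} → 0ℚ < a → 0ℚ < b → inv a - inv b ≡ (b - a) * (inv a * inv b)
    inv-diff {a} {b} 0<a 0<b = trans
      (cong₂ _-_
        (sym (trans (cong (inv a *_) (inv-inverse (>⇒≢ 0<b))) (ℚ.*-identityʳ (inv a))))
        (sym (trans (cong (inv b *_) (inv-inverse (>⇒≢ 0<a))) (ℚ.*-identityʳ (inv b)))))
      (solve 4 (λ a b x y → x :* (b :* y) :- y :* (a :* x) := (b :- a) :* (x :* y)) refl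
        a b (inv a) (inv b))

    fromℕ-suc : ∀ n → fromℕ (suc n) ≡ 1ℚ + fromℕ n
    fromℕ-suc n = ℚ.toℚᵘ-injective (ℚᵘ.≃-trans (ℚ.toℚᵘ-fromℚᵘ (mkℚᵘ (ℤ.+ suc n) 0))
      (ℚᵘ.≃-sym (ℚᵘ.≃-trans (ℚ.toℚᵘ-homo-+ 1ℚ (fromℕ n))
        (ℚᵘ.≃-trans (ℚᵘ.+-congʳ (mkℚᵘ (ℤ.+ 1) 0) (ℚ.toℚᵘ-fromℚᵘ (mkℚᵘ (ℤ.+ n) 0)))
          (*≡* (cong (λ i → (ℤ.+ 1 ℤ.+ i) ℤ.* ℤ.+ 1) (ℤ.*-identityʳ (ℤ.+ n))))))))

    0≤fromℕ : ∀ n → 0ℚ ≤ fromℕ n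
    0≤fromℕ zero    = ℚ.≤-refl
    0≤fromℕ (suc n) = subst (0ℚ ≤_) (sym (fromℕ-suc n)) (0≤+ 0≤1 (0≤fromℕ n))

    0<fromℕ : ∀ n → 0ℚ < fromℕ (suc n)
    0<fromℕ n = subst (0ℚ <_) (sym (fromℕ-suc n)) (ℚ.<-≤-trans 0<1 (p≤p+ (0≤fromℕ n)))

    fromℕ-+ : ∀ m n → fromℕ (m ℕ.+ n) ≡ fromℕ m + fromℕ n
    fromℕ-+ zero    n = sym (ℚ.+-identityˡ _)
    fromℕ-+ (suc m) n = trans (fromℕ-suc (m ℕ.+ n)) (trans (cong (1ℚ +_) (fromℕ-+ m n))
      (trans (sym (ℚ.+-assoc 1ℚ (fromℕ m) (fromℕ n)))
        (cong (_+ fromℕ n) (sym (fromℕ-suc m)))))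

    fromℕ-double : ∀ n → fromℕ (2 ℕ.* n) ≡ fromℕ n + fromℕ n
    fromℕ-double n = trans (fromℕ-+ n (n ℕ.+ 0))
      (cong (λ m → fromℕ n + fromℕ m) (ℕ.+-identityʳ n))

    fromℕ-mono : ∀ {m n} → m ℕ.≤ n → fromℕ m ≤ fromℕ n
    fromℕ-mono {m} {n} m≤n =
      subst (fromℕ m ≤_) (trans (sym (fromℕ-+ m _)) (cong fromℕ (ℕ.m+[n∸m]≡n m≤n)))
        (p≤p+ (0≤fromℕ (n ℕ.∸ m)))

    archimedean : ∀ p → ∃[ n ] p ≤ fromℕ n
    archimedean p@(ℚ.mkℚ i d c) = ℤ.∣ i ∣ , ℚ.≤-trans (p≤∣p∣ p)
      (ℚ.toℚᵘ-cancel-≤ (ℚᵘ.≤-respʳ-≃ (ℚᵘ.≃-sym (ℚ.toℚᵘ-fromℚᵘ (mkℚᵘ (ℤ.+ ℤ.∣ i ∣) 0)))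
        (*≤* (ℤ.*-monoˡ-≤-nonNeg (ℤ.+ ℤ.∣ i ∣) (ℤ.+≤+ (ℕ.s≤s ℕ.z≤n))))))

    0<½^ : ∀ n → 0ℚ < ½^ n
    0<½^ zero    = 0<1
    0<½^ (suc n) = 0<* 0<½ (0<½^ n)

    0≤½^ : ∀ n → 0ℚ ≤ ½^ n
    0≤½^ n = ℚ.<⇒≤ (0<½^ n)

    ½^-suc≤ : ∀ n → ½^ suc n ≤ ½^ n
    ½^-suc≤ n = subst (½^ suc n ≤_) (half+half (½^ n)) (p≤p+ (0≤½^ (suc n)))

    ½^-+≤ : ∀ m n → ½^ (m ℕ.+ n) ≤ ½^ n
    ½^-+≤ zero    n = ℚ.≤-refl
    ½^-+≤ (suc m) n = ℚ.≤-trans (½^-suc≤ (m ℕ.+ n)) (½^-+≤ m n)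

    ½^≤1 : ∀ n → ½^ n ≤ 1ℚ
    ½^≤1 n = subst (λ m → ½^ m ≤ 1ℚ) (ℕ.+-identityʳ n) (½^-+≤ n 0)

    n*½^n≤1 : ∀ n → fromℕ n * ½^ n ≤ 1ℚ
    n*½^n≤1 zero    = 0≤1
    n*½^n≤1 (suc n) = subst₂ _≤_
      (trans (solve 2 (λ a h → con ½ :* h :+ con ½ :* (a :* h)
                            := (con 1ℚ :+ a) :* (con ½ :* h)) refl (fromℕ n) (½^ n))
        (cong (_* ½^ suc n) (sym (fromℕ-suc n))))
      (half+half 1ℚ)
      (ℚ.+-mono-≤ (*-monoˡ 0≤½ (½^≤1 n)) (*-monoˡ 0≤½ (n*½^n≤1 n)))

    2^n*½^n≡1 : ∀ n → fromℕ (2 ℕ.^ n) * ½^ n ≡ 1ℚ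
    2^n*½^n≡1 zero    = refl
    2^n*½^n≡1 (suc n) = trans (cong (_* ½^ suc n) (fromℕ-double (2 ℕ.^ n)))
      (trans (solve 2 (λ a h → (a :+ a) :* (con ½ :* h) := a :* h) refl
                (fromℕ (2 ℕ.^ n)) (½^ n))
        (2^n*½^n≡1 n))

    ½^-small : ∀ c ε → 0ℚ ≤ c → 0ℚ < ε → ∃[ n ] c * ½^ n ≤ ε
    ½^-small c ε 0≤c 0<ε with archimedean (c * inv ε)
    ... | n , cε⁻¹≤n = n , ℚ.≤-trans (*-monoʳ (0≤½^ n) c≤nε)
      (subst₂ _≤_
        (solve 3 (λ a e h → e :* (a :* h) := a :* e :* h) refl (fromℕ n) ε (½^ n))
        (ℚ.*-identityʳ ε)
        (*-monoˡ (ℚ.<⇒≤ 0<ε) (n*½^n≤1 n)))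
      where
      c≤nε : c ≤ fromℕ n * ε
      c≤nε = subst (_≤ fromℕ n * ε)
        (trans (solve 3 (λ c e x → c :* x :* e := c :* (e :* x)) refl c ε (inv ε))
          (trans (cong (c *_) (inv-inverse (>⇒≢ 0<ε))) (ℚ.*-identityʳ c)))
        (*-monoʳ (ℚ.<⇒≤ 0<ε) cε⁻¹≤n)

    sum-mono : ∀ n {f g} → (∀ k → k ℕ.< n → f k ≤ g k) → sum n f ≤ sum n g
    sum-mono zero    f≤g = ℚ.≤-refl
    sum-mono (suc n) f≤g = ℚ.+-mono-≤
      (sum-mono n (λ k k<n → f≤g k (ℕ.m<n⇒m<1+n k<n))) (f≤g n (ℕ.n<1+n n))

    sum-∣-∣ : ∀ n {f g h} → (∀ k → k ℕ.< n → ∣ f k - g k ∣ ≤ h k) →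
              ∣ sum n f - sum n g ∣ ≤ sum n h
    sum-∣-∣ zero            _ = ℚ.≤-refl
    sum-∣-∣ (suc n) {f} {g} b = ℚ.≤-trans
      (subst (λ z → ∣ z ∣ ≤ ∣ sum n f - sum n g ∣ + ∣ f n - g n ∣)
        (solve 4 (λ a b c d → (a :- b) :+ (c :- d) := (a :+ c) :- (b :+ d)) refl
          (sum n f) (sum n g) (f n) (g n))
        (ℚ.∣p+q∣≤∣p∣+∣q∣ (sum n f - sum n g) (f n - g n)))
      (ℚ.+-mono-≤ (sum-∣-∣ n (λ k k<n → b k (ℕ.m<n⇒m<1+n k<n))) (b n (ℕ.n<1+n n)))

    sum-const : ∀ n c → sum n (λ _ → c) ≡ fromℕ n * c
    sum-const zero    c = sym (ℚ.*-zeroˡ c)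
    sum-const (suc n) c = trans (cong (_+ c) (sum-const n c))
      (trans (solve 2 (λ a c → a :* c :+ c := (con 1ℚ :+ a) :* c) refl (fromℕ n) c)
        (cong (_* c) (sym (fromℕ-suc n))))

    sum-scale : ∀ n c f → sum n (λ k → c * f k) ≡ c * sum n f
    sum-scale zero    c f = sym (ℚ.*-zeroʳ c)
    sum-scale (suc n) c f = trans (cong (_+ c * f n) (sum-scale n c f))
      (sym (ℚ.*-distribˡ-+ c (sum n f) (f n)))

    sum-double : ∀ n f → sum (2 ℕ.* n) f ≡ sum n (λ k → f (2 ℕ.* k) + f (suc (2 ℕ.* k)))
    sum-double zero    f = refl
    sum-double (suc n) f = trans (cong (λ m → sum m f) (ℕ.*-suc 2 n))
      (trans (ℚ.+-assoc (sum (2 ℕ.* n) f) (f (2 ℕ.* n)) (f (suc (2 ℕ.* n))))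
        (cong (_+ (f (2 ℕ.* n) + f (suc (2 ℕ.* n)))) (sum-double n f)))

  IsCauchy : (ℕ → ℚ) → Set
  IsCauchy s = ∀ ε → 0ℚ < ε → ∃[ N ] ∀ m n → N ℕ.≤ m → N ℕ.≤ n → ∣ s m - s n ∣ ≤ ε

  abstract

    0<half : ∀ {ε} → 0ℚ < ε → 0ℚ < ½ * ε
    0<half = 0<* 0<½

    cauchy-from : ∀ s → (∀ ε → 0ℚ < ε → ∃[ N ] ∀ n → N ℕ.≤ n → ∣ s n - s N ∣ ≤ ε) →
                  IsCauchy s
    cauchy-from s near ε 0<ε with near (½ * ε) (0<half 0<ε)
    ... | N , near-N = N , λ m n N≤m N≤n → ℚ.≤-trans (∣-∣-triangle (s m) (s N) (s n))
      (subst (∣ s m - s N ∣ + ∣ s N - s n ∣ ≤_) (half+half ε)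
        (ℚ.+-mono-≤ (near-N m N≤m)
          (subst (_≤ ½ * ε) (∣p-q∣-sym (s n) (s N)) (near-N n N≤n))))

    cauchy-const : ∀ p → IsCauchy (λ _ → p)
    cauchy-const p ε 0<ε = 0 , λ _ _ _ _ →
      subst (λ z → ∣ z ∣ ≤ ε) (sym (ℚ.+-inverseʳ p)) (ℚ.<⇒≤ 0<ε)

    cauchy-contract : ∀ {s t} → (∀ m n → ∣ t m - t n ∣ ≤ ∣ s m - s n ∣) →
                      IsCauchy s → IsCauchy t
    cauchy-contract t≤s cs ε 0<ε with cs ε 0<ε
    ... | N , near = N , λ m n N≤m N≤n → ℚ.≤-trans (t≤s m n) (near m n N≤m N≤n)

    cauchy-neg : ∀ {s} → IsCauchy s → IsCauchy (λ n → - s n)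
    cauchy-neg {s} = cauchy-contract {s} {λ n → - s n} λ m n → ℚ.≤-reflexive
      (trans (cong ∣_∣ (solve 2 (λ a b → :- a :- :- b := :- (a :- b)) refl (s m) (s n)))
        (ℚ.∣-p∣≡∣p∣ (s m - s n)))

    cauchy-abs : ∀ {s} → IsCauchy s → IsCauchy (λ n → ∣ s n ∣)
    cauchy-abs {s} = cauchy-contract {s} {λ n → ∣ s n ∣} λ m n → ∣∣p∣-∣q∣∣≤∣p-q∣ (s m) (s n)

    cauchy-+ : ∀ {s t} → IsCauchy s → IsCauchy t → IsCauchy (λ n → s n + t n)
    cauchy-+ {s} {t} cs ct ε 0<ε with cs (½ * ε) (0<half 0<ε) | ct (½ * ε) (0<half 0<ε)
    ... | N₁ , near₁ | N₂ , near₂ = N₁ ℕ.⊔ N₂ , λ m n N≤m N≤n → subst (_ ≤_)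
      (half+half ε)
      (ℚ.≤-trans
        (subst (λ z → ∣ z ∣ ≤ ∣ s m - s n ∣ + ∣ t m - t n ∣)
          (solve 4 (λ a b c d → (a :- b) :+ (c :- d) := (a :+ c) :- (b :+ d)) refl
            (s m) (s n) (t m) (t n))
          (ℚ.∣p+q∣≤∣p∣+∣q∣ (s m - s n) (t m - t n)))
        (ℚ.+-mono-≤
          (near₁ m n (ℕ.m⊔n≤o⇒m≤o N₁ N₂ N≤m) (ℕ.m⊔n≤o⇒m≤o N₁ N₂ N≤n))
          (near₂ m n (ℕ.m⊔n≤o⇒n≤o N₁ N₂ N≤m) (ℕ.m⊔n≤o⇒n≤o N₁ N₂ N≤n))))

    cauchy-bounded : ∀ {s} → IsCauchy s →
                     ∃[ M ] ∃[ N ] 1ℚ ≤ M × (∀ n → N ℕ.≤ n → ∣ s n ∣ ≤ M)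
    cauchy-bounded {s} cs with cs 1ℚ 0<1
    ... | N , near = 1ℚ + ∣ s N ∣ , N , p≤p+ (ℚ.0≤∣p∣ (s N)) , λ n N≤n → ℚ.≤-trans
      (subst (λ z → ∣ z ∣ ≤ ∣ s n - s N ∣ + ∣ s N ∣)
        (solve 2 (λ a b → (a :- b) :+ b := a) refl (s n) (s N))
        (ℚ.∣p+q∣≤∣p∣+∣q∣ (s n - s N) (s N)))
      (ℚ.+-monoˡ-≤ ∣ s N ∣ (near n N N≤n ℕ.≤-refl))

    -- ε / (1 + B), so that B times it is at most ε
    shrink : ∀ {B ε} → 0ℚ ≤ B → 0ℚ < ε → ∃[ η ] 0ℚ < η × B * η ≤ ε
    shrink {B} {ε} 0≤B 0<ε = ε * inv (1ℚ + B) , 0<* 0<ε (0<inv 0<1+B) ,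
      subst (B * (ε * inv (1ℚ + B)) ≤_)
        (trans (solve 3 (λ b e x → b :* (e :* x) := e :* (b :* x)) refl
                 (1ℚ + B) ε (inv (1ℚ + B)))
          (trans (cong (ε *_) (inv-inverse (>⇒≢ 0<1+B))) (ℚ.*-identityʳ ε)))
        (*-monoʳ (0≤* (ℚ.<⇒≤ 0<ε) (ℚ.<⇒≤ (0<inv 0<1+B)))
          (subst (B ≤_) (ℚ.+-comm B 1ℚ) (p≤p+ 0≤1)))
      where
      0<1+B : 0ℚ < 1ℚ + B
      0<1+B = ℚ.<-≤-trans 0<1 (p≤p+ 0≤B)

    -- If the maps f n are Lipschitz on D uniformly in n and converge
    -- geometrically there, then n ↦ f n (s n) is Cauchy.
    cauchy-diagonal :
      (f : ℕ → ℚ → ℚ) {s : ℕ → ℚ} → IsCauchy s →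
      (D : ℚ → Set) (N₀ : ℕ) → (∀ n → N₀ ℕ.≤ n → D (s n)) →
      (A B : ℚ) → 0ℚ ≤ A → 0ℚ ≤ B → (N₁ : ℕ) →
      (∀ t → D t → ∀ d → ∣ f (suc (d ℕ.+ N₁)) t - f (d ℕ.+ N₁) t ∣ ≤ A * ½^ d) →
      (∀ t u → D t → D u → ∀ d → ∣ f (d ℕ.+ N₁) t - f (d ℕ.+ N₁) u ∣ ≤ B * ∣ t - u ∣) →
      IsCauchy (λ n → f n (s n))
    cauchy-diagonal f {s} cs D N₀ s∈D A B 0≤A 0≤B N₁ step lip = cauchy-from (λ n → f n (s n)) near
      where
      0≤A+A : 0ℚ ≤ A + A
      0≤A+A = 0≤+ 0≤A 0≤A

      tail′ : ∀ t → D t → ∀ d e →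
              ∣ f (e ℕ.+ (d ℕ.+ N₁)) t - f (d ℕ.+ N₁) t ∣ + (A + A) * ½^ (e ℕ.+ d)
              ≤ (A + A) * ½^ d
      tail′ t t∈D d zero = ℚ.≤-reflexive
        (trans (cong (λ z → ∣ z ∣ + (A + A) * ½^ d) (ℚ.+-inverseʳ (f (d ℕ.+ N₁) t)))
          (ℚ.+-identityˡ _))
      tail′ t t∈D d (suc e) = ℚ.≤-trans
        (ℚ.+-monoˡ-≤ ((A + A) * ½^ suc (e ℕ.+ d)) (ℚ.≤-trans
          (∣-∣-triangle (f (suc (e ℕ.+ (d ℕ.+ N₁))) t) (f (e ℕ.+ (d ℕ.+ N₁)) t) (f (d ℕ.+ N₁) t))
          (ℚ.+-monoˡ-≤ P
            (subst (λ m → ∣ f (suc m) t - f m t ∣ ≤ A * ½^ (e ℕ.+ d))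
              (ℕ.+-assoc e d N₁) (step t t∈D (e ℕ.+ d))))))
        (subst (_≤ (A + A) * ½^ d)
          (solve 3 (λ a h p → p :+ (a :+ a) :* h
                           := a :* h :+ p :+ (a :+ a) :* (con ½ :* h)) refl
            A (½^ (e ℕ.+ d)) P)
          (tail′ t t∈D d e))
        where
        P : ℚ
        P = ∣ f (e ℕ.+ (d ℕ.+ N₁)) t - f (d ℕ.+ N₁) t ∣

      tail : ∀ t → D t → ∀ d e →
             ∣ f (e ℕ.+ (d ℕ.+ N₁)) t - f (d ℕ.+ N₁) t ∣ ≤ (A + A) * ½^ d
      tail t t∈D d e = ℚ.≤-trans (p≤p+ (0≤* 0≤A+A (0≤½^ (e ℕ.+ d)))) (tail′ t t∈D d e)

      near : ∀ ε → 0ℚ < ε → ∃[ N ] ∀ n → N ℕ.≤ n → ∣ f n (s n) - f N (s N) ∣ ≤ ε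
      near ε 0<ε = d ℕ.+ N₁ , bound
        where
        small : ∃[ n ] (A + A) * ½^ n ≤ ½ * ε
        small = ½^-small (A + A) (½ * ε) 0≤A+A (0<half 0<ε)

        η : ∃[ η ] 0ℚ < η × B * η ≤ ½ * ε
        η = shrink 0≤B (0<half 0<ε)

        close : ∃[ N ] ∀ m n → N ℕ.≤ m → N ℕ.≤ n → ∣ s m - s n ∣ ≤ proj₁ η
        close = cs (proj₁ η) (proj₁ (proj₂ η))

        d : ℕ
        d = N₀ ℕ.+ proj₁ close ℕ.+ proj₁ small

        N₀≤N : N₀ ℕ.≤ d ℕ.+ N₁
        N₀≤N = ℕ.≤-trans (ℕ.m≤m+n N₀ (proj₁ close))
          (ℕ.≤-trans (ℕ.m≤m+n (N₀ ℕ.+ proj₁ close) (proj₁ small)) (ℕ.m≤m+n d N₁))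

        N₂≤N : proj₁ close ℕ.≤ d ℕ.+ N₁
        N₂≤N = ℕ.≤-trans (ℕ.m≤n+m (proj₁ close) N₀)
          (ℕ.≤-trans (ℕ.m≤m+n (N₀ ℕ.+ proj₁ close) (proj₁ small)) (ℕ.m≤m+n d N₁))

        bound : ∀ n → d ℕ.+ N₁ ℕ.≤ n → ∣ f n (s n) - f (d ℕ.+ N₁) (s (d ℕ.+ N₁)) ∣ ≤ ε
        bound n N≤n = ℚ.≤-trans (∣-∣-triangle (f n (s n)) (f N (s n)) (f N (s N)))
          (subst (∣ f n (s n) - f N (s n) ∣ + ∣ f N (s n) - f N (s N) ∣ ≤_) (half+half ε)
            (ℚ.+-mono-≤
              (ℚ.≤-trans
                (subst (λ m → ∣ f m (s n) - f N (s n) ∣ ≤ (A + A) * ½^ d)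
                  (ℕ.m∸n+n≡m N≤n) (tail (s n) n∈D d (n ℕ.∸ N)))
                (ℚ.≤-trans
                  (*-monoˡ 0≤A+A (½^-+≤ (N₀ ℕ.+ proj₁ close) (proj₁ small))) (proj₂ small)))
              (ℚ.≤-trans (lip (s n) (s N) n∈D (s∈D N N₀≤N) d)
                (ℚ.≤-trans
                  (*-monoˡ 0≤B (proj₂ close n N (ℕ.≤-trans N₂≤N N≤n) N₂≤N))
                  (proj₂ (proj₂ η))))))
          where
          N : ℕ
          N = d ℕ.+ N₁
          n∈D : D (s n)
          n∈D = s∈D n (ℕ.≤-trans N₀≤N N≤n)

    product-diff : ∀ a b c d {ε M₁ M₂ η₁ η₂} → 0ℚ ≤ M₁ → 0ℚ ≤ M₂ →
                   ∣ c ∣ ≤ M₁ → ∣ b ∣ ≤ M₂ → ∣ a - c ∣ ≤ η₁ → ∣ b - d ∣ ≤ η₂ →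
                   M₂ * η₁ ≤ ½ * ε → M₁ * η₂ ≤ ½ * ε → ∣ a * b - c * d ∣ ≤ ε
    product-diff a b c d {ε} 0≤M₁ 0≤M₂ c≤M₁ b≤M₂ ac bd le₁ le₂ = subst (λ z → ∣ z ∣ ≤ ε)
      (solve 4 (λ a b c d → b :* (a :- c) :+ c :* (b :- d) := a :* b :- c :* d) refl a b c d)
      (ℚ.≤-trans (ℚ.∣p+q∣≤∣p∣+∣q∣ (b * (a - c)) (c * (b - d)))
        (subst (∣ b * (a - c) ∣ + ∣ c * (b - d) ∣ ≤_) (half+half ε)
          (ℚ.+-mono-≤
            (subst (_≤ ½ * ε) (sym (ℚ.∣p*q∣≡∣p∣*∣q∣ b (a - c)))
              (ℚ.≤-trans (*-mono 0≤M₂ (ℚ.0≤∣p∣ (a - c)) b≤M₂ ac) le₁))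
            (subst (_≤ ½ * ε) (sym (ℚ.∣p*q∣≡∣p∣*∣q∣ c (b - d)))
              (ℚ.≤-trans (*-mono 0≤M₁ (ℚ.0≤∣p∣ (b - d)) c≤M₁ bd) le₂)))))

    cauchy-* : ∀ {s t} → IsCauchy s → IsCauchy t → IsCauchy (λ n → s n * t n)
    cauchy-* {s} {t} cs ct ε 0<ε =
      from (cauchy-bounded {s} cs) (cauchy-bounded {t} ct)
      where
      from : ∃[ M ] ∃[ N ] 1ℚ ≤ M × (∀ n → N ℕ.≤ n → ∣ s n ∣ ≤ M) →
             ∃[ M ] ∃[ N ] 1ℚ ≤ M × (∀ n → N ℕ.≤ n → ∣ t n ∣ ≤ M) →
             ∃[ N ] ∀ m n → N ℕ.≤ m → N ℕ.≤ n → ∣ s m * t m - s n * t n ∣ ≤ ε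
      from (M₁ , N₁ , 1≤M₁ , s≤M₁) (M₂ , N₂ , 1≤M₂ , t≤M₂) =
        N₁ ℕ.+ N₂ ℕ.+ (proj₁ close₁ ℕ.+ proj₁ close₂) , λ m n N≤m N≤n →
          product-diff (s m) (t m) (s n) (t n) 0≤M₁ 0≤M₂
            (s≤M₁ n (ℕ.m+n≤o⇒m≤o N₁ (ℕ.m+n≤o⇒m≤o (N₁ ℕ.+ N₂) N≤n)))
            (t≤M₂ m (ℕ.m+n≤o⇒n≤o N₁ (ℕ.m+n≤o⇒m≤o (N₁ ℕ.+ N₂) N≤m)))
            (proj₂ close₁ m n
              (ℕ.m+n≤o⇒m≤o (proj₁ close₁) (ℕ.m+n≤o⇒n≤o (N₁ ℕ.+ N₂) N≤m))
              (ℕ.m+n≤o⇒m≤o (proj₁ close₁) (ℕ.m+n≤o⇒n≤o (N₁ ℕ.+ N₂) N≤n)))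
            (proj₂ close₂ m n
              (ℕ.m+n≤o⇒n≤o (proj₁ close₁) (ℕ.m+n≤o⇒n≤o (N₁ ℕ.+ N₂) N≤m))
              (ℕ.m+n≤o⇒n≤o (proj₁ close₁) (ℕ.m+n≤o⇒n≤o (N₁ ℕ.+ N₂) N≤n)))
            (proj₂ (proj₂ η₁)) (proj₂ (proj₂ η₂))
        where
        0≤M₁ : 0ℚ ≤ M₁
        0≤M₁ = ℚ.≤-trans 0≤1 1≤M₁
        0≤M₂ : 0ℚ ≤ M₂
        0≤M₂ = ℚ.≤-trans 0≤1 1≤M₂
        η₁ : ∃[ η ] 0ℚ < η × M₂ * η ≤ ½ * ε
        η₁ = shrink 0≤M₂ (0<half 0<ε)
        η₂ : ∃[ η ] 0ℚ < η × M₁ * η ≤ ½ * ε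
        η₂ = shrink 0≤M₁ (0<half 0<ε)
        close₁ : ∃[ N ] ∀ m n → N ℕ.≤ m → N ℕ.≤ n → ∣ s m - s n ∣ ≤ proj₁ η₁
        close₁ = cs (proj₁ η₁) (proj₁ (proj₂ η₁))
        close₂ : ∃[ N ] ∀ m n → N ℕ.≤ m → N ℕ.≤ n → ∣ t m - t n ∣ ≤ proj₁ η₂
        close₂ = ct (proj₁ η₂) (proj₁ (proj₂ η₂))

    cauchy-inv : ∀ {s} → IsCauchy s → ∀ δ → 0ℚ < δ → ∀ N → (∀ n → N ℕ.≤ n → δ ≤ s n) →
                 IsCauchy (λ n → inv (s n))
    cauchy-inv {s} cs δ 0<δ N δ≤s =
      cauchy-diagonal (λ _ → inv) cs (δ ≤_) N δ≤s 0ℚ (inv δ * inv δ)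
        ℚ.≤-refl (0≤* 0≤inv 0≤inv) 0
        (λ t _ d → ℚ.≤-reflexive
          (trans (cong ∣_∣ (ℚ.+-inverseʳ (inv t))) (sym (ℚ.*-zeroˡ (½^ d)))))
        (λ t u δ≤t δ≤u _ → inv-lipschitz δ≤t δ≤u)
      where
      0≤inv : 0ℚ ≤ inv δ
      0≤inv = ℚ.<⇒≤ (0<inv 0<δ)

      inv-lipschitz : ∀ {t u} → δ ≤ t → δ ≤ u →
                      ∣ inv t - inv u ∣ ≤ inv δ * inv δ * ∣ t - u ∣
      inv-lipschitz {t} {u} δ≤t δ≤u = subst₂ _≤_
        (sym (trans (cong ∣_∣ (inv-diff 0<t 0<u)) (trans (ℚ.∣p*q∣≡∣p∣*∣q∣ (u - t) _)
          (cong₂ _*_ (∣p-q∣-sym u t) (ℚ.0≤p⇒∣p∣≡p (0≤* 0≤t⁻¹ 0≤u⁻¹))))))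
        (ℚ.*-comm ∣ t - u ∣ (inv δ * inv δ))
        (*-monoˡ (ℚ.0≤∣p∣ (t - u)) (*-mono 0≤inv 0≤u⁻¹ (inv-anti 0<δ δ≤t) (inv-anti 0<δ δ≤u)))
        where
        0<t : 0ℚ < t
        0<t = ℚ.<-≤-trans 0<δ δ≤t
        0<u : 0ℚ < u
        0<u = ℚ.<-≤-trans 0<δ δ≤u
        0≤t⁻¹ : 0ℚ ≤ inv t
        0≤t⁻¹ = ℚ.<⇒≤ (0<inv 0<t)
        0≤u⁻¹ : 0ℚ ≤ inv u
        0≤u⁻¹ = ℚ.<⇒≤ (0<inv 0<u)

    -- expTerm M k bounds ∣ expTerm t k ∣ for ∣ t ∣ ≤ M, and decays
    -- geometrically as soon as k ≥ 2 M.
    module ExpBounds {M : ℚ} (0≤M : 0ℚ ≤ M) where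

      r : ℕ → ℚ
      r k = inv (fromℕ (suc k))

      0≤r : ∀ k → 0ℚ ≤ r k
      0≤r k = ℚ.<⇒≤ (0<inv (0<fromℕ k))

      r-inverse : ∀ k → fromℕ (suc k) * r k ≡ 1ℚ
      r-inverse k = inv-inverse (>⇒≢ (0<fromℕ k))

      0≤term : ∀ k → 0ℚ ≤ expTerm M k
      0≤term zero    = 0≤1
      0≤term (suc k) = 0≤* (0≤term k) (0≤* 0≤M (0≤r k))

      term-bound : ∀ {t} → ∣ t ∣ ≤ M → ∀ k → ∣ expTerm t k ∣ ≤ expTerm M k
      term-bound t≤M zero = ℚ.≤-refl
      term-bound {t} t≤M (suc k) = subst (_≤ expTerm M (suc k))
        (sym (trans (ℚ.∣p*q∣≡∣p∣*∣q∣ (expTerm t k) (t * r k))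
          (cong (∣ expTerm t k ∣ *_) (trans (ℚ.∣p*q∣≡∣p∣*∣q∣ t (r k))
            (cong (∣ t ∣ *_) (ℚ.0≤p⇒∣p∣≡p (0≤r k)))))))
        (*-mono (0≤term k) (0≤* (ℚ.0≤∣p∣ t) (0≤r k)) (term-bound t≤M k)
          (*-monoʳ (0≤r k) t≤M))

      deriv : ℕ → ℚ
      deriv zero    = 0ℚ
      deriv (suc k) = expTerm M k

      0≤deriv : ∀ k → 0ℚ ≤ deriv k
      0≤deriv zero    = ℚ.≤-refl
      0≤deriv (suc k) = 0≤term k

      M*deriv : ∀ k → M * deriv k ≡ fromℕ k * expTerm M k
      M*deriv zero    = trans (ℚ.*-zeroʳ M) (sym (ℚ.*-zeroˡ (expTerm M zero)))
      M*deriv (suc k) = sym (trans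
        (solve 4 (λ n e m r → n :* (e :* (m :* r)) := m :* e :* (n :* r)) refl
          (fromℕ (suc k)) (expTerm M k) M (r k))
        (trans (cong (M * expTerm M k *_) (r-inverse k)) (ℚ.*-identityʳ _)))

      term-lipschitz : ∀ {t u} → ∣ t ∣ ≤ M → ∣ u ∣ ≤ M → ∀ k →
                       ∣ expTerm t k - expTerm u k ∣ ≤ ∣ t - u ∣ * deriv k
      term-lipschitz {t} {u} t≤M u≤M zero = ℚ.≤-reflexive (sym (ℚ.*-zeroʳ ∣ t - u ∣))
      term-lipschitz {t} {u} t≤M u≤M (suc k) = subst₂ _≤_ lhs rhs
        (*-monoˡ (0≤r k) (ℚ.≤-trans (ℚ.∣p+q∣≤∣p∣+∣q∣ (a * (t - u)) ((a - b) * u))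
          (ℚ.+-mono-≤
            (subst (_≤ expTerm M k * ∣ t - u ∣) (sym (ℚ.∣p*q∣≡∣p∣*∣q∣ a (t - u)))
              (*-monoʳ (ℚ.0≤∣p∣ (t - u)) (term-bound t≤M k)))
            (subst (_≤ ∣ t - u ∣ * deriv k * M) (sym (ℚ.∣p*q∣≡∣p∣*∣q∣ (a - b) u))
              (*-mono (0≤* (ℚ.0≤∣p∣ (t - u)) (0≤deriv k)) (ℚ.0≤∣p∣ u)
                (term-lipschitz t≤M u≤M k) u≤M)))))
        where
        a b : ℚ
        a = expTerm t k
        b = expTerm u k

        lhs : r k * ∣ a * (t - u) + (a - b) * u ∣ ≡ ∣ a * (t * r k) - b * (u * r k) ∣
        lhs = trans (cong (_* ∣ a * (t - u) + (a - b) * u ∣) (sym (ℚ.0≤p⇒∣p∣≡p (0≤r k))))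
          (trans (sym (ℚ.∣p*q∣≡∣p∣*∣q∣ (r k) _))
            (cong ∣_∣ (solve 5 (λ r a b t u → r :* (a :* (t :- u) :+ (a :- b) :* u)
                                        := a :* (t :* r) :- b :* (u :* r)) refl
              (r k) a b t u)))

        rhs : r k * (expTerm M k * ∣ t - u ∣ + ∣ t - u ∣ * deriv k * M)
              ≡ ∣ t - u ∣ * expTerm M k
        rhs = trans
          (solve 5 (λ r e x d m → r :* (e :* x :+ x :* d :* m)
                              := r :* x :* (e :+ m :* d)) refl
            (r k) (expTerm M k) ∣ t - u ∣ (deriv k) M)
          (trans (cong (λ z → r k * ∣ t - u ∣ * (expTerm M k + z)) (M*deriv k))
            (trans
              (solve 4 (λ r x e n → r :* x :* (e :+ n :* e)
                                := x :* e :* ((con 1ℚ :+ n) :* r)) refl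
                (r k) ∣ t - u ∣ (expTerm M k) (fromℕ k))
              (trans (cong (λ n → ∣ t - u ∣ * expTerm M k * (n * r k)) (sym (fromℕ-suc k)))
                (trans (cong (∣ t - u ∣ * expTerm M k *_) (r-inverse k))
                  (ℚ.*-identityʳ _)))))

      sum-deriv : ∀ n → sum (suc n) deriv ≡ sum n (expTerm M)
      sum-deriv zero    = refl
      sum-deriv (suc n) = cong (_+ expTerm M n) (sum-deriv n)

      sum-lipschitz : ∀ {t u} → ∣ t ∣ ≤ M → ∣ u ∣ ≤ M → ∀ n →
                      ∣ expSum n t - expSum n u ∣ ≤ ∣ t - u ∣ * expSum n M
      sum-lipschitz {t} {u} t≤M u≤M n = ℚ.≤-trans
        (sum-∣-∣ n (λ k _ → term-lipschitz t≤M u≤M k))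
        (subst (_≤ ∣ t - u ∣ * expSum n M) (sym (sum-scale n ∣ t - u ∣ deriv))
          (*-monoˡ (ℚ.0≤∣p∣ (t - u))
            (subst (sum n deriv ≤_) (sum-deriv n) (p≤p+ (0≤deriv n)))))

      module _ (N : ℕ) (2M≤N : M + M ≤ fromℕ N) where

        M*r≤½ : ∀ d → M * r (d ℕ.+ N) ≤ ½
        M*r≤½ d = subst₂ _≤_
          (solve 2 (λ m r → con ½ :* (m :+ m) :* r := m :* r) refl M (r (d ℕ.+ N)))
          (trans (ℚ.*-assoc ½ (fromℕ (suc (d ℕ.+ N))) (r (d ℕ.+ N)))
            (cong (½ *_) (r-inverse (d ℕ.+ N))))
          (*-monoʳ (0≤r (d ℕ.+ N)) (*-monoˡ 0≤½ (ℚ.≤-trans 2M≤N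
            (fromℕ-mono (ℕ.m≤n⇒m≤1+n (ℕ.m≤n+m N d))))))

        term-decay : ∀ d → expTerm M (d ℕ.+ N) ≤ expTerm M N * ½^ d
        term-decay zero    = ℚ.≤-reflexive (sym (ℚ.*-identityʳ (expTerm M N)))
        term-decay (suc d) = subst (expTerm M (suc (d ℕ.+ N)) ≤_)
          (solve 2 (λ e h → e :* h :* con ½ := e :* (con ½ :* h)) refl (expTerm M N) (½^ d))
          (*-mono (0≤* (0≤term N) (0≤½^ d)) (0≤* 0≤M (0≤r (d ℕ.+ N)))
            (term-decay d) (M*r≤½ d))

        A : ℚ
        A = expTerm M N

        sum-bounded′ : ∀ d → expSum (d ℕ.+ N) M + (A + A) * ½^ d ≤ expSum N M + (A + A)
        sum-bounded′ zero    = ℚ.≤-reflexive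
          (cong (expSum N M +_) (ℚ.*-identityʳ (A + A)))
        sum-bounded′ (suc d) = ℚ.≤-trans
          (ℚ.+-monoˡ-≤ ((A + A) * ½^ suc d)
            (ℚ.+-monoʳ-≤ (expSum (d ℕ.+ N) M) (term-decay d)))
          (subst (_≤ expSum N M + (A + A))
            (solve 3 (λ s a h → s :+ (a :+ a) :* h
                             := s :+ a :* h :+ (a :+ a) :* (con ½ :* h)) refl
              (expSum (d ℕ.+ N) M) A (½^ d))
            (sum-bounded′ d))

        0≤A+A : 0ℚ ≤ A + A
        0≤A+A = 0≤+ (0≤term N) (0≤term N)

        sum-bounded : ∀ d → expSum (d ℕ.+ N) M ≤ expSum N M + (A + A)
        sum-bounded d = ℚ.≤-trans (p≤p+ (0≤* 0≤A+A (0≤½^ d))) (sum-bounded′ d)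

        0≤sum : ∀ n → 0ℚ ≤ expSum n M
        0≤sum zero    = ℚ.≤-refl
        0≤sum (suc n) = 0≤+ (0≤sum n) (0≤term n)

        diagonal : ∀ {s} → IsCauchy s → ∀ N₀ → (∀ n → N₀ ℕ.≤ n → ∣ s n ∣ ≤ M) →
                   IsCauchy (λ n → expSum n (s n))
        diagonal {s} cs N₀ s≤M = cauchy-diagonal expSum {s} cs (λ t → ∣ t ∣ ≤ M) N₀ s≤M
          A (expSum N M + (A + A)) (0≤term N) (0≤+ (0≤sum N) 0≤A+A) N
          (λ t t≤M d → subst (λ z → ∣ z ∣ ≤ A * ½^ d)
            (solve 2 (λ s e → e := s :+ e :- s) refl
              (expSum (d ℕ.+ N) t) (expTerm t (d ℕ.+ N)))
            (ℚ.≤-trans (term-bound t≤M (d ℕ.+ N)) (term-decay d)))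
          (λ t u t≤M u≤M d → subst (∣ expSum (d ℕ.+ N) t - expSum (d ℕ.+ N) u ∣ ≤_)
            (ℚ.*-comm ∣ t - u ∣ (expSum N M + (A + A)))
            (ℚ.≤-trans (sum-lipschitz t≤M u≤M (d ℕ.+ N))
              (*-monoˡ (ℚ.0≤∣p∣ (t - u)) (sum-bounded d))))

    cauchy-exp : ∀ {s} → IsCauchy s → IsCauchy (λ n → expSum n (s n))
    cauchy-exp {s} cs = from (cauchy-bounded {s} cs)
      where
      from : ∃[ M ] ∃[ N ] 1ℚ ≤ M × (∀ n → N ℕ.≤ n → ∣ s n ∣ ≤ M) →
             IsCauchy (λ n → expSum n (s n))
      from (M , N₀ , 1≤M , s≤M) =
        ExpBounds.diagonal (ℚ.≤-trans 0≤1 1≤M)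
          (proj₁ (archimedean (M + M))) (proj₂ (archimedean (M + M))) {s} cs N₀ s≤M

    -- Points 1 + k w of the partition of [1, t], where w = (t - 1) / 2ⁿ.
    module LnBounds {δ M : ℚ} (0<δ : 0ℚ < δ) (δ≤1 : δ ≤ 1ℚ) (1≤M : 1ℚ ≤ M) (n : ℕ) where

      width : ℚ → ℚ
      width t = (t - 1ℚ) * ½^ n

      point : ℚ → ℕ → ℚ
      point t k = 1ℚ + fromℕ k * width t

      point-convex : ∀ t k → point t k ≡ (1ℚ - fromℕ k * ½^ n) + fromℕ k * ½^ n * t
      point-convex t k = solve 3
        (λ t k h → con 1ℚ :+ k :* ((t :- con 1ℚ) :* h) := (con 1ℚ :- k :* h) :+ k :* h :* t)
        refl t (fromℕ k) (½^ n)

      0≤ratio : ∀ k → 0ℚ ≤ fromℕ k * ½^ n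
      0≤ratio k = 0≤* (0≤fromℕ k) (0≤½^ n)

      ratio≤1 : ∀ {k} → k ℕ.≤ 2 ℕ.^ n → fromℕ k * ½^ n ≤ 1ℚ
      ratio≤1 {k} k≤2^n = subst (fromℕ k * ½^ n ≤_) (2^n*½^n≡1 n)
        (*-monoʳ (0≤½^ n) (fromℕ-mono k≤2^n))

      δ≤point : ∀ {t k} → δ ≤ t → k ℕ.≤ 2 ℕ.^ n → δ ≤ point t k
      δ≤point {t} {k} δ≤t k≤2^n = subst₂ _≤_
        (solve 2 (λ d l → (con 1ℚ :- l) :* d :+ l :* d := d) refl δ (fromℕ k * ½^ n))
        (trans (cong (_+ fromℕ k * ½^ n * t) (ℚ.*-identityʳ (1ℚ - fromℕ k * ½^ n)))
          (sym (point-convex t k)))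
        (ℚ.+-mono-≤ (*-monoˡ (≤⇒0≤- (ratio≤1 k≤2^n)) δ≤1) (*-monoˡ (0≤ratio k) δ≤t))

      point≤t : ∀ {t k} → 1ℚ ≤ t → k ℕ.≤ 2 ℕ.^ n → point t k ≤ t
      point≤t {t} {k} 1≤t k≤2^n = subst₂ _≤_
        (sym (trans (point-convex t k)
          (cong (_+ fromℕ k * ½^ n * t) (sym (ℚ.*-identityʳ (1ℚ - fromℕ k * ½^ n))))))
        (solve 2 (λ t l → (con 1ℚ :- l) :* t :+ l :* t := t) refl t (fromℕ k * ½^ n))
        (ℚ.+-monoˡ-≤ (fromℕ k * ½^ n * t) (*-monoˡ (≤⇒0≤- (ratio≤1 k≤2^n)) 1≤t))

      C : ℚ
      C = inv δ * inv δ

      0≤δ⁻¹ : 0ℚ ≤ inv δ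
      0≤δ⁻¹ = ℚ.<⇒≤ (0<inv 0<δ)

      0≤C : 0ℚ ≤ C
      0≤C = 0≤* 0≤δ⁻¹ 0≤δ⁻¹

      ∣z*inv*inv∣ : ∀ z {a b} → δ ≤ a → δ ≤ b → ∣ z * (inv a * inv b) ∣ ≤ ∣ z ∣ * C
      ∣z*inv*inv∣ z {a} {b} δ≤a δ≤b = subst (_≤ ∣ z ∣ * C)
        (sym (trans (ℚ.∣p*q∣≡∣p∣*∣q∣ z (inv a * inv b))
          (cong (∣ z ∣ *_) (ℚ.0≤p⇒∣p∣≡p (0≤* (0≤inv δ≤a) (0≤inv δ≤b))))))
        (*-monoˡ (ℚ.0≤∣p∣ z)
          (*-mono 0≤δ⁻¹ (0≤inv δ≤b) (inv-anti 0<δ δ≤a) (inv-anti 0<δ δ≤b)))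
        where
        0≤inv : ∀ {a} → δ ≤ a → 0ℚ ≤ inv a
        0≤inv δ≤a = ℚ.<⇒≤ (0<inv (ℚ.<-≤-trans 0<δ δ≤a))

      -- x/a - y/b over a common denominator
      fraction-diff : ∀ x y {a b} → 0ℚ < a → 0ℚ < b →
                      x * inv a - y * inv b ≡ (x * b - y * a) * (inv a * inv b)
      fraction-diff x y {a} {b} 0<a 0<b = trans
        (cong₂ (λ p q → x * p - y * q)
          (sym (trans (cong (inv a *_) (inv-inverse (>⇒≢ 0<b))) (ℚ.*-identityʳ (inv a))))
          (sym (trans (cong (inv b *_) (inv-inverse (>⇒≢ 0<a))) (ℚ.*-identityʳ (inv b)))))
        (solve 6 (λ x y a b p q → x :* (p :* (b :* q)) :- y :* (q :* (a :* p))
                              := (x :* b :- y :* a) :* (p :* q)) refl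
          x y a b (inv a) (inv b))

      lipschitz : ∀ {t u} → δ ≤ t → δ ≤ u → ∣ lnSum n t - lnSum n u ∣ ≤ C * ∣ t - u ∣
      lipschitz {t} {u} δ≤t δ≤u = subst (∣ lnSum n t - lnSum n u ∣ ≤_)
        (trans (sum-const (2 ℕ.^ n) (∣ t - u ∣ * ½^ n * C))
          (trans (solve 4 (λ a x h c → a :* (x :* h :* c) := c :* x :* (a :* h)) refl
                   (fromℕ (2 ℕ.^ n)) ∣ t - u ∣ (½^ n) C)
            (trans (cong (C * ∣ t - u ∣ *_) (2^n*½^n≡1 n)) (ℚ.*-identityʳ _))))
        (sum-∣-∣ (2 ℕ.^ n) λ k k<2^n → term k (ℕ.<⇒≤ k<2^n))
        where
        term : ∀ k → k ℕ.≤ 2 ℕ.^ n →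
               ∣ width t * inv (point t k) - width u * inv (point u k) ∣
               ≤ ∣ t - u ∣ * ½^ n * C
        term k k≤2^n = subst₂ _≤_
          (cong ∣_∣ (sym (trans
            (fraction-diff (width t) (width u)
              (ℚ.<-≤-trans 0<δ δ≤a) (ℚ.<-≤-trans 0<δ δ≤b))
            (cong (_* (inv (point t k) * inv (point u k)))
              (solve 4 (λ t u k h →
                  (t :- con 1ℚ) :* h :* (con 1ℚ :+ k :* ((u :- con 1ℚ) :* h))
                  :- (u :- con 1ℚ) :* h :* (con 1ℚ :+ k :* ((t :- con 1ℚ) :* h))
                  := (t :- u) :* h) refl t u (fromℕ k) (½^ n))))))
          (cong (_* C) (trans (ℚ.∣p*q∣≡∣p∣*∣q∣ (t - u) (½^ n))
            (cong (∣ t - u ∣ *_) (ℚ.0≤p⇒∣p∣≡p (0≤½^ n)))))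
          (∣z*inv*inv∣ ((t - u) * ½^ n) δ≤a δ≤b)
          where
          δ≤a : δ ≤ point t k
          δ≤a = δ≤point δ≤t k≤2^n
          δ≤b : δ ≤ point u k
          δ≤b = δ≤point δ≤u k≤2^n

      refine : ∀ {t} → ∣ t - 1ℚ ∣ ≤ M → δ ≤ t →
               ∣ lnSum (suc n) t - lnSum n t ∣ ≤ M * M * C * ½^ n
      refine {t} t≤M δ≤t = subst₂ _≤_
        (cong (λ z → ∣ z - lnSum n t ∣) (sym (sum-double (2 ℕ.^ n) g)))
        (trans (sum-const (2 ℕ.^ n) (M * ½^ n * (M * ½^ n) * C))
          (trans (solve 4 (λ a m h c → a :* (m :* h :* (m :* h) :* c)
                                   := m :* m :* c :* h :* (a :* h)) refl
                   (fromℕ (2 ℕ.^ n)) M (½^ n) C)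
            (trans (cong (M * M * C * ½^ n *_) (2^n*½^n≡1 n)) (ℚ.*-identityʳ _))))
        (sum-∣-∣ (2 ℕ.^ n) term)
        where
        v : ℚ
        v = (t - 1ℚ) * ½^ suc n

        g : ℕ → ℚ
        g k = v * inv (1ℚ + fromℕ k * v)

        ∣v∣≤ : ∣ v ∣ ≤ M * ½^ n
        ∣v∣≤ = subst (_≤ M * ½^ n)
          (sym (trans (ℚ.∣p*q∣≡∣p∣*∣q∣ (t - 1ℚ) (½^ suc n))
            (cong (∣ t - 1ℚ ∣ *_) (ℚ.0≤p⇒∣p∣≡p (0≤½^ (suc n))))))
          (*-mono (ℚ.≤-trans 0≤1 1≤M) (0≤½^ (suc n)) t≤M (½^-suc≤ n))

        even : ∀ k → 1ℚ + fromℕ (2 ℕ.* k) * v ≡ point t k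
        even k = trans (cong (λ a → 1ℚ + a * v) (fromℕ-double k))
          (solve 3 (λ k t h → con 1ℚ :+ (k :+ k) :* ((t :- con 1ℚ) :* (con ½ :* h))
                          := con 1ℚ :+ k :* ((t :- con 1ℚ) :* h)) refl (fromℕ k) t (½^ n))

        odd : ∀ k → 1ℚ + fromℕ (suc (2 ℕ.* k)) * v ≡ point t k + v
        odd k = trans (cong (λ a → 1ℚ + a * v) (fromℕ-suc (2 ℕ.* k)))
          (trans (solve 2 (λ a v → con 1ℚ :+ (con 1ℚ :+ a) :* v := con 1ℚ :+ a :* v :+ v) refl
                   (fromℕ (2 ℕ.* k)) v)
            (cong (_+ v) (even k)))

        -- the odd points are midpoints of consecutive points
        δ≤odd : ∀ k → suc k ℕ.≤ 2 ℕ.^ n → δ ≤ point t k + v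
        δ≤odd k k<2^n = subst₂ _≤_ (half+half δ)
          (trans (cong (λ a → ½ * point t k + ½ * (1ℚ + a * width t)) (fromℕ-suc k))
            (solve 3 (λ k t h →
                con ½ :* (con 1ℚ :+ k :* ((t :- con 1ℚ) :* h))
                :+ con ½ :* (con 1ℚ :+ (con 1ℚ :+ k) :* ((t :- con 1ℚ) :* h))
                := con 1ℚ :+ k :* ((t :- con 1ℚ) :* h) :+ (t :- con 1ℚ) :* (con ½ :* h))
              refl (fromℕ k) t (½^ n)))
          (ℚ.+-mono-≤ (*-monoˡ 0≤½ (δ≤point δ≤t (ℕ.<⇒≤ k<2^n)))
            (*-monoˡ 0≤½ (δ≤point δ≤t k<2^n)))

        term : ∀ k → k ℕ.< 2 ℕ.^ n →
               ∣ (g (2 ℕ.* k) + g (suc (2 ℕ.* k))) - width t * inv (point t k) ∣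
               ≤ M * ½^ n * (M * ½^ n) * C
        term k k<2^n = subst (λ z → ∣ z ∣ ≤ M * ½^ n * (M * ½^ n) * C) (sym diff)
          (ℚ.≤-trans (∣z*inv*inv∣ (v * a - v * (a + v)) (δ≤odd k k<2^n) δ≤a)
            (*-monoʳ 0≤C (subst (_≤ M * ½^ n * (M * ½^ n))
              (sym (trans (cong ∣_∣ (solve 2 (λ a v → v :* a :- v :* (a :+ v) := :- (v :* v))
                                    refl a v))
                (trans (ℚ.∣-p∣≡∣p∣ (v * v)) (ℚ.∣p*q∣≡∣p∣*∣q∣ v v))))
              (*-mono (0≤* (ℚ.≤-trans 0≤1 1≤M) (0≤½^ n)) (ℚ.0≤∣p∣ v) ∣v∣≤ ∣v∣≤))))
          where
          a : ℚ
          a = point t k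

          δ≤a : δ ≤ a
          δ≤a = δ≤point δ≤t (ℕ.<⇒≤ k<2^n)

          diff : (g (2 ℕ.* k) + g (suc (2 ℕ.* k))) - width t * inv a
                 ≡ (v * a - v * (a + v)) * (inv (a + v) * inv a)
          diff = trans
            (cong₂ (λ p q → (v * inv p + v * inv q) - width t * inv a) (even k) (odd k))
            (trans
              (solve 4 (λ t h p q →
                  ((t :- con 1ℚ) :* (con ½ :* h) :* p :+ (t :- con 1ℚ) :* (con ½ :* h) :* q)
                  :- (t :- con 1ℚ) :* h :* p
                  := (t :- con 1ℚ) :* (con ½ :* h) :* q :- (t :- con 1ℚ) :* (con ½ :* h) :* p)
                refl t (½^ n) (inv a) (inv (a + v)))
              (fraction-diff v v (ℚ.<-≤-trans 0<δ (δ≤odd k k<2^n)) (ℚ.<-≤-trans 0<δ δ≤a)))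

      -- ln t ≥ (t - 1) / t
      lnSum-lower : ∀ {t} → 1ℚ ≤ t → (t - 1ℚ) * inv t ≤ lnSum n t
      lnSum-lower {t} 1≤t = subst (_≤ lnSum n t)
        (trans (sum-const (2 ℕ.^ n) (width t * inv t))
          (trans (solve 4 (λ a x h i → a :* (x :* h :* i) := x :* i :* (a :* h)) refl
                   (fromℕ (2 ℕ.^ n)) (t - 1ℚ) (½^ n) (inv t))
            (trans (cong ((t - 1ℚ) * inv t *_) (2^n*½^n≡1 n)) (ℚ.*-identityʳ _))))
        (sum-mono (2 ℕ.^ n) λ k k<2^n →
          *-monoˡ (0≤* (≤⇒0≤- 1≤t) (0≤½^ n))
            (inv-anti (ℚ.<-≤-trans 0<δ (δ≤point (ℚ.≤-trans δ≤1 1≤t) (ℕ.<⇒≤ k<2^n)))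
              (point≤t 1≤t (ℕ.<⇒≤ k<2^n))))

    cauchy-ln : ∀ {s} → IsCauchy s → ∀ δ → 0ℚ < δ → ∀ N → (∀ n → N ℕ.≤ n → δ ≤ s n) →
                IsCauchy (λ n → lnSum n (s n))
    cauchy-ln {s} cs δ₀ 0<δ₀ N δ₀≤s = from (cauchy-bounded {λ n → s n - 1ℚ} cs-1)
      where
      cs-1 : IsCauchy (λ n → s n - 1ℚ)
      cs-1 = cauchy-+ {s} {λ _ → - 1ℚ} cs (cauchy-const (- 1ℚ))

      δ : ℚ
      δ = δ₀ ⊓ 1ℚ

      0<δ : 0ℚ < δ
      0<δ = case (ℚ.⊓-sel δ₀ 1ℚ)
        where
        case : δ ≡ δ₀ ⊎ δ ≡ 1ℚ → 0ℚ < δ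
        case (inj₁ e) = subst (0ℚ <_) (sym e) 0<δ₀
        case (inj₂ e) = subst (0ℚ <_) (sym e) 0<1

      δ≤1 : δ ≤ 1ℚ
      δ≤1 = ℚ.p⊓q≤q δ₀ 1ℚ

      from : ∃[ M ] ∃[ N ] 1ℚ ≤ M × (∀ n → N ℕ.≤ n → ∣ s n - 1ℚ ∣ ≤ M) →
             IsCauchy (λ n → lnSum n (s n))
      from (M , N′ , 1≤M , s≤M) =
        cauchy-diagonal lnSum {s} cs (λ t → δ ≤ t × ∣ t - 1ℚ ∣ ≤ M) (N ℕ.+ N′)
          (λ n le → ℚ.≤-trans (ℚ.p⊓q≤p δ₀ 1ℚ) (δ₀≤s n (ℕ.m+n≤o⇒m≤o N le)) ,
                    s≤M n (ℕ.m+n≤o⇒n≤o N le))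
          (M * M * (inv δ * inv δ)) (inv δ * inv δ)
          (0≤* (0≤* (ℚ.≤-trans 0≤1 1≤M) (ℚ.≤-trans 0≤1 1≤M)) 0≤C) 0≤C 0
          (λ t (δ≤t , t≤M) d →
            subst (λ m → ∣ lnSum (suc m) t - lnSum m t ∣ ≤ M * M * (inv δ * inv δ) * ½^ d)
              (sym (ℕ.+-identityʳ d)) (LnBounds.refine 0<δ δ≤1 1≤M d t≤M δ≤t))
          (λ t u (δ≤t , _) (δ≤u , _) d →
            LnBounds.lipschitz 0<δ δ≤1 1≤M (d ℕ.+ 0) δ≤t δ≤u)
        where
        0≤C : 0ℚ ≤ inv δ * inv δ
        0≤C = 0≤* (ℚ.<⇒≤ (0<inv 0<δ)) (ℚ.<⇒≤ (0<inv 0<δ))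

open Rational

-- Real numbers are Cauchy sequences of rationals; they are compared with _≃_,
-- not with _≡_.
record ℝ : Set where
  constructor real
  field
    seq    : ℕ → ℚ
    cauchy : IsCauchy seq

open ℝ public

infix  4 _≃_ _≤_ _<_
infixl 6 _+_ _-_
infixl 7 _*_ _÷_⟨_⟩ _/ln_
infix  8 -_
infixr 8 _^_

_≃_ _≤_ _<_ : ℝ → ℝ → Set
x ≃ y = ∀ ε → 0ℚ ℚ.< ε → ∃[ N ] ∀ n → N ℕ.≤ n → ℚ.∣ seq x n ℚ.- seq y n ∣ ℚ.≤ ε
x ≤ y = ∀ ε → 0ℚ ℚ.< ε → ∃[ N ] ∀ n → N ℕ.≤ n → seq x n ℚ.≤ seq y n ℚ.+ ε
x < y = ∃[ δ ] 0ℚ ℚ.< δ × ∃[ N ] ∀ n → N ℕ.≤ n → seq x n ℚ.+ δ ℚ.≤ seq y n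

fromℚ : ℚ → ℝ
fromℚ p = real (λ _ → p) (cauchy-const p)

0ℝ 1ℝ 2ℝ : ℝ
0ℝ = fromℚ 0ℚ
1ℝ = fromℚ 1ℚ
2ℝ = fromℚ (fromℕ 2)

_+_ _*_ : ℝ → ℝ → ℝ
x + y = real (λ n → seq x n ℚ.+ seq y n) (cauchy-+ {seq x} {seq y} (cauchy x) (cauchy y))
x * y = real (λ n → seq x n ℚ.* seq y n) (cauchy-* {seq x} {seq y} (cauchy x) (cauchy y))

-_ : ℝ → ℝ
- x = real (λ n → ℚ.- seq x n) (cauchy-neg {seq x} (cauchy x))

_-_ : ℝ → ℝ → ℝ
x - y = x + (- y)

∣_∣ : ℝ → ℝ
∣ x ∣ = real (λ n → ℚ.∣ seq x n ∣) (cauchy-abs {seq x} (cauchy x))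

_^_ : ℝ → ℕ → ℝ
x ^ zero  = 1ℝ
x ^ suc n = x * x ^ n

abstract

  0<⇒eventually : ∀ x → 0ℝ < x →
                  ∃[ δ ] 0ℚ ℚ.< δ × ∃[ N ] ∀ n → N ℕ.≤ n → δ ℚ.≤ seq x n
  0<⇒eventually x (δ , 0<δ , N , le) = δ , 0<δ , N , λ n N≤n →
    subst (ℚ._≤ seq x n) (ℚ.+-identityˡ δ) (le n N≤n)

  eventually⇒0< : ∀ x δ → 0ℚ ℚ.< δ → ∀ N → (∀ n → N ℕ.≤ n → δ ℚ.≤ seq x n) → 0ℝ < x
  eventually⇒0< x δ 0<δ N le = δ , 0<δ , N , λ n N≤n →
    subst (ℚ._≤ seq x n) (sym (ℚ.+-identityˡ δ)) (le n N≤n)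

  cauchy-recip : ∀ x → 0ℝ < x → IsCauchy (λ n → inv (seq x n))
  cauchy-recip x 0<x = from (0<⇒eventually x 0<x)
    where
    from : ∃[ δ ] 0ℚ ℚ.< δ × ∃[ N ] (∀ n → N ℕ.≤ n → δ ℚ.≤ seq x n) →
           IsCauchy (λ n → inv (seq x n))
    from (δ , 0<δ , N , le) = cauchy-inv {seq x} (cauchy x) δ 0<δ N le

  cauchy-log : ∀ x → 0ℝ < x → IsCauchy (λ n → lnSum n (seq x n))
  cauchy-log x 0<x = from (0<⇒eventually x 0<x)
    where
    from : ∃[ δ ] 0ℚ ℚ.< δ × ∃[ N ] (∀ n → N ℕ.≤ n → δ ℚ.≤ seq x n) →
           IsCauchy (λ n → lnSum n (seq x n))
    from (δ , 0<δ , N , le) = cauchy-ln {seq x} (cauchy x) δ 0<δ N le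

  0<fromℚ : ∀ {p} → 0ℚ ℚ.< p → 0ℝ < fromℚ p
  0<fromℚ {p} 0<p = eventually⇒0< (fromℚ p) p 0<p 0 (λ _ _ → ℚ.≤-refl)

  0<-+ : ∀ {x y} → 1ℝ ≤ x → 0ℝ < y → 0ℝ < x + y
  0<-+ {x} {y} 1≤x 0<y = from (1≤x ½ 0<½) (0<⇒eventually y 0<y)
    where
    from : ∃[ N ] (∀ n → N ℕ.≤ n → 1ℚ ℚ.≤ seq x n ℚ.+ ½) →
           ∃[ δ ] 0ℚ ℚ.< δ × ∃[ N ] (∀ n → N ℕ.≤ n → δ ℚ.≤ seq y n) → 0ℝ < x + y
    from (N₁ , le₁) (δ , 0<δ , N₂ , le₂) =
      eventually⇒0< (x + y) δ 0<δ (N₁ ℕ.+ N₂) λ n le →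
        subst (ℚ._≤ seq x n ℚ.+ seq y n) (ℚ.+-identityˡ δ)
          (ℚ.+-mono-≤
            (ℚ.≤-trans 0≤½ (subst (½ ℚ.≤_)
              (trans (ℚ.+-assoc (seq x n) ½ (ℚ.- ½)) (ℚ.+-identityʳ (seq x n)))
              (ℚ.+-monoˡ-≤ (ℚ.- ½) (le₁ n (ℕ.m+n≤o⇒m≤o N₁ le)))))
            (le₂ n (ℕ.m+n≤o⇒n≤o N₁ le)))

  0<-* : ∀ {x y} → 0ℝ < x → 0ℝ < y → 0ℝ < x * y
  0<-* {x} {y} 0<x 0<y = from (0<⇒eventually x 0<x) (0<⇒eventually y 0<y)
    where
    from : ∃[ δ ] 0ℚ ℚ.< δ × ∃[ N ] (∀ n → N ℕ.≤ n → δ ℚ.≤ seq x n) →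
           ∃[ δ ] 0ℚ ℚ.< δ × ∃[ N ] (∀ n → N ℕ.≤ n → δ ℚ.≤ seq y n) → 0ℝ < x * y
    from (δ₁ , 0<δ₁ , N₁ , le₁) (δ₂ , 0<δ₂ , N₂ , le₂) =
      eventually⇒0< (x * y) (δ₁ ℚ.* δ₂) (0<* 0<δ₁ 0<δ₂) (N₁ ℕ.+ N₂) λ n le →
        *-mono (ℚ.≤-trans (ℚ.<⇒≤ 0<δ₁) (le₁ n (ℕ.m+n≤o⇒m≤o N₁ le))) (ℚ.<⇒≤ 0<δ₂)
          (le₁ n (ℕ.m+n≤o⇒m≤o N₁ le)) (le₂ n (ℕ.m+n≤o⇒n≤o N₁ le))

  0<-^ : ∀ {x} → 0ℝ < x → ∀ n → 0ℝ < x ^ n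
  0<-^ 0<x zero    = 0<fromℚ 0<1
  0<-^ {x} 0<x (suc n) = 0<-* {x} {x ^ n} 0<x (0<-^ {x} 0<x n)

recip : (x : ℝ) → 0ℝ < x → ℝ
recip x 0<x = real (λ n → inv (seq x n)) (cauchy-recip x 0<x)

_÷_⟨_⟩ : (x y : ℝ) → 0ℝ < y → ℝ
x ÷ y ⟨ 0<y ⟩ = x * recip y 0<y

-- eˣ = Σ xᵏ / k!
exp : ℝ → ℝ
exp x = real (λ n → expSum n (seq x n)) (cauchy-exp {seq x} (cauchy x))

-- ln x = ∫₁ˣ dt / t
ln : (x : ℝ) → 0ℝ < x → ℝ
ln x 0<x = real (λ n → lnSum n (seq x n)) (cauchy-log x 0<x)

-- xʸ = exp (y ln x)
rpow : (x : ℝ) → 0ℝ < x → ℝ → ℝ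
rpow x 0<x y = exp (y * ln x 0<x)

natural : ℕ → ℝ
natural m = fromℚ (fromℕ m)

0<natural : ∀ m .{{_ : ℕ.NonZero m}} → 0ℝ < natural m
0<natural (suc m) = 0<fromℚ (0<fromℕ m)

lnℕ : (m : ℕ) .{{_ : ℕ.NonZero m}} → ℝ
lnℕ m = ln (natural m) (0<natural m)

abstract

  0<lnℕ : ∀ {m} .{{_ : ℕ.NonZero m}} → 1 ℕ.< m → 0ℝ < lnℕ m
  0<lnℕ {m@(suc (suc k))} _ = eventually⇒0< (lnℕ m) ((p ℚ.- 1ℚ) ℚ.* inv p)
    (0<* (subst (0ℚ ℚ.<_) (sym p-1≡) (0<fromℕ k)) (0<inv (0<fromℕ (suc k)))) 0
    λ n _ → LnBounds.lnSum-lower 0<1 ℚ.≤-refl ℚ.≤-refl n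
      (subst (1ℚ ℚ.≤_) (sym (fromℕ-suc (suc k))) (p≤p+ (0≤fromℕ (suc k))))
    where
    p : ℚ
    p = fromℕ m

    p-1≡ : p ℚ.- 1ℚ ≡ fromℕ (suc k)
    p-1≡ = trans (cong (ℚ._- 1ℚ) (fromℕ-suc (suc k)))
      (solve 1 (λ a → con 1ℚ :+ a :- con 1ℚ := a) refl (fromℕ (suc k)))
      where open +-*-Solver
  0<lnℕ {suc zero} (ℕ.s≤s ())

-- x /ln m = x / ln m.  The quotient is undefined for m = 1, where the value is
-- set to 0; below this only affects the terms with q n = 1, that is n ≤ 1.
_/ln_ : ℝ → (m : ℕ) .{{_ : ℕ.NonZero m}} → ℝ
x /ln m with 1 ℕ.<? m
... | yes 1<m = x ÷ lnℕ m ⟨ 0<lnℕ 1<m ⟩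
... | no  _   = 0ℝ

data ExtReal : Set where
  -∞  : ExtReal
  fin : ℝ → ExtReal
  +∞  : ExtReal

infixr 6 _⊕_

_⊕_ : ℝ → ExtReal → ExtReal
x ⊕ -∞    = -∞
x ⊕ fin y = fin (x + y)
x ⊕ +∞    = +∞

Positive : ExtReal → Set
Positive -∞      = ⊥
Positive (fin x) = 0ℝ < x
Positive +∞      = ⊤

ln∞ : (x : ExtReal) → Positive x → ExtReal
ln∞ (fin x) 0<x = fin (ln x 0<x)
ln∞ +∞      _   = +∞

-- Constructively, an infimum and a limit superior are relations between a
-- predicate (a sequence) and an extended real, rather than total functions.
IsInfimum : (ℝ → Set) → ExtReal → Set
IsInfimum P -∞      = ∀ y → ∃[ u ] P u × u < y
IsInfimum P (fin x) = (∀ u → P u → x ≤ u) × (∀ ε → 0ℝ < ε → ∃[ u ] P u × u < x + ε)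
IsInfimum P +∞      = ∀ u → ¬ P u

EventuallyBoundedBy : (ℕ → ℝ) → ℝ → Set
EventuallyBoundedBy s u = ∃[ N ] ∀ n → N ℕ.≤ n → s n ≤ u

-- lim sup s = inf { u | s n ≤ u for all large n }
IsLimsup : (ℕ → ℝ) → ExtReal → Set
IsLimsup s = IsInfimum (EventuallyBoundedBy s)

-- The least real satisfying P, and +∞ if no real satisfies P.
IsLeastOr∞ : (ℝ → Set) → ExtReal → Set
IsLeastOr∞ P -∞      = ⊥
IsLeastOr∞ P (fin x) = P x × (∀ y → P y → x ≤ y)
IsLeastOr∞ P +∞      = ∀ y → ¬ P y

Irrational : ℝ → Set
Irrational α = ∀ r → ¬ (α ≃ fromℚ r)

-- ∣ α - p / q ∣ > q ^ -(μ + ε) for all large q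
ExponentBound : ℝ → ℝ → Set
ExponentBound α μ = 0ℝ < μ ×
  (∀ ε → 0ℝ < ε → ∃[ Q ] 0 ℕ.< Q ×
    (∀ (p : ℤ) (q : ℕ) .{{_ : ℕ.NonZero q}} → Q ℕ.≤ q →
      rpow (natural q) (0<natural q) (- (μ + ε)) < ∣ α - fromℚ (p ℚ./ q) ∣))

-- ∣ α - p / q ∣ > 1 / (β + ε) ^ q for all large q
BaseBound : ℝ → ℝ → Set
BaseBound α β = Σ[ 1≤β ∈ 1ℝ ≤ β ]
  (∀ ε (0<ε : 0ℝ < ε) → ∃[ Q ] 0 ℕ.< Q ×
    (∀ (p : ℤ) (q : ℕ) .{{_ : ℕ.NonZero q}} → Q ℕ.≤ q →
      recip ((β + ε) ^ q) (0<-^ {β + ε} (0<-+ {β} {ε} 1≤β 0<ε) q)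
        < ∣ α - fromℚ (p ℚ./ q) ∣))

IsIrrationalityExponent : ℝ → ExtReal → Set
IsIrrationalityExponent α = IsLeastOr∞ (ExponentBound α)

IsIrrationalityBase : ℝ → ExtReal → Set
IsIrrationalityBase α = IsLeastOr∞ (BaseBound α)

-- Partial quotients of a simple continued fraction: b⁺ n is b_{n+1}.
record ContinuedFraction : Set where
  field
    b₀     : ℤ
    b⁺     : ℕ → ℕ
    {{b⁺≢0}} : ∀ {n} → ℕ.NonZero (b⁺ n)

-- 1 / (b 0 + 1 / (b 1 + ⋯ + 1 / b (n - 1)))
fractionalPart : (ℕ → ℕ) → ℕ → ℚ
fractionalPart b zero    = 0ℚ
fractionalPart b (suc n) = inv (fromℕ (b 0) ℚ.+ fractionalPart (λ k → b (suc k)) n)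

module _ (c : ContinuedFraction) where

  open ContinuedFraction c

  -- [b₀; b₁, …, bₙ]
  convergent : ℕ → ℚ
  convergent n = b₀ ℚ./ 1 ℚ.+ fractionalPart b⁺ n

  -- Elements of ℚ are in lowest terms, so this is the denominator qₙ.
  q : ℕ → ℕ
  q n = ℚ.↧ₙ (convergent n)

-- α = [b₀; b₁, b₂, …]
HasExpansion : ℝ → ContinuedFraction → Set
HasExpansion α c = ∀ ε → 0ℝ < ε →
  ∃[ N ] ∀ n → N ℕ.≤ n → ∣ fromℚ (convergent c n) - α ∣ < ε

{-# OPTIONS --safe #-}

-- Write θ = ∣ α - p / k ∣.  If k < q (n + 1) then 1 ≤ 2 k q (n + 1) θ, and if
-- p / k is the n-th convergent then q n q (n + 1) θ ≤ 1.  Taking logarithms, a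
-- bound θ > k ^ -(1 + u) for all large k is, up to an arbitrarily small change
-- of u, the same as ln q (n + 1) ≤ u ln q n for all large n: in one direction
-- take for k the denominators of the convergents, in the other choose n with
-- q n ≤ k < q (n + 1).  Likewise θ > exp (- u k) corresponds to
-- ln q (n + 1) ≤ u q n.  The two statements about b follow from
-- b (n + 1) q n ≤ q (n + 1) ≤ 2 b (n + 1) q n.
--
-- For the first estimate, expand a late convergent (P, Q) as
-- u (p n, q n) + v (p (n + 1), q (n + 1)) with naturals u ≤ v.  The integers
-- e₀ = p n k - p q n and e₁ = p (n + 1) k - p q (n + 1) satisfy
-- ∣ e₀ q (n + 1) - e₁ q n ∣ = k < q (n + 1), so they have the same sign and
-- ∣ P k - p Q ∣ = ∣ u e₀ + v e₁ ∣ ≥ v, while Q ≤ 2 v q (n + 1).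
module Submission where

open import Defs
open Rational
open import Data.Nat.Base as ℕ using (ℕ; zero; suc) hiding (module ℕ)
import Data.Nat.Properties as ℕ
import Data.Nat.Divisibility as ℕ
import Data.Nat.Solver as ℕ
open import Data.Nat.Coprimality using (Coprime)
open import Data.Integer.Base as ℤ using (ℤ) hiding (module ℤ)
import Data.Integer.Properties as ℤ
import Data.Integer.Divisibility.Signed as ℤ
import Data.Integer.Solver as ℤ
open import Data.Rational.Base as ℚ using (ℚ; 0ℚ; 1ℚ; ½; mkℚ) hiding (module ℚ)
import Data.Rational.Properties as ℚ
open import Data.Rational.Unnormalised.Base using (mkℚᵘ; *≡*)
import Data.Rational.Unnormalised.Properties as ℚᵘ
open import Data.Rational.Solver using (module +-*-Solver)
open import Data.Empty using (⊥-elim)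
open import Data.Product.Base using (∃-syntax; _×_; _,_; proj₁; proj₂)
open import Data.Sum.Base using (_⊎_; inj₁; inj₂)
open import Function.Bundles using (_⇔_; mk⇔)
open import Relation.Nullary.Negation.Core using (¬_)
open import Relation.Nullary.Negation using (contradiction)
open import Relation.Nullary.Decidable.Core using (yes; no)
open import Relation.Binary.PropositionalEquality
  using (_≡_; _≢_; refl; sym; trans; cong; cong₂; subst; subst₂)
open +-*-Solver using (solve; _:+_; _:*_; _:-_; :-_; _:=_; con)
open ℤ.+-*-Solver using () renaming
  (solve to solveℤ; _:+_ to _⊞_; _:*_ to _⊠_; _:-_ to _⊟_; :-_ to ⊟_; _:=_ to _⊜_;
   con to conℤ)
open ℕ.+-*-Solver using () renaming
  (solve to solveℕ; _:+_ to _⊹_; _:*_ to _∙_; _:=_ to _≐_; con to conℕ)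

-- Order and arithmetic of real numbers

-- The order of Cauchy reals is not decidable and a limit superior is a relation, so each formula
-- becomes an equivalence: a candidate is the exponent (or base) exactly when the corresponding
-- value is the infimum of the eventual bounds of the sequence. The exponent is a least element,
-- whereas an infimum need not be attained. The gap closes because the two measure conditions
-- already contain an arbitrary ε > 0 and are therefore closed under approximation from above; the
-- same closure absorbs the small losses of u.
--
-- Since exp is a power series and ln a Riemann sum, both truncated at the index of the
-- approximating sequence, the logarithm rules cannot be taken for granted. They rest on exp (x + y)
-- = exp x exp y, by the Cauchy product, on 1 + x ≤ exp x, and on exp (ln x) = x, by telescoping;
-- the basic inequalities between logarithms of integers are then proved by applying exp.

Eventually : (ℕ → Set) → Set
Eventually P = ∃[ N ] ∀ n → N ℕ.≤ n → P n

module _ {P Q : ℕ → Set} where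

  ev-map : (∀ n → P n → Q n) → Eventually P → Eventually Q
  ev-map f (N , p) = N , λ n N≤n → f n (p n N≤n)

  ev-zip : {R : ℕ → Set} → (∀ n → P n → Q n → R n) →
           Eventually P → Eventually Q → Eventually R
  ev-zip f (M , p) (N , q) = M ℕ.+ N , λ n le →
    f n (p n (ℕ.m+n≤o⇒m≤o M le)) (q n (ℕ.m+n≤o⇒n≤o M le))

ev-all : {P : ℕ → Set} → (∀ n → P n) → Eventually P
ev-all p = 0 , λ n _ → p n

-- Linear consequences of an inequality: the identity is left to the ring solver.
lin : ∀ {a b c d} → a ℚ.≤ b → d ℚ.- c ≡ b ℚ.- a → c ℚ.≤ d
lin {a} {b} {c} {d} a≤b e = subst₂ ℚ._≤_ (ℚ.+-identityʳ c)
  (solve 2 (λ c d → c :+ (d :- c) := d) refl c d)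
  (ℚ.+-monoʳ-≤ c (subst (0ℚ ℚ.≤_) (sym e) (≤⇒0≤- a≤b)))

infix 4 _⩽_ _≺_ _≈_

-- The relations of Defs unfold to function types, from which Agda cannot infer
-- the two reals; these wrappers can be used with implicit arguments.
record _⩽_ (x y : ℝ) : Set where
  constructor ⩽⁺
  field ⩽⁻ : x ≤ y

record _≺_ (x y : ℝ) : Set where
  constructor ≺⁺
  field ≺⁻ : x < y

record _≈_ (x y : ℝ) : Set where
  constructor ≈⁺
  field ≈⁻ : x ≃ y

open _⩽_ public
open _≺_ public
open _≈_ public

⩽-ev : ∀ {x y} → Eventually (λ n → seq x n ℚ.≤ seq y n) → x ⩽ y
⩽-ev h = ⩽⁺ λ ε 0<ε → ev-map (λ n le → ℚ.≤-trans le (p≤p+ (ℚ.<⇒≤ 0<ε))) h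

⩽-ptwise : ∀ {x y} → (∀ n → seq x n ℚ.≤ seq y n) → x ⩽ y
⩽-ptwise h = ⩽-ev (ev-all h)

⩽-antisym : ∀ {x y} → x ⩽ y → y ⩽ x → x ≈ y
⩽-antisym {x} {y} (⩽⁺ p) (⩽⁺ q) = ≈⁺ λ ε 0<ε → ev-zip
  (λ n a b → ∣-∣≤
    (lin a (solve 3 (λ x y e → e :- (x :- y) := (y :+ e) :- x) refl (seq x n) (seq y n) ε))
    (lin b (solve 3 (λ x y e → e :- (:- (x :- y)) := (x :+ e) :- y) refl
      (seq x n) (seq y n) ε)))
  (p ε 0<ε) (q ε 0<ε)

⩽-reflexive : ∀ {x y} → x ≈ y → x ⩽ y
⩽-reflexive {x} {y} (≈⁺ p) = ⩽⁺ λ ε 0<ε → ev-map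
  (λ n a → lin (ℚ.≤-trans (p≤∣p∣ _) a)
    (solve 3 (λ x y e → (y :+ e) :- x := e :- (x :- y)) refl (seq x n) (seq y n) ε))
  (p ε 0<ε)

≈-ev : ∀ {x y} → Eventually (λ n → seq x n ≡ seq y n) → x ≈ y
≈-ev h = ⩽-antisym (⩽-ev (ev-map (λ _ e → ℚ.≤-reflexive e) h))
  (⩽-ev (ev-map (λ _ e → ℚ.≤-reflexive (sym e)) h))

≈-ptwise : ∀ {x y} → (∀ n → seq x n ≡ seq y n) → x ≈ y
≈-ptwise h = ≈-ev (ev-all h)

≈-refl : ∀ {x} → x ≈ x
≈-refl = ≈-ptwise (λ _ → refl)

⩽-refl : ∀ {x} → x ⩽ x
⩽-refl = ⩽-reflexive ≈-refl

⩽-trans : ∀ {x y z} → x ⩽ y → y ⩽ z → x ⩽ z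
⩽-trans {x} {y} {z} (⩽⁺ p) (⩽⁺ q) = ⩽⁺ λ ε 0<ε → ev-zip
  (λ n a b → lin (ℚ.+-mono-≤ a b)
    (solve 4 (λ x y z e → (z :+ e) :- x
        := (y :+ con ½ :* e) :+ (z :+ con ½ :* e) :- (x :+ y)) refl
      (seq x n) (seq y n) (seq z n) ε))
  (p (½ ℚ.* ε) (0<half 0<ε)) (q (½ ℚ.* ε) (0<half 0<ε))

≈-sym : ∀ {x y} → x ≈ y → y ≈ x
≈-sym {x} {y} (≈⁺ p) = ≈⁺ λ ε 0<ε → ev-map
  (λ n → subst (ℚ._≤ ε) (∣p-q∣-sym (seq x n) (seq y n))) (p ε 0<ε)

≈-trans : ∀ {x y z} → x ≈ y → y ≈ z → x ≈ z
≈-trans p q = ⩽-antisym (⩽-trans (⩽-reflexive p) (⩽-reflexive q))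
  (⩽-trans (⩽-reflexive (≈-sym q)) (⩽-reflexive (≈-sym p)))

≺-⩽-trans : ∀ {x y z} → x ≺ y → y ⩽ z → x ≺ z
≺-⩽-trans {x} {y} {z} (≺⁺ (δ , 0<δ , p)) (⩽⁺ q) = ≺⁺ (½ ℚ.* δ , 0<half 0<δ , ev-zip
  (λ n a b → lin (ℚ.+-mono-≤ a b)
    (solve 4 (λ x y z d → z :- (x :+ con ½ :* d)
        := (y :+ (z :+ con ½ :* d)) :- ((x :+ d) :+ y)) refl
      (seq x n) (seq y n) (seq z n) δ))
  p (q (½ ℚ.* δ) (0<half 0<δ)))

⩽-≺-trans : ∀ {x y z} → x ⩽ y → y ≺ z → x ≺ z
⩽-≺-trans {x} {y} {z} (⩽⁺ q) (≺⁺ (δ , 0<δ , p)) = ≺⁺ (½ ℚ.* δ , 0<half 0<δ , ev-zip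
  (λ n a b → lin (ℚ.+-mono-≤ a b)
    (solve 4 (λ x y z d → z :- (x :+ con ½ :* d)
        := (z :+ (y :+ con ½ :* d)) :- ((y :+ d) :+ x)) refl
      (seq x n) (seq y n) (seq z n) δ))
  p (q (½ ℚ.* δ) (0<half 0<δ)))

≺⇒⩽ : ∀ {x y} → x ≺ y → x ⩽ y
≺⇒⩽ (≺⁺ (δ , 0<δ , p)) = ⩽-ev (ev-map (λ n a → ℚ.≤-trans (p≤p+ (ℚ.<⇒≤ 0<δ)) a) p)

≺-trans : ∀ {x y z} → x ≺ y → y ≺ z → x ≺ z
≺-trans p q = ≺-⩽-trans p (≺⇒⩽ q)

≺-irrefl : ∀ {x} → ¬ (x ≺ x)
≺-irrefl {x} (≺⁺ (δ , 0<δ , N , p)) = ℚ.<-irrefl refl (ℚ.<-≤-trans 0<δ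
  (lin (p N ℕ.≤-refl) (solve 2 (λ x d → con 0ℚ :- d := x :- (x :+ d)) refl (seq x N) δ)))

-- With an error ε, the order can be decided from a sufficiently late term.
≺-or-⩽ : ∀ x y {ε} → 0ℚ ℚ.< ε → x ≺ y ⊎ y ⩽ x + fromℚ ε
≺-or-⩽ x y {ε} 0<ε = go (ε₃ ℚ.≤? (seq y N ℚ.- seq x N))
  where
  ε₁ ε₂ ε₃ : ℚ
  -- With ε₁ = ε / 8 a gap of 3 ε₁ at index N, less one oscillation ε₁ of each sequence, leaves ε₁
  -- for `≺`. Otherwise the excess is at most 5 ε₁, and the remaining 3 ε₁ are padding.
  ε₁ = ½ ℚ.* (½ ℚ.* (½ ℚ.* ε))
  ε₂ = ε₁ ℚ.+ ε₁
  ε₃ = ε₂ ℚ.+ ε₁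
  0<ε₁ : 0ℚ ℚ.< ε₁
  0<ε₁ = 0<half (0<half (0<half 0<ε))
  N₁ N₂ N : ℕ
  N₁ = proj₁ (cauchy x ε₁ 0<ε₁)
  N₂ = proj₁ (cauchy y ε₁ 0<ε₁)
  N = N₁ ℕ.+ N₂
  nearx : ∀ n → N ℕ.≤ n → ℚ.∣ seq x n ℚ.- seq x N ∣ ℚ.≤ ε₁
  nearx n le = proj₂ (cauchy x ε₁ 0<ε₁) n N (ℕ.m+n≤o⇒m≤o N₁ le) (ℕ.m≤m+n N₁ N₂)
  neary : ∀ n → N ℕ.≤ n → ℚ.∣ seq y n ℚ.- seq y N ∣ ℚ.≤ ε₁
  neary n le = proj₂ (cauchy y ε₁ 0<ε₁) n N (ℕ.m+n≤o⇒n≤o N₁ le) (ℕ.m≤n+m N₂ N₁)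
  go : _ → x ≺ y ⊎ y ⩽ x + fromℚ ε
  go (yes le) = inj₁ (≺⁺ (ε₁ , 0<ε₁ , N , λ n N≤n →
    lin (ℚ.+-mono-≤ le (ℚ.+-mono-≤
          (ℚ.≤-trans (p≤∣p∣ _) (nearx n N≤n))
          (ℚ.≤-trans (p≤∣p∣ _) (subst (ℚ._≤ ε₁) (∣p-q∣-sym (seq y n) (seq y N))
            (neary n N≤n)))))
      (solve 5 (λ x y a b e → y :- (x :+ e)
          := (b :- a) :+ (e :+ e) :- ((e :+ e :+ e) :+ ((x :- a) :+ (b :- y)))) refl
        (seq x n) (seq y n) (seq x N) (seq y N) ε₁)))
  go (no nle) = inj₂ (⩽-ev (N , λ n N≤n →
    lin (ℚ.+-mono-≤ (ℚ.+-mono-≤ (ℚ.<⇒≤ (ℚ.≰⇒> nle)) (0≤* (0≤fromℕ 3) (ℚ.<⇒≤ 0<ε₁))) (ℚ.+-mono-≤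
          (ℚ.≤-trans (p≤∣p∣ _) (neary n N≤n))
          (ℚ.≤-trans (p≤∣p∣ _) (subst (ℚ._≤ ε₁) (∣p-q∣-sym (seq x n) (seq x N))
            (nearx n N≤n)))))
      (solve 5 (λ x y a b e → let h = con ½ :* (con ½ :* (con ½ :* e)) in
          (x :+ e) :- y
          := (h :+ h :+ h :+ con (fromℕ 3) :* h) :+ (h :+ h)
             :- (((b :- a) :+ con 0ℚ) :+ ((y :- b) :+ (a :- x)))) refl
        (seq x n) (seq y n) (seq x N) (seq y N) ε)))

⩽-limit : ∀ {x y} → (∀ ε → 0ℚ ℚ.< ε → x ⩽ y + fromℚ ε) → x ⩽ y
⩽-limit {x} {y} h = ⩽⁺ λ ε 0<ε → ev-map
  (λ n a → lin a (solve 3 (λ x y e → (y :+ e) :- x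
      := ((y :+ con ½ :* e) :+ con ½ :* e) :- x) refl
    (seq x n) (seq y n) ε))
  (⩽⁻ (h (½ ℚ.* ε) (0<half 0<ε)) (½ ℚ.* ε) (0<half 0<ε))

-- Once y ≺ x is excluded, `≺-or-⩽` gives x ⩽ y + ε for every ε. Cancellation and reflection laws
-- for `⩽` thus follow from strict monotonicity without deciding the order.
⊀⇒⩽ : ∀ {x y} → ¬ (y ≺ x) → x ⩽ y
⊀⇒⩽ {x} {y} y⊀x = ⩽-limit λ ε 0<ε → go (≺-or-⩽ y x 0<ε)
  where
  go : ∀ {ε} → y ≺ x ⊎ x ⩽ y + fromℚ ε → x ⩽ y + fromℚ ε
  go (inj₁ y≺x) = contradiction y≺x y⊀x
  go (inj₂ le)  = le

⩽⇒⊀ : ∀ {x y} → x ⩽ y → ¬ (y ≺ x)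
⩽⇒⊀ x⩽y y≺x = ≺-irrefl (⩽-≺-trans x⩽y y≺x)

-- The real counterpart of `lin`: arithmetic is termwise, so the ring solver can check the equality
-- of the differences at each index.
⩽-lin : ∀ {x y u v} → x ⩽ y →
        (∀ n → seq v n ℚ.- seq u n ≡ seq y n ℚ.- seq x n) → u ⩽ v
⩽-lin {x} {y} {u} {v} (⩽⁺ p) e = ⩽⁺ λ ε 0<ε → ev-map
  (λ n a → lin a (trans
    (solve 3 (λ u v e → (v :+ e) :- u := (v :- u) :+ e) refl (seq u n) (seq v n) ε)
    (trans (cong (ℚ._+ ε) (e n))
      (solve 3 (λ x y e → (y :- x) :+ e := (y :+ e) :- x) refl (seq x n) (seq y n) ε))))
  (p ε 0<ε)

≺-lin : ∀ {x y u v} → x ≺ y →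
        (∀ n → seq v n ℚ.- seq u n ≡ seq y n ℚ.- seq x n) → u ≺ v
≺-lin {x} {y} {u} {v} (≺⁺ (δ , 0<δ , p)) e = ≺⁺ (δ , 0<δ , ev-map
  (λ n a → lin a (trans
    (solve 3 (λ u v e → v :- (u :+ e) := (v :- u) :- e) refl (seq u n) (seq v n) δ)
    (trans (cong (ℚ._- δ) (e n))
      (solve 3 (λ x y e → (y :- x) :- e := y :- (x :+ e)) refl (seq x n) (seq y n) δ))))
  p)

+-mono-⩽ : ∀ {x y u v} → x ⩽ y → u ⩽ v → x + u ⩽ y + v
+-mono-⩽ {x} {y} {u} {v} p q = ⩽-trans {y = y + u}
  (⩽-lin p λ n → solve 3 (λ x y u → (y :+ u) :- (x :+ u) := y :- x) refl
    (seq x n) (seq y n) (seq u n))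
  (⩽-lin q λ n → solve 3 (λ y u v → (y :+ v) :- (y :+ u) := v :- u) refl
    (seq y n) (seq u n) (seq v n))

+-mono-≺-⩽ : ∀ {x y u v} → x ≺ y → u ⩽ v → x + u ≺ y + v
+-mono-≺-⩽ {x} {y} {u} {v} p q = ≺-⩽-trans {y = y + u}
  (≺-lin p λ n → solve 3 (λ x y u → (y :+ u) :- (x :+ u) := y :- x) refl
    (seq x n) (seq y n) (seq u n))
  (⩽-lin q λ n → solve 3 (λ y u v → (y :+ v) :- (y :+ u) := v :- u) refl
    (seq y n) (seq u n) (seq v n))

+-cong : ∀ {x y u v} → x ≈ y → u ≈ v → x + u ≈ y + v
+-cong p q = ⩽-antisym (+-mono-⩽ (⩽-reflexive p) (⩽-reflexive q))
  (+-mono-⩽ (⩽-reflexive (≈-sym p)) (⩽-reflexive (≈-sym q)))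

fromℚ-mono : ∀ {p q} → p ℚ.≤ q → fromℚ p ⩽ fromℚ q
fromℚ-mono p≤q = ⩽-ptwise (λ _ → p≤q)

bounded : ∀ x → ∃[ M ] 0ℚ ℚ.≤ M × Eventually (λ n → ℚ.∣ seq x n ∣ ℚ.≤ M)
bounded x with cauchy-bounded {seq x} (cauchy x)
... | M , N , 1≤M , p = M , ℚ.≤-trans 0≤1 1≤M , N , p

*-monoʳ-⩽ : ∀ {x y z} → 0ℝ ≺ z → x ⩽ y → x * z ⩽ y * z
*-monoʳ-⩽ {x} {y} {z} (≺⁺ 0<z) (⩽⁺ p) =
  from (0<⇒eventually z 0<z) (bounded z)
  where
  from : ∃[ δ ] 0ℚ ℚ.< δ × Eventually (λ n → δ ℚ.≤ seq z n) →
         ∃[ M ] 0ℚ ℚ.≤ M × Eventually (λ n → ℚ.∣ seq z n ∣ ℚ.≤ M) → x * z ⩽ y * z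
  from (δ , 0<δ , evδ) (M , 0≤M , evM) = ⩽⁺ λ ε 0<ε → case ε (shrink 0≤M 0<ε)
    where
    case : ∀ ε → ∃[ η ] 0ℚ ℚ.< η × M ℚ.* η ℚ.≤ ε →
           Eventually (λ n → seq x n ℚ.* seq z n ℚ.≤ seq y n ℚ.* seq z n ℚ.+ ε)
    case ε (η , 0<η , Mη≤ε) = ev-zip
      (λ n (δ≤z , z≤M) a → lin (ℚ.+-mono-≤ (*-monoʳ (ℚ.≤-trans (ℚ.<⇒≤ 0<δ) δ≤z) a)
           (ℚ.≤-trans (*-monoʳ (ℚ.<⇒≤ 0<η) (ℚ.≤-trans (p≤∣p∣ _) z≤M)) Mη≤ε))
         (solve 5 (λ x y z h e → (y :* z :+ e) :- x :* z
             := ((y :+ h) :* z :+ e) :- (x :* z :+ z :* h)) refl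
           (seq x n) (seq y n) (seq z n) η ε))
      (ev-zip (λ _ → _,_) evδ evM) (p η 0<η)

*-comm : ∀ x y → x * y ≈ y * x
*-comm x y = ≈-ptwise λ n → ℚ.*-comm (seq x n) (seq y n)

*-assoc : ∀ x y z → x * y * z ≈ x * (y * z)
*-assoc x y z = ≈-ptwise λ n → ℚ.*-assoc (seq x n) (seq y n) (seq z n)

*-identityˡ : ∀ x → 1ℝ * x ≈ x
*-identityˡ x = ≈-ptwise λ n → ℚ.*-identityˡ (seq x n)

*-identityʳ : ∀ x → x * 1ℝ ≈ x
*-identityʳ x = ≈-ptwise λ n → ℚ.*-identityʳ (seq x n)

*-monoˡ-⩽ : ∀ {x y z} → 0ℝ ≺ z → x ⩽ y → z * x ⩽ z * y
*-monoˡ-⩽ 0≺z p = ⩽-trans (⩽-reflexive (*-comm _ _))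
  (⩽-trans (*-monoʳ-⩽ 0≺z p) (⩽-reflexive (*-comm _ _)))

*-monoʳ-≺ : ∀ {x y z} → 0ℝ ≺ z → x ≺ y → x * z ≺ y * z
*-monoʳ-≺ {x} {y} {z} (≺⁺ 0<z) (≺⁺ (δ , 0<δ , p)) = from (0<⇒eventually z 0<z)
  where
  from : ∃[ ζ ] 0ℚ ℚ.< ζ × Eventually (λ n → ζ ℚ.≤ seq z n) → x * z ≺ y * z
  from (ζ , 0<ζ , evζ) = ≺⁺ (δ ℚ.* ζ , 0<* 0<δ 0<ζ , ev-zip
    (λ n a ζ≤z → lin
      (ℚ.+-mono-≤ (*-monoʳ (ℚ.≤-trans (ℚ.<⇒≤ 0<ζ) ζ≤z) a) (*-monoˡ (ℚ.<⇒≤ 0<δ) ζ≤z))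
      (solve 5 (λ x y z d c → y :* z :- (x :* z :+ d :* c)
          := (y :* z :+ d :* z) :- ((x :+ d) :* z :+ d :* c)) refl
        (seq x n) (seq y n) (seq z n) δ ζ))
    p evζ)

*-monoˡ-≺ : ∀ {x y z} → 0ℝ ≺ z → x ≺ y → z * x ≺ z * y
*-monoˡ-≺ 0≺z p = ⩽-≺-trans (⩽-reflexive (*-comm _ _))
  (≺-⩽-trans (*-monoʳ-≺ 0≺z p) (⩽-reflexive (*-comm _ _)))

*-cancelʳ-⩽ : ∀ {x y z} → 0ℝ ≺ z → x * z ⩽ y * z → x ⩽ y
*-cancelʳ-⩽ 0≺z p = ⊀⇒⩽ λ y≺x → ⩽⇒⊀ p (*-monoʳ-≺ 0≺z y≺x)

*-congʳ : ∀ {x y} z → x ≈ y → x * z ≈ y * z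
*-congʳ {x} {y} z (≈⁺ p) = from (bounded z)
  where
  from : ∃[ M ] 0ℚ ℚ.≤ M × Eventually (λ n → ℚ.∣ seq z n ∣ ℚ.≤ M) → x * z ≈ y * z
  from (M , 0≤M , evM) = ≈⁺ λ ε 0<ε → case ε (shrink 0≤M 0<ε)
    where
    case : ∀ ε → ∃[ η ] 0ℚ ℚ.< η × M ℚ.* η ℚ.≤ ε →
           Eventually (λ n → ℚ.∣ seq x n ℚ.* seq z n ℚ.- seq y n ℚ.* seq z n ∣ ℚ.≤ ε)
    case ε (η , 0<η , Mη≤ε) = ev-zip
      (λ n z≤M a → subst (ℚ._≤ ε)
        (trans (sym (ℚ.∣p*q∣≡∣p∣*∣q∣ (seq z n) (seq x n ℚ.- seq y n)))
          (cong ℚ.∣_∣ (solve 3 (λ x y z → z :* (x :- y) := x :* z :- y :* z) refl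
            (seq x n) (seq y n) (seq z n))))
        (ℚ.≤-trans (*-mono 0≤M (ℚ.0≤∣p∣ _) z≤M a) Mη≤ε))
      evM (p η 0<η)

*-congˡ : ∀ {x y} z → x ≈ y → z * x ≈ z * y
*-congˡ z p = ≈-trans (*-comm _ _) (≈-trans (*-congʳ z p) (*-comm _ _))

0≺* : ∀ {x y} → 0ℝ ≺ x → 0ℝ ≺ y → 0ℝ ≺ x * y
0≺* {x} {y} (≺⁺ p) (≺⁺ q) = ≺⁺ (0<-* {x} {y} p q)

0≺1 : 0ℝ ≺ 1ℝ
0≺1 = ≺⁺ (0<fromℚ 0<1)

≺-of-pos : ∀ {x y} → 0ℝ ≺ x → y ≺ y + x
≺-of-pos {x} {y} p = ≺-lin p λ n → solve 2 (λ x y → (y :+ x) :- y := x :- con 0ℚ) refl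
  (seq x n) (seq y n)

≺⇒0≺- : ∀ {x y} → x ≺ y → 0ℝ ≺ y - x
≺⇒0≺- {x} {y} p = ≺-lin p λ n → solve 2 (λ x y → (y :- x) :- con 0ℚ := y :- x) refl
  (seq x n) (seq y n)

1⩽⇒0≺ : ∀ {x} → 1ℝ ⩽ x → 0ℝ ≺ x
1⩽⇒0≺ = ≺-⩽-trans 0≺1

module _ {x : ℝ} (0<x : 0ℝ < x) where

  *-recip : x * recip x 0<x ≈ 1ℝ
  *-recip = from (0<⇒eventually x 0<x)
    where
    from : ∃[ δ ] 0ℚ ℚ.< δ × Eventually (λ n → δ ℚ.≤ seq x n) → x * recip x 0<x ≈ 1ℝ
    from (δ , 0<δ , ev) = ≈-ev (ev-map
      (λ n δ≤x → inv-inverse (>⇒≢ (ℚ.<-≤-trans 0<δ δ≤x))) ev)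

  0≺recip : 0ℝ ≺ recip x 0<x
  0≺recip = from (0<⇒eventually x 0<x) (bounded x)
    where
    from : ∃[ δ ] 0ℚ ℚ.< δ × Eventually (λ n → δ ℚ.≤ seq x n) →
           ∃[ M ] 0ℚ ℚ.≤ M × Eventually (λ n → ℚ.∣ seq x n ∣ ℚ.≤ M) → 0ℝ ≺ recip x 0<x
    from (δ , 0<δ , evδ) (M , 0≤M , evM) = ≺⁺ (inv (δ ℚ.+ M) ,
      0<inv (ℚ.<-≤-trans 0<δ (p≤p+ 0≤M)) , ev-zip
        (λ n δ≤x x≤M → subst (ℚ._≤ inv (seq x n)) (sym (ℚ.+-identityˡ _))
          (inv-anti (ℚ.<-≤-trans 0<δ δ≤x)
            (ℚ.≤-trans (ℚ.≤-trans (p≤∣p∣ _) x≤M)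
              (subst (M ℚ.≤_) (ℚ.+-comm M δ) (p≤p+ (ℚ.<⇒≤ 0<δ))))))
        evδ evM)

  recip-* : recip x 0<x * x ≈ 1ℝ
  recip-* = ≈-trans (*-comm (recip x 0<x) x) *-recip

  ÷-*-cancel : ∀ y → y ÷ x ⟨ 0<x ⟩ * x ≈ y
  ÷-*-cancel y = ≈-trans (*-assoc y (recip x 0<x) x)
    (≈-trans (*-congˡ y recip-*) (*-identityʳ y))

  ÷-⩽⇒ : ∀ {y u} → y ÷ x ⟨ 0<x ⟩ ⩽ u → y ⩽ u * x
  ÷-⩽⇒ {y} p = ⩽-trans (⩽-reflexive (≈-sym (÷-*-cancel y))) (*-monoʳ-⩽ (≺⁺ 0<x) p)

  ⇒÷-⩽ : ∀ {y u} → y ⩽ u * x → y ÷ x ⟨ 0<x ⟩ ⩽ u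
  ⇒÷-⩽ {y} p = *-cancelʳ-⩽ (≺⁺ 0<x) (⩽-trans (⩽-reflexive (÷-*-cancel y)) p)

⩽-≈-trans : ∀ {x y z} → x ⩽ y → y ≈ z → x ⩽ z
⩽-≈-trans p q = ⩽-trans p (⩽-reflexive q)

≈-⩽-trans : ∀ {x y z} → x ≈ y → y ⩽ z → x ⩽ z
≈-⩽-trans p q = ⩽-trans (⩽-reflexive p) q

≺-≈-trans : ∀ {x y z} → x ≺ y → y ≈ z → x ≺ z
≺-≈-trans p q = ≺-⩽-trans p (⩽-reflexive q)

≈-≺-trans : ∀ {x y z} → x ≈ y → y ≺ z → x ≺ z
≈-≺-trans p q = ⩽-≺-trans (⩽-reflexive p) q

*-cancelˡ-⩽ : ∀ {x y z} → 0ℝ ≺ z → z * x ⩽ z * y → x ⩽ y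
*-cancelˡ-⩽ 0≺z p = *-cancelʳ-⩽ 0≺z (≈-⩽-trans (*-comm _ _) (⩽-≈-trans p (*-comm _ _)))

*-cancelʳ-≺ : ∀ {x y z} → 0ℝ ≺ z → x * z ≺ y * z → x ≺ y
*-cancelʳ-≺ {x} {y} {z} (≺⁺ 0<z) p = ≈-≺-trans (≈-sym (÷z x)) (≺-≈-trans
  (*-monoʳ-≺ (0≺recip 0<z) p) (÷z y))
  where
  ÷z : ∀ x → x * z * recip z 0<z ≈ x
  ÷z x = ≈-trans (*-assoc x z (recip z 0<z))
    (≈-trans (*-congˡ x (*-recip 0<z)) (*-identityʳ x))

*-cong : ∀ {x y u v} → x ≈ y → u ≈ v → x * u ≈ y * v
*-cong {y = y} {u = u} p q = ≈-trans (*-congʳ u p) (*-congˡ y q)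

half : ℝ → ℝ
half x = fromℚ ½ * x

0≺half : ∀ {x} → 0ℝ ≺ x → 0ℝ ≺ half x
0≺half = 0≺* {fromℚ ½} (≺⁺ (0<fromℚ 0<½))

half≺ : ∀ {x} → 0ℝ ≺ x → half x ≺ x
half≺ {x} 0≺x = ≺-lin (0≺half 0≺x) λ n → solve 1
  (λ x → x :- con ½ :* x := con ½ :* x :- con 0ℚ) refl (seq x n)

-- The exponential function

sum-tail-∣∣ : ∀ {f g : ℕ → ℚ} → (∀ k → ℚ.∣ f k ∣ ℚ.≤ g k) → ∀ d n →
              ℚ.∣ sum (d ℕ.+ n) f ℚ.- sum n f ∣ ℚ.≤ sum (d ℕ.+ n) g ℚ.- sum n g
sum-tail-∣∣ {f} {g} f≤g zero    n = ℚ.≤-reflexive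
  (trans (cong ℚ.∣_∣ (ℚ.+-inverseʳ (sum n f))) (sym (ℚ.+-inverseʳ (sum n g))))
sum-tail-∣∣ {f} {g} f≤g (suc d) n = subst₂ ℚ._≤_
  (cong ℚ.∣_∣ (sym (ex (sum (d ℕ.+ n) f) (f (d ℕ.+ n)) (sum n f))))
  (sym (ex (sum (d ℕ.+ n) g) (g (d ℕ.+ n)) (sum n g)))
  (ℚ.≤-trans (ℚ.∣p+q∣≤∣p∣+∣q∣ (sum (d ℕ.+ n) f ℚ.- sum n f) (f (d ℕ.+ n)))
    (ℚ.+-mono-≤ (sum-tail-∣∣ f≤g d n) (f≤g (d ℕ.+ n))))
  where
  ex : ∀ a b c → (a ℚ.+ b) ℚ.- c ≡ (a ℚ.- c) ℚ.+ b
  ex = solve 3 (λ a b c → (a :+ b) :- c := (a :- c) :+ b) refl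

sum-tail-∣∣-≤ : ∀ {f g : ℕ → ℚ} → (∀ k → ℚ.∣ f k ∣ ℚ.≤ g k) → ∀ {m n} → m ℕ.≤ n →
                ℚ.∣ sum n f ℚ.- sum m f ∣ ℚ.≤ sum n g ℚ.- sum m g
sum-tail-∣∣-≤ {f} {g} f≤g {m} {n} m≤n =
  subst (λ z → ℚ.∣ sum z f ℚ.- sum m f ∣ ℚ.≤ sum z g ℚ.- sum m g) (ℕ.m∸n+n≡m m≤n)
    (sum-tail-∣∣ f≤g (n ℕ.∸ m) m)

sum-monoˡ : ∀ {f : ℕ → ℚ} → (∀ k → 0ℚ ℚ.≤ f k) → ∀ {m n} → m ℕ.≤ n → sum m f ℚ.≤ sum n f
sum-monoˡ {f} 0≤f {m} {n} m≤n = lin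
  (ℚ.≤-trans (ℚ.0≤∣p∣ _) (sum-tail-∣∣-≤ {f} {f} (λ k → ℚ.≤-reflexive (ℚ.0≤p⇒∣p∣≡p (0≤f k))) m≤n))
  (solve 2 (λ a b → b :- a := (b :- a) :- con 0ℚ) refl (sum m f) (sum n f))

-- Double sums and the Cauchy product of exponential series

module Grid (T : ℕ → ℕ → ℚ) where

  -- Σ T (i + a) (k - a) over 0 ≤ a ≤ k
  diagonal : ℕ → ℕ → ℚ
  diagonal i zero    = T i zero
  diagonal i (suc k) = T i (suc k) ℚ.+ diagonal (suc i) k

  -- Σ T (i + a) b over a + b < n
  triangle : ℕ → ℕ → ℚ
  triangle i zero    = 0ℚ
  triangle i (suc n) = sum (suc n) (T i) ℚ.+ triangle (suc i) n

  -- Σ T (i + a) b over a < m and b < n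
  box : ℕ → ℕ → ℕ → ℚ
  box i zero    n = 0ℚ
  box i (suc m) n = sum n (T i) ℚ.+ box (suc i) m n

  triangle-diagonal : ∀ i n → triangle i (suc n) ≡ triangle i n ℚ.+ diagonal i n
  triangle-diagonal i zero    =
    solve 1 (λ x → con 0ℚ :+ x :+ con 0ℚ := con 0ℚ :+ x) refl (T i 0)
  triangle-diagonal i (suc n) = trans
    (cong (sum (suc n) (T i) ℚ.+ T i (suc n) ℚ.+_) (triangle-diagonal (suc i) n))
    (solve 4 (λ s t x d → s :+ t :+ (x :+ d) := s :+ x :+ (t :+ d)) refl
      (sum (suc n) (T i)) (T i (suc n)) (triangle (suc i) n) (diagonal (suc i) n))

  triangle-sum : ∀ n → triangle 0 n ≡ sum n (diagonal 0)
  triangle-sum zero    = refl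
  triangle-sum (suc n) = trans (triangle-diagonal 0 n)
    (cong (ℚ._+ diagonal 0 n) (triangle-sum n))

  box-last : ∀ i m n → box i (suc m) n ≡ box i m n ℚ.+ sum n (T (m ℕ.+ i))
  box-last i zero    n = ℚ.+-comm (sum n (T i)) 0ℚ
  box-last i (suc m) n = trans
    (cong (sum n (T i) ℚ.+_) (trans (box-last (suc i) m n)
      (cong (λ k → box (suc i) m n ℚ.+ sum n (T k)) (ℕ.+-suc m i))))
    (sym (ℚ.+-assoc (sum n (T i)) (box (suc i) m n) (sum n (T (suc m ℕ.+ i)))))

  module _ (0≤T : ∀ i j → 0ℚ ℚ.≤ T i j) where

    0≤triangle : ∀ i n → 0ℚ ℚ.≤ triangle i n
    0≤triangle i zero    = ℚ.≤-refl
    0≤triangle i (suc n) = 0≤+ (sum-monoˡ (0≤T i) {0} {suc n} ℕ.z≤n) (0≤triangle (suc i) n)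

    box≤triangle : ∀ i m n → box i m n ℚ.≤ triangle i (m ℕ.+ n)
    box≤triangle i zero    n = 0≤triangle i n
    box≤triangle i (suc m) n = ℚ.+-mono-≤
      (sum-monoˡ (0≤T i) (ℕ.m≤n⇒m≤1+n (ℕ.m≤n+m n m))) (box≤triangle (suc i) m n)

open Grid using (diagonal; triangle; box)

-- For m ≤ n the triangle lies inside the box, so both differences are sums over the same leftover
-- cells and the bound holds cell by cell.
box-triangle-∣∣ : ∀ {S T : ℕ → ℕ → ℚ} → (∀ i j → ℚ.∣ S i j ∣ ℚ.≤ T i j) →
  ∀ i {m n} → m ℕ.≤ n →
  ℚ.∣ box S i m n ℚ.- triangle S i m ∣ ℚ.≤ box T i m n ℚ.- triangle T i m
box-triangle-∣∣ S≤T i {zero} m≤n = ℚ.≤-refl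
box-triangle-∣∣ {S} {T} S≤T i {suc m} {n} m<n = subst₂ ℚ._≤_
  (cong ℚ.∣_∣ (sym (ex (sum n (S i)) (box S (suc i) m n) (sum (suc m) (S i))
    (triangle S (suc i) m))))
  (sym (ex (sum n (T i)) (box T (suc i) m n) (sum (suc m) (T i)) (triangle T (suc i) m)))
  (ℚ.≤-trans (ℚ.∣p+q∣≤∣p∣+∣q∣ (sum n (S i) ℚ.- sum (suc m) (S i))
      (box S (suc i) m n ℚ.- triangle S (suc i) m))
    (ℚ.+-mono-≤ (sum-tail-∣∣-≤ (S≤T i) m<n) (box-triangle-∣∣ S≤T (suc i) (ℕ.<⇒≤ m<n))))
  where
  ex : ∀ a b c d → (a ℚ.+ b) ℚ.- (c ℚ.+ d) ≡ (a ℚ.- c) ℚ.+ (b ℚ.- d)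
  ex = solve 4 (λ a b c d → (a :+ b) :- (c :+ d) := (a :- c) :+ (b :- d)) refl

expTerm-suc : ∀ t k → fromℕ (suc k) ℚ.* expTerm t (suc k) ≡ t ℚ.* expTerm t k
expTerm-suc t k = trans
  (solve 4 (λ n e t r → n :* (e :* (t :* r)) := t :* e :* (n :* r)) refl
    (fromℕ (suc k)) (expTerm t k) t (inv (fromℕ (suc k))))
  (trans (cong (t ℚ.* expTerm t k ℚ.*_) (inv-inverse (>⇒≢ (0<fromℕ k)))) (ℚ.*-identityʳ _))

expGrid : ℚ → ℚ → ℕ → ℕ → ℚ
expGrid s t i j = expTerm s i ℚ.* expTerm t j

module _ (s t : ℚ) where

  private
    T : ℕ → ℕ → ℚ
    T = expGrid s t

  expGrid-step : ∀ i j → (s ℚ.+ t) ℚ.* T i j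
                 ≡ fromℕ (suc i) ℚ.* T (suc i) j ℚ.+ fromℕ (suc j) ℚ.* T i (suc j)
  expGrid-step i j = sym (trans
    (solve 6 (λ m n a a′ b b′ → m :* (a′ :* b) :+ n :* (a :* b′)
                             := (m :* a′) :* b :+ (n :* b′) :* a) refl
      (fromℕ (suc i)) (fromℕ (suc j)) (expTerm s i) (expTerm s (suc i))
      (expTerm t j) (expTerm t (suc j)))
    (trans
      (cong₂ (λ x y → x ℚ.* expTerm t j ℚ.+ y ℚ.* expTerm s i) (expTerm-suc s i) (expTerm-suc t j))
      (solve 4 (λ s t a b → s :* a :* b :+ t :* b :* a := (s :+ t) :* (a :* b)) refl
        s t (expTerm s i) (expTerm t j))))

  -- The binomial theorem divided by factorials. By `expGrid-step` each cell feeds its two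
  -- neighbours; a cell of the next diagonal beyond the first collects its row index plus its column
  -- index, k + i + 1 in total. At i = 0 the two factors agree. The starting row stays general
  -- because `diagonal` recurses into row i + 1.
  diagonal-step : ∀ i k → (s ℚ.+ t) ℚ.* diagonal T i k
                  ≡ fromℕ (suc k) ℚ.* T i (suc k)
                    ℚ.+ fromℕ (suc (k ℕ.+ i)) ℚ.* diagonal T (suc i) k
  diagonal-step i zero    = trans (expGrid-step i 0)
    (ℚ.+-comm (fromℕ (suc i) ℚ.* T (suc i) 0) (fromℕ 1 ℚ.* T i 1))
  diagonal-step i (suc k) = trans (ℚ.*-distribˡ-+ (s ℚ.+ t) (T i (suc k)) (diagonal T (suc i) k))
    (trans (cong₂ ℚ._+_ (expGrid-step i (suc k)) (diagonal-step (suc i) k))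
      (trans
        (cong (λ x → fromℕ (suc i) ℚ.* u ℚ.+ v ℚ.+ (fromℕ (suc k) ℚ.* u ℚ.+ x ℚ.* d)) N≡)
        (trans
          (solve 6 (λ a u v k n d → a :* u :+ v :+ (k :* u :+ n :* d)
                                  := v :+ ((k :+ a) :* u :+ n :* d)) refl
            (fromℕ (suc i)) u v (fromℕ (suc k)) N d)
          (trans (cong (λ x → v ℚ.+ (x ℚ.* u ℚ.+ N ℚ.* d))
              (trans (sym (fromℕ-+ (suc k) (suc i))) N≡))
            (cong (v ℚ.+_) (sym (ℚ.*-distribˡ-+ N u d)))))))
    where
    N u v d : ℚ
    N = fromℕ (suc (suc k ℕ.+ i))
    u = T (suc i) (suc k)
    v = fromℕ (suc (suc k)) ℚ.* T i (suc (suc k))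
    d = diagonal T (suc (suc i)) k
    N≡ : fromℕ (suc (k ℕ.+ suc i)) ≡ N
    N≡ = cong (λ m → fromℕ (suc m)) (ℕ.+-suc k i)

  expTerm-+ : ∀ k → expTerm (s ℚ.+ t) k ≡ diagonal T 0 k
  expTerm-+ zero    = refl
  expTerm-+ (suc k) = trans (cong (ℚ._* ((s ℚ.+ t) ℚ.* r)) (expTerm-+ k))
    (trans (solve 3 (λ d z r → d :* (z :* r) := r :* (z :* d)) refl (diagonal T 0 k) (s ℚ.+ t) r)
      (trans (cong (r ℚ.*_) (trans (diagonal-step 0 k)
          (cong (λ m → N ℚ.* T 0 (suc k) ℚ.+ fromℕ (suc m) ℚ.* diagonal T 1 k) (ℕ.+-identityʳ k))))
        (trans (solve 4 (λ r n a b → r :* (n :* a :+ n :* b) := n :* r :* (a :+ b)) refl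
            r N (T 0 (suc k)) (diagonal T 1 k))
          (trans (cong (ℚ._* (T 0 (suc k) ℚ.+ diagonal T 1 k)) (inv-inverse (>⇒≢ (0<fromℕ k))))
            (ℚ.*-identityˡ _)))))
    where
    N r : ℚ
    N = fromℕ (suc k)
    r = inv N

  expSum-+ : ∀ n → expSum n (s ℚ.+ t) ≡ triangle T 0 n
  expSum-+ n = trans (go n) (sym (Grid.triangle-sum T n))
    where
    go : ∀ n → expSum n (s ℚ.+ t) ≡ sum n (diagonal T 0)
    go zero    = refl
    go (suc n) = cong₂ ℚ._+_ (go n) (expTerm-+ n)

  expSum-* : ∀ m n → expSum m s ℚ.* expSum n t ≡ box T 0 m n
  expSum-* zero    n = ℚ.*-zeroˡ (expSum n t)
  expSum-* (suc m) n = trans (ℚ.*-distribʳ-+ (expSum n t) (expSum m s) (expTerm s m))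
    (trans (cong₂ ℚ._+_ (expSum-* m n) (sym (sum-scale n (expTerm s m) (expTerm t))))
      (trans (cong (λ i → box T 0 m n ℚ.+ sum n (T i)) (sym (ℕ.+-identityʳ m)))
        (sym (Grid.box-last T 0 m n))))

0≤expTerm : ∀ {t} → 0ℚ ℚ.≤ t → ∀ k → 0ℚ ℚ.≤ expTerm t k
0≤expTerm 0≤t = ExpBounds.0≤term 0≤t

expSum-monoˡ : ∀ {t} → 0ℚ ℚ.≤ t → ∀ {m n} → m ℕ.≤ n → expSum m t ℚ.≤ expSum n t
expSum-monoˡ 0≤t = sum-monoˡ (0≤expTerm 0≤t)

-- The error consists of the cells of the n × n box outside the triangle. Replacing s and t by M
-- only enlarges them, and the box lies in the triangle of side n + n, so a tail of the series of
-- exp (2 M) bounds the error.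
expSum-additive : ∀ {M s t} → 0ℚ ℚ.≤ M → ℚ.∣ s ∣ ℚ.≤ M → ℚ.∣ t ∣ ℚ.≤ M → ∀ n →
  ℚ.∣ expSum n s ℚ.* expSum n t ℚ.- expSum n (s ℚ.+ t) ∣
  ℚ.≤ expSum (n ℕ.+ n) (M ℚ.+ M) ℚ.- expSum n (M ℚ.+ M)
expSum-additive {M} {s} {t} 0≤M s≤M t≤M n = subst₂ ℚ._≤_
  (cong ℚ.∣_∣ (sym (cong₂ ℚ._-_ (expSum-* s t n n) (expSum-+ s t n))))
  (sym (cong₂ ℚ._-_ (expSum-+ M M (n ℕ.+ n)) (expSum-+ M M n)))
  (ℚ.≤-trans
    (box-triangle-∣∣ (λ i j → subst (ℚ._≤ expGrid M M i j)
        (sym (ℚ.∣p*q∣≡∣p∣*∣q∣ (expTerm s i) (expTerm t j)))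
        (*-mono (0≤expTerm 0≤M i) (ℚ.0≤∣p∣ (expTerm t j))
          (ExpBounds.term-bound 0≤M s≤M i) (ExpBounds.term-bound 0≤M t≤M j)))
      0 (ℕ.≤-refl {n}))
    (ℚ.+-monoˡ-≤ (ℚ.- triangle (expGrid M M) 0 n)
      (Grid.box≤triangle (expGrid M M) (λ i j → 0≤* (0≤expTerm 0≤M i) (0≤expTerm 0≤M j)) 0 n n)))

expTail : ∀ {M} → 0ℚ ℚ.≤ M → ∀ {ε} → 0ℚ ℚ.< ε →
          ∃[ N ] ∀ {m n} → N ℕ.≤ m → m ℕ.≤ n → expSum n M ℚ.- expSum m M ℚ.≤ ε
expTail {M} 0≤M {ε} 0<ε with cauchy (exp (fromℚ M)) ε 0<ε
... | N , p = N , λ {m} {n} N≤m m≤n →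
  ℚ.≤-trans (p≤∣p∣ _) (p n m (ℕ.≤-trans N≤m m≤n) N≤m)

expSum-uniform : ∀ {M} → 0ℚ ℚ.≤ M → ∀ {ε} → 0ℚ ℚ.< ε →
  ∃[ N ] ∀ {m n} → N ℕ.≤ m → N ℕ.≤ n → ∀ {t} → ℚ.∣ t ∣ ℚ.≤ M →
  ℚ.∣ expSum n t ℚ.- expSum m t ∣ ℚ.≤ ε
expSum-uniform {M} 0≤M {ε} 0<ε with expTail 0≤M 0<ε
... | N , tail = N , λ {m} {n} → go m n
  where
  ordered : ∀ m n → N ℕ.≤ m → m ℕ.≤ n → ∀ {t} → ℚ.∣ t ∣ ℚ.≤ M →
            ℚ.∣ expSum n t ℚ.- expSum m t ∣ ℚ.≤ ε
  ordered m n N≤m m≤n t≤M = ℚ.≤-trans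
    (sum-tail-∣∣-≤ (ExpBounds.term-bound 0≤M t≤M) m≤n) (tail N≤m m≤n)
  go : ∀ m n → N ℕ.≤ m → N ℕ.≤ n → ∀ {t} → ℚ.∣ t ∣ ℚ.≤ M →
       ℚ.∣ expSum n t ℚ.- expSum m t ∣ ℚ.≤ ε
  go m n N≤m N≤n {t} t≤M with ℕ.≤-total m n
  ... | inj₁ m≤n = ordered m n N≤m m≤n t≤M
  ... | inj₂ n≤m = subst (ℚ._≤ ε) (∣p-q∣-sym (expSum m t) (expSum n t))
    (ordered n m N≤n n≤m t≤M)

exp-ptwise : ∀ {x y} → (∀ n → seq x n ≡ seq y n) → exp x ≈ exp y
exp-ptwise e = ≈-ptwise λ n → cong (expSum n) (e n)

exp-+ : ∀ x y → exp (x + y) ≈ exp x * exp y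
exp-+ x y = from (bounded x) (bounded y)
  where
  from : ∃[ M ] 0ℚ ℚ.≤ M × Eventually (λ n → ℚ.∣ seq x n ∣ ℚ.≤ M) →
         ∃[ M ] 0ℚ ℚ.≤ M × Eventually (λ n → ℚ.∣ seq y n ∣ ℚ.≤ M) →
         exp (x + y) ≈ exp x * exp y
  from (K , 0≤K , evK) (L , 0≤L , evL) = ≈-sym (≈⁺ λ ε 0<ε → close ε (expTail (0≤+ 0≤M 0≤M) 0<ε))
    where
    M : ℚ
    M = K ℚ.+ L
    0≤M : 0ℚ ℚ.≤ M
    0≤M = 0≤+ 0≤K 0≤L
    close : ∀ ε → _ → Eventually (λ n → ℚ.∣ expSum n (seq x n) ℚ.* expSum n (seq y n)
                                      ℚ.- expSum n (seq x n ℚ.+ seq y n) ∣ ℚ.≤ ε)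
    close ε (N , tail) = ev-zip
      (λ n (x≤K , y≤L) N≤n → ℚ.≤-trans
        (expSum-additive 0≤M (ℚ.≤-trans x≤K (p≤p+ 0≤L))
          (ℚ.≤-trans y≤L (subst (L ℚ.≤_) (ℚ.+-comm L K) (p≤p+ 0≤K))) n)
        (tail N≤n (ℕ.m≤m+n n n)))
      (ev-zip (λ _ → _,_) evK evL) (N , λ _ le → le)

exp-0 : ∀ {x} → (∀ n → seq x n ≡ 0ℚ) → exp x ≈ 1ℝ
-- Index 0 is skipped: the empty partial sum is 0, not 1.
exp-0 {x} x≡0 = ≈-ev (1 , λ { (suc n) _ → trans (cong (expSum (suc n)) (x≡0 (suc n))) (go n) })
  where
  go : ∀ n → expSum (suc n) 0ℚ ≡ 1ℚ
  go zero    = refl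
  go (suc n) = cong₂ ℚ._+_ (go n)
    (trans (cong (expTerm 0ℚ n ℚ.*_) (ℚ.*-zeroˡ (inv (fromℕ (suc n))))) (ℚ.*-zeroʳ (expTerm 0ℚ n)))

exp-inverse : ∀ x → exp x * exp (- x) ≈ 1ℝ
exp-inverse x = ≈-trans (≈-sym (exp-+ x (- x)))
  (exp-0 (λ n → ℚ.+-inverseʳ (seq x n)))

expTerm-1 : ∀ t → expTerm t 1 ≡ t
expTerm-1 t = solve 1 (λ t → con 1ℚ :* (t :* con 1ℚ) := t) refl t

expSum-lower : ∀ {t} → 0ℚ ℚ.≤ t → ∀ {n} → 2 ℕ.≤ n → 1ℚ ℚ.+ t ℚ.≤ expSum n t
expSum-lower {t} 0≤t {n} 2≤n = subst (ℚ._≤ expSum n t)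
  (trans (cong (0ℚ ℚ.+ 1ℚ ℚ.+_) (expTerm-1 t)) (cong (ℚ._+ t) (ℚ.+-identityˡ 1ℚ)))
  (expSum-monoˡ 0≤t 2≤n)

-- Comparison with the geometric series Σ tᵏ = 1 / (1 - t).
expSum-upper : ∀ {t} → 0ℚ ℚ.≤ t → ∀ n → (1ℚ ℚ.- t) ℚ.* expSum n t ℚ.≤ 1ℚ
expSum-upper {t} 0≤t zero    = subst (ℚ._≤ 1ℚ) (sym (ℚ.*-zeroʳ (1ℚ ℚ.- t))) 0≤1
expSum-upper {t} 0≤t (suc n) = ℚ.≤-trans (p≤p+ (0≤* 0≤t (0≤expTerm 0≤t n))) (go n)
  where
  inv≤1 : ∀ n → inv (fromℕ (suc n)) ℚ.≤ 1ℚ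
  inv≤1 n = inv-anti 0<1 (fromℕ-mono (ℕ.s≤s (ℕ.z≤n {n})))

  term≤ : ∀ n → expTerm t (suc n) ℚ.≤ t ℚ.* expTerm t n
  term≤ n = lin (*-monoˡ (0≤* 0≤t (0≤expTerm 0≤t n)) (inv≤1 n))
    (solve 3 (λ t e i → t :* e :- e :* (t :* i) := t :* e :* con 1ℚ :- t :* e :* i) refl
      t (expTerm t n) (inv (fromℕ (suc n))))

  -- The added t times the last term makes the induction work: the next term is at most t times the
  -- last one, so it is already paid for.
  go : ∀ n → (1ℚ ℚ.- t) ℚ.* expSum (suc n) t ℚ.+ t ℚ.* expTerm t n ℚ.≤ 1ℚ
  go zero    = ℚ.≤-reflexive
    (solve 1 (λ t → (con 1ℚ :- t) :* (con 0ℚ :+ con 1ℚ) :+ t :* con 1ℚ := con 1ℚ) refl t)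
  go (suc n) = lin (ℚ.+-mono-≤ (go n) (term≤ n))
    (solve 4 (λ t s e f → con 1ℚ :- ((con 1ℚ :- t) :* (s :+ f) :+ t :* f)
        := (con 1ℚ :+ t :* e) :- (((con 1ℚ :- t) :* s :+ t :* e) :+ f)) refl
      t (expSum (suc n) t) (expTerm t n) (expTerm t (suc n)))

module _ (x : ℝ) where

  private
    product≈1 : ∀ ε → 0ℚ ℚ.< ε → Eventually (λ n →
                  ℚ.∣ expSum n (seq x n) ℚ.* expSum n (ℚ.- seq x n) ℚ.- 1ℚ ∣ ℚ.≤ ε)
    product≈1 = ≈⁻ (exp-inverse x)

    1-ε≤ : ∀ p {ε} → ℚ.∣ p ℚ.- 1ℚ ∣ ℚ.≤ ε → 1ℚ ℚ.- ε ℚ.≤ p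
    1-ε≤ p {ε} h = lin (ℚ.≤-trans (p≤∣p∣ _) (subst (ℚ._≤ ε) (∣p-q∣-sym p 1ℚ) h))
      (solve 2 (λ p e → p :- (con 1ℚ :- e) := e :- (con 1ℚ :- p)) refl p ε)

    *-cancel : ∀ {a b c} → 0ℚ ℚ.< c → a ℚ.* c ℚ.≤ b ℚ.* c → a ℚ.≤ b
    *-cancel {c = c} 0<c = ℚ.*-cancelʳ-≤-pos c {{ℚ.positive 0<c}}

    1≤expSum : ∀ {t n} → 0ℚ ℚ.≤ t → 2 ℕ.≤ n → 1ℚ ℚ.≤ expSum n t
    1≤expSum 0≤t 2≤n = ℚ.≤-trans (p≤p+ 0≤t) (expSum-lower 0≤t 2≤n)

    0≤neg : ∀ {s} → s ℚ.≤ 0ℚ → 0ℚ ℚ.≤ ℚ.- s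
    0≤neg {s} s≤0 = lin s≤0 (solve 1 (λ s → :- s :- con 0ℚ := con 0ℚ :- s) refl s)

  -- Negative arguments are reduced to positive ones by exp x * exp (- x) = 1.
  1+x⩽exp : 1ℝ + x ⩽ exp x
  1+x⩽exp = ⩽⁺ λ ε 0<ε → ev-zip (λ n → bound n ε 0<ε)
    (product≈1 (ε ℚ.⊓ ½) (0<⊓ 0<ε)) (2 , λ _ le → le)
    where
    0<⊓ : ∀ {ε} → 0ℚ ℚ.< ε → 0ℚ ℚ.< ε ℚ.⊓ ½
    0<⊓ {ε} 0<ε with ℚ.⊓-sel ε ½
    ... | inj₁ e = subst (0ℚ ℚ.<_) (sym e) 0<ε
    ... | inj₂ e = subst (0ℚ ℚ.<_) (sym e) 0<½

    bound : ∀ n ε → 0ℚ ℚ.< ε →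
            ℚ.∣ expSum n (seq x n) ℚ.* expSum n (ℚ.- seq x n) ℚ.- 1ℚ ∣ ℚ.≤ ε ℚ.⊓ ½ →
            2 ℕ.≤ n → 1ℚ ℚ.+ seq x n ℚ.≤ expSum n (seq x n) ℚ.+ ε
    bound n ε 0<ε close 2≤n with ℚ.≤-total 0ℚ (seq x n)
    ... | inj₁ 0≤s = ℚ.≤-trans (expSum-lower 0≤s 2≤n) (p≤p+ (ℚ.<⇒≤ 0<ε))
    -- Write s = `seq x n` and E = `expSum n s`. Multiplied by F, the claim follows from (1 + s) F ≤
    -- 1, the geometric bound at - s, from E F ≥ 1 - ε, and from ε F ≥ ε.
    ... | inj₂ s≤0 = *-cancel 0<F (lin
      (ℚ.+-mono-≤ (ℚ.+-mono-≤ (1-ε≤ (expSum n (seq x n) ℚ.* F) (ℚ.≤-trans close (ℚ.p⊓q≤p ε ½))) (expSum-upper 0≤h n))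
        (*-monoˡ (ℚ.<⇒≤ 0<ε) (1≤expSum 0≤h 2≤n)))
      (solve 4 (λ s e f d → (e :+ d) :* f :- (con 1ℚ :+ s) :* f
          := (e :* f :+ con 1ℚ :+ d :* f) :- ((con 1ℚ :- d) :+ (con 1ℚ :- :- s) :* f :+ d :* con 1ℚ)) refl
        (seq x n) (expSum n (seq x n)) F ε))
      where
      F : ℚ
      F = expSum n (ℚ.- seq x n)
      0≤h : 0ℚ ℚ.≤ ℚ.- seq x n
      0≤h = 0≤neg s≤0
      0<F : 0ℚ ℚ.< F
      0<F = ℚ.<-≤-trans 0<1 (1≤expSum 0≤h 2≤n)

  -- If L bounds the partial sums of exp (- x) and their product with those of exp x is at least
  -- 1/2, then the latter stay above 1 / (2 L), a rational witness of positivity.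
  0≺exp : 0ℝ ≺ exp x
  0≺exp = from (bounded (exp (- x)))
    where
    from : ∃[ M ] 0ℚ ℚ.≤ M × Eventually (λ n → ℚ.∣ expSum n (ℚ.- seq x n) ∣ ℚ.≤ M) →
           0ℝ ≺ exp x
    from (M , 0≤M , evM) = ≺⁺ (eventually⇒0< (exp x) δ 0<δ
      (proj₁ ev) (proj₂ ev))
      where
      L δ : ℚ
      L = 1ℚ ℚ.+ M
      δ = ½ ℚ.* inv L
      1≤L : 1ℚ ℚ.≤ L
      1≤L = p≤p+ 0≤M
      0<L : 0ℚ ℚ.< L
      0<L = ℚ.<-≤-trans 0<1 1≤L
      0<δ : 0ℚ ℚ.< δ
      0<δ = 0<half (0<inv 0<L)
      bound : ∀ n → ℚ.∣ expSum n (ℚ.- seq x n) ∣ ℚ.≤ M →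
              ℚ.∣ expSum n (seq x n) ℚ.* expSum n (ℚ.- seq x n) ℚ.- 1ℚ ∣ ℚ.≤ ½ × 2 ℕ.≤ n →
              δ ℚ.≤ expSum n (seq x n)
      bound n F≤M (close , 2≤n) with ℚ.≤-total 0ℚ (seq x n)
      ... | inj₁ 0≤s = ℚ.≤-trans
        (*-mono 0≤1 (ℚ.<⇒≤ (0<inv 0<L)) ½≤1 (inv-anti 0<1 1≤L))
        (1≤expSum 0≤s 2≤n)
        where
        ½≤1 : ½ ℚ.≤ 1ℚ
        ½≤1 = ½^≤1 1
      ... | inj₂ s≤0 = *-cancel 0<F (ℚ.≤-trans
        (*-monoˡ (ℚ.<⇒≤ 0<δ) F≤L)
        (ℚ.≤-trans (ℚ.≤-reflexive (trans (ℚ.*-assoc ½ (inv L) L)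
            (cong (½ ℚ.*_) (trans (ℚ.*-comm (inv L) L) (inv-inverse (>⇒≢ 0<L))))))
          (1-ε≤ (expSum n (seq x n) ℚ.* expSum n (ℚ.- seq x n)) close)))
        where
        0<F : 0ℚ ℚ.< expSum n (ℚ.- seq x n)
        0<F = ℚ.<-≤-trans 0<1 (1≤expSum (0≤neg s≤0) 2≤n)
        F≤L : expSum n (ℚ.- seq x n) ℚ.≤ L
        F≤L = ℚ.≤-trans (ℚ.≤-trans (p≤∣p∣ _) F≤M)
          (subst (M ℚ.≤_) (ℚ.+-comm M 1ℚ) (p≤p+ 0≤1))
      ev : Eventually (λ n → δ ℚ.≤ expSum n (seq x n))
      ev = ev-zip bound evM (ev-zip (λ _ → _,_) (product≈1 ½ 0<½) (2 , λ _ le → le))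

exp-split : ∀ x y → exp y ≈ exp x * exp (y - x)
exp-split x y = ≈-trans
  (exp-ptwise {y} {x + (y - x)} λ n → solve 2 (λ x y → y := x :+ (y :- x)) refl (seq x n) (seq y n))
  (exp-+ x (y - x))

-- exp y = exp x exp (y - x) ≥ exp x (1 + (y - x)), and exp x is positive.
exp-mono-≺ : ∀ {x y} → x ≺ y → exp x ≺ exp y
exp-mono-≺ {x} {y} x≺y = ⩽-≺-trans (⩽-reflexive (≈-sym (*-identityʳ (exp x))))
  (≺-⩽-trans (*-monoˡ-≺ (0≺exp x) (≺-⩽-trans
      (≺-lin {u = 1ℝ} {v = 1ℝ + (y - x)} x≺y λ n →
        solve 2 (λ x y → (con 1ℚ :+ (y :- x)) :- con 1ℚ := y :- x) refl (seq x n) (seq y n))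
      (1+x⩽exp (y - x))))
    (⩽-reflexive (≈-sym (exp-split x y))))

exp-mono-⩽ : ∀ {x y} → x ⩽ y → exp x ⩽ exp y
exp-mono-⩽ {x} {y} x⩽y = ⩽-trans (⩽-reflexive (≈-sym (*-identityʳ (exp x))))
  (⩽-trans (*-monoˡ-⩽ (0≺exp x) (⩽-trans
      (⩽-lin {u = 1ℝ} {v = 1ℝ + (y - x)} x⩽y λ n →
        solve 2 (λ x y → (con 1ℚ :+ (y :- x)) :- con 1ℚ := y :- x) refl (seq x n) (seq y n))
      (1+x⩽exp (y - x))))
    (⩽-reflexive (≈-sym (exp-split x y))))

exp-reflects-⩽ : ∀ {x y} → exp x ⩽ exp y → x ⩽ y
exp-reflects-⩽ p = ⊀⇒⩽ λ y≺x → ⩽⇒⊀ p (exp-mono-≺ y≺x)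

-- The logarithm as the inverse of exp

exp*1-x⩽1 : ∀ x → (1ℝ - x) * exp x ⩽ 1ℝ
exp*1-x⩽1 x = ⩽-trans (*-monoʳ-⩽ (0≺exp x) (1+x⩽exp (- x)))
  (⩽-reflexive (≈-trans (*-comm (exp (- x)) (exp x)) (exp-inverse x)))

-- The summands w / (1 + k w) of lnSum are the relative increments of the
-- partition points, so the products of 1 + w / (1 + k w) and of
-- 1 - w / (1 + k w) telescope, while 1 + h ≤ exp h ≤ 1 / (1 - h).
module Telescope (w : ℚ) where

  point : ℕ → ℚ
  point k = 1ℚ ℚ.+ fromℕ k ℚ.* w

  term : ℕ → ℚ
  term k = w ℚ.* inv (point k)

  point-suc : ∀ k → point (suc k) ≡ point k ℚ.+ w
  point-suc k = trans (cong (λ a → 1ℚ ℚ.+ a ℚ.* w) (fromℕ-suc k))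
    (solve 2 (λ a w → con 1ℚ :+ (con 1ℚ :+ a) :* w := con 1ℚ :+ a :* w :+ w) refl (fromℕ k) w)

  point*term : ∀ k → 0ℚ ℚ.< point k → point k ℚ.* term k ≡ w
  point*term k 0<p = trans
    (solve 3 (λ p w i → p :* (w :* i) := w :* (p :* i)) refl (point k) w (inv (point k)))
    (trans (cong (w ℚ.*_) (inv-inverse (>⇒≢ 0<p))) (ℚ.*-identityʳ w))

  expPart : ℕ → ℝ
  expPart k = exp (fromℚ (sum k term))

  expPart-suc : ∀ k → expPart (suc k) ≈ expPart k * exp (fromℚ (term k))
  expPart-suc k = ≈-trans
    (exp-ptwise {fromℚ (sum (suc k) term)} {fromℚ (sum k term) + fromℚ (term k)} λ _ → refl)
    (exp-+ (fromℚ (sum k term)) (fromℚ (term k)))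

  lower : ∀ k → (∀ j → j ℕ.< k → 0ℚ ℚ.< point j) → fromℚ (point k) ⩽ expPart k
  lower zero    _   = ⩽-trans
    (⩽-reflexive (≈-ptwise λ _ → solve 1 (λ w → con 1ℚ :+ con 0ℚ :* w := con 1ℚ) refl w))
    (⩽-reflexive (≈-sym (exp-0 {fromℚ 0ℚ} λ _ → refl)))
  lower (suc k) 0<p = ⩽-trans
    (⩽-reflexive (≈-ptwise λ _ → trans (point-suc k)
      (trans (cong (point k ℚ.+_) (sym (point*term k (0<p k ℕ.≤-refl))))
        (solve 2 (λ p h → p :+ p :* h := p :* (con 1ℚ :+ h)) refl (point k) (term k)))))
    (⩽-trans (*-monoˡ-⩽ (≺⁺ (0<fromℚ (0<p k ℕ.≤-refl))) (1+x⩽exp (fromℚ (term k))))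
      (⩽-trans (*-monoʳ-⩽ (0≺exp (fromℚ (term k))) (lower k (λ j j<k → 0<p j (ℕ.m<n⇒m<1+n j<k))))
        (⩽-reflexive (≈-sym (expPart-suc k)))))

  -- Since 1 - `term j` is the quotient of the points j - 1 and j, the telescoped product is shifted
  -- by one: 1 - w and `point k` - w are the points with indices -1 and k - 1. The product form
  -- avoids dividing by 1 - w, which need not be positive on a coarse partition.
  upper : ∀ k → (∀ j → j ℕ.< k → 0ℚ ℚ.< point j) →
          expPart k * fromℚ (1ℚ ℚ.- w) ⩽ fromℚ (point k ℚ.- w)
  upper zero    _   = ⩽-trans
    (⩽-reflexive (*-congʳ (fromℚ (1ℚ ℚ.- w)) (exp-0 {fromℚ 0ℚ} λ _ → refl)))
    (⩽-reflexive (≈-ptwise λ _ →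
      solve 1 (λ w → con 1ℚ :* (con 1ℚ :- w) := con 1ℚ :+ con 0ℚ :* w :- w) refl w))
  upper (suc k) 0<p = ⩽-trans
    (⩽-reflexive (≈-trans (*-congʳ (fromℚ (1ℚ ℚ.- w)) (expPart-suc k))
      (≈-ptwise λ n → solve 3 (λ a b c → a :* b :* c := a :* c :* b) refl
        (seq (expPart k) n) (seq (exp (fromℚ (term k))) n) (1ℚ ℚ.- w))))
    (⩽-trans (*-monoʳ-⩽ (0≺exp (fromℚ (term k))) (upper k (λ j j<k → 0<p j (ℕ.m<n⇒m<1+n j<k))))
      (⩽-trans
        (⩽-reflexive (≈-ptwise λ n → trans
          (cong (λ z → (point k ℚ.- z) ℚ.* seq (exp (fromℚ (term k))) n)
            (sym (point*term k (0<p k ℕ.≤-refl))))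
          (solve 3 (λ p h e → (p :- p :* h) :* e := p :* ((con 1ℚ :- h) :* e)) refl
            (point k) (term k) (seq (exp (fromℚ (term k))) n))))
        (⩽-trans (*-monoˡ-⩽ {z = fromℚ (point k)} (≺⁺ (0<fromℚ (0<p k ℕ.≤-refl))) (exp*1-x⩽1 (fromℚ (term k))))
          (⩽-reflexive (≈-ptwise λ _ → trans (ℚ.*-identityʳ (point k))
            (trans (solve 2 (λ p w → p := p :+ w :- w) refl (point k) w)
              (cong (ℚ._- w) (sym (point-suc k)))))))))

module _ {t : ℚ} (0<t : 0ℚ ℚ.< t) (n : ℕ) where

  private
    δ w : ℚ
    δ = t ℚ.⊓ 1ℚ
    w = (t ℚ.- 1ℚ) ℚ.* ½^ n

    0<δ : 0ℚ ℚ.< δ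
    0<δ with ℚ.⊓-sel t 1ℚ
    ... | inj₁ e = subst (0ℚ ℚ.<_) (sym e) 0<t
    ... | inj₂ e = subst (0ℚ ℚ.<_) (sym e) 0<1

    open Telescope w

    0<point : ∀ k → k ℕ.< 2 ℕ.^ n → 0ℚ ℚ.< point k
    0<point k k<2^n = ℚ.<-≤-trans 0<δ
      (LnBounds.δ≤point 0<δ (ℚ.p⊓q≤q t 1ℚ) (ℚ.≤-refl {1ℚ}) n (ℚ.p⊓q≤p t 1ℚ) (ℕ.<⇒≤ k<2^n))

    last-point : point (2 ℕ.^ n) ≡ t
    last-point = trans
      (solve 3 (λ a t h → con 1ℚ :+ a :* ((t :- con 1ℚ) :* h)
                       := con 1ℚ :+ (t :- con 1ℚ) :* (a :* h)) refl (fromℕ (2 ℕ.^ n)) t (½^ n))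
      (trans (cong (λ z → 1ℚ ℚ.+ (t ℚ.- 1ℚ) ℚ.* z) (2^n*½^n≡1 n))
        (solve 1 (λ t → con 1ℚ :+ (t :- con 1ℚ) :* con 1ℚ := t) refl t))

  exp-lnSum-lower : fromℚ t ⩽ exp (fromℚ (lnSum n t))
  exp-lnSum-lower = subst (λ z → fromℚ z ⩽ exp (fromℚ (lnSum n t))) last-point
    (lower (2 ℕ.^ n) 0<point)

  exp-lnSum-upper : exp (fromℚ (lnSum n t)) * fromℚ (1ℚ ℚ.- w) ⩽ fromℚ (t ℚ.- w)
  exp-lnSum-upper =
    subst (λ z → exp (fromℚ (lnSum n t)) * fromℚ (1ℚ ℚ.- w) ⩽ fromℚ (z ℚ.- w)) last-point
      (upper (2 ℕ.^ n) 0<point)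

*≤∣∣* : ∀ p q {a b} → 0ℚ ℚ.≤ a → ℚ.∣ p ∣ ℚ.≤ a → ℚ.∣ q ∣ ℚ.≤ b → p ℚ.* q ℚ.≤ a ℚ.* b
*≤∣∣* p q 0≤a p≤a q≤b = ℚ.≤-trans (p≤∣p∣ (p ℚ.* q))
  (ℚ.≤-trans (ℚ.≤-reflexive (ℚ.∣p*q∣≡∣p∣*∣q∣ p q)) (*-mono 0≤a (ℚ.0≤∣p∣ q) p≤a q≤b))

module _ (x : ℝ) (0<x : 0ℝ < x) where

  private
    y : ℝ
    y = ln x 0<x

  -- At a fixed n the telescoping bounds concern exp of the rational `seq y n`, a limit of
  -- `expSum m (seq y n)` in m, whereas exp y takes the diagonal m = n. Uniform convergence on a
  -- bounded interval exchanges the two, and the width w of the partition tends to 0.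
  exp-ln : exp y ≈ x
  exp-ln = from (0<⇒eventually x 0<x) (bounded (x - 1ℝ)) (bounded y) (bounded (exp y - 1ℝ))
    where
    from : ∃[ δ ] 0ℚ ℚ.< δ × Eventually (λ n → δ ℚ.≤ seq x n) →
           ∃[ M ] 0ℚ ℚ.≤ M × Eventually (λ n → ℚ.∣ seq x n ℚ.- 1ℚ ∣ ℚ.≤ M) →
           ∃[ K ] 0ℚ ℚ.≤ K × Eventually (λ n → ℚ.∣ seq y n ∣ ℚ.≤ K) →
           ∃[ B ] 0ℚ ℚ.≤ B × Eventually (λ n → ℚ.∣ seq (exp y) n ℚ.- 1ℚ ∣ ℚ.≤ B) →
           exp y ≈ x
    from (δ , 0<δ , evδ) (M , 0≤M , evM) (K , 0≤K , evK) (B , 0≤B , evB) =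
      ⩽-antisym
        (⩽⁺ λ ε 0<ε → upper ε 0<ε
          (shrink {1ℚ ℚ.+ M} (0≤+ 0≤1 0≤M) (0<half (0<half 0<ε)))
          (½^-small (M ℚ.* B) (½ ℚ.* (½ ℚ.* ε)) (0≤* 0≤M 0≤B) (0<half (0<half 0<ε))))
        (⩽⁺ λ ε 0<ε → lower ε 0<ε (expSum-uniform 0≤K (0<half 0<ε)))
      where
      lower : ∀ ε → 0ℚ ℚ.< ε →
              ∃[ N ] (∀ {m n} → N ℕ.≤ m → N ℕ.≤ n → ∀ {t} → ℚ.∣ t ∣ ℚ.≤ K →
                      ℚ.∣ expSum n t ℚ.- expSum m t ∣ ℚ.≤ ½ ℚ.* ε) →
              Eventually (λ n → seq x n ℚ.≤ seq (exp y) n ℚ.+ ε)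
      lower ε 0<ε (N , uniform) = ev-zip (λ n (δ≤x , y≤K) N≤n → bound n δ≤x y≤K N≤n
          (⩽⁻ (exp-lnSum-lower (ℚ.<-≤-trans 0<δ δ≤x) n) (½ ℚ.* ε) (0<half 0<ε)))
        (ev-zip (λ _ → _,_) evδ evK) (N , λ _ le → le)
        where
        bound : ∀ n → δ ℚ.≤ seq x n → ℚ.∣ seq y n ∣ ℚ.≤ K → N ℕ.≤ n →
                Eventually (λ m → seq x n ℚ.≤ expSum m (seq y n) ℚ.+ ½ ℚ.* ε) →
                seq x n ℚ.≤ seq (exp y) n ℚ.+ ε
        bound n δ≤x y≤K N≤n (N′ , le) = lin
          (ℚ.+-mono-≤ (le (N ℕ.+ N′) (ℕ.m≤n+m N′ N))
            (ℚ.≤-trans (p≤∣p∣ _) (uniform N≤n (ℕ.m≤m+n N N′) y≤K)))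
          (solve 4 (λ x a b e → (b :+ e) :- x
              := (a :+ con ½ :* e :+ con ½ :* e) :- (x :+ (a :- b))) refl
            (seq x n) (expSum (N ℕ.+ N′) (seq y n)) (expSum n (seq y n)) ε)

      upper : ∀ ε → 0ℚ ℚ.< ε →
              ∃[ η ] 0ℚ ℚ.< η × (1ℚ ℚ.+ M) ℚ.* η ℚ.≤ ½ ℚ.* (½ ℚ.* ε) →
              ∃[ n₀ ] M ℚ.* B ℚ.* ½^ n₀ ℚ.≤ ½ ℚ.* (½ ℚ.* ε) →
              Eventually (λ n → seq (exp y) n ℚ.≤ seq x n ℚ.+ ε)
      upper ε 0<ε (η , 0<η , Mη≤) (n₀ , small) =
        ev-zip (λ n (δ≤x , x≤M) (y≤K , e≤B , N≤n , n₀≤n) → bound n δ≤x x≤M y≤K e≤B N≤n n₀≤n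
            (⩽⁻ (exp-lnSum-upper (ℚ.<-≤-trans 0<δ δ≤x) n) (½ ℚ.* ε) (0<half 0<ε)))
          (ev-zip (λ _ → _,_) evδ evM)
          (ev-zip (λ _ → _,_) evK (ev-zip (λ _ → _,_) evB
            (ev-zip {N ℕ.≤_} {n₀ ℕ.≤_} (λ _ → _,_) (N , λ _ le → le) (n₀ , λ _ le → le))))
        where
        N : ℕ
        N = proj₁ (expSum-uniform 0≤K 0<η)

        bound : ∀ n → δ ℚ.≤ seq x n → ℚ.∣ seq x n ℚ.- 1ℚ ∣ ℚ.≤ M → ℚ.∣ seq y n ∣ ℚ.≤ K →
                ℚ.∣ seq (exp y) n ℚ.- 1ℚ ∣ ℚ.≤ B → N ℕ.≤ n → n₀ ℕ.≤ n →
                Eventually (λ m → expSum m (seq y n) ℚ.* (1ℚ ℚ.- (seq x n ℚ.- 1ℚ) ℚ.* ½^ n)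
                  ℚ.≤ seq x n ℚ.- (seq x n ℚ.- 1ℚ) ℚ.* ½^ n ℚ.+ ½ ℚ.* ε) →
                seq (exp y) n ℚ.≤ seq x n ℚ.+ ε
        -- Split Eₙ as (1 - w) Eₘ + (1 - w) (Eₙ - Eₘ) + w Eₙ. The first summand is at most x - w + ε
        -- / 2, the second at most ε / 4; the - w joins the third to give w (Eₙ - 1), again at most
        -- ε / 4.
        bound n δ≤x x≤M y≤K e≤B N≤n n₀≤n (N′ , le) = lin
          (ℚ.+-mono-≤ (le m (ℕ.m≤n+m N′ N)) (ℚ.+-mono-≤
            (ℚ.≤-trans (*≤∣∣* (1ℚ ℚ.- w) (Eₙ ℚ.- Eₘ) (0≤+ 0≤1 0≤M) ∣1-w∣≤
              (proj₂ (expSum-uniform 0≤K 0<η) (ℕ.m≤m+n N N′) N≤n y≤K)) Mη≤)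
            (ℚ.≤-trans (*≤∣∣* w (Eₙ ℚ.- 1ℚ) (0≤* 0≤M (0≤½^ n)) ∣w∣≤ e≤B)
              (ℚ.≤-trans (ℚ.≤-trans
                (ℚ.≤-reflexive (solve 3 (λ m h b → m :* h :* b := m :* b :* h) refl M (½^ n) B))
                (*-monoˡ (0≤* 0≤M 0≤B)
                  (subst (λ k → ½^ k ℚ.≤ ½^ n₀) (ℕ.m∸n+n≡m n₀≤n) (½^-+≤ (n ℕ.∸ n₀) n₀))))
                small))))
          (solve 5 (λ a b w x e → (x :+ e) :- b
              := ((x :- w :+ con ½ :* e) :+ (con ½ :* (con ½ :* e) :+ con ½ :* (con ½ :* e)))
                 :- (a :* (con 1ℚ :- w) :+ ((con 1ℚ :- w) :* (b :- a) :+ w :* (b :- con 1ℚ)))) refl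
              Eₘ Eₙ w (seq x n) ε)
          where
          m : ℕ
          m = N ℕ.+ N′
          Eₙ Eₘ w : ℚ
          Eₙ = expSum n (seq y n)
          Eₘ = expSum m (seq y n)
          w = (seq x n ℚ.- 1ℚ) ℚ.* ½^ n
          ∣w∣≤ : ℚ.∣ w ∣ ℚ.≤ M ℚ.* ½^ n
          ∣w∣≤ = subst (ℚ._≤ M ℚ.* ½^ n)
            (sym (trans (ℚ.∣p*q∣≡∣p∣*∣q∣ (seq x n ℚ.- 1ℚ) (½^ n))
              (cong (ℚ.∣ seq x n ℚ.- 1ℚ ∣ ℚ.*_) (ℚ.0≤p⇒∣p∣≡p (0≤½^ n)))))
            (*-monoʳ (0≤½^ n) x≤M)
          ∣1-w∣≤ : ℚ.∣ 1ℚ ℚ.- w ∣ ℚ.≤ 1ℚ ℚ.+ M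
          ∣1-w∣≤ = ℚ.≤-trans (ℚ.∣p+q∣≤∣p∣+∣q∣ 1ℚ (ℚ.- w))
            (ℚ.+-monoʳ-≤ 1ℚ (subst (ℚ._≤ M) (sym (ℚ.∣-p∣≡∣p∣ w))
              (ℚ.≤-trans ∣w∣≤ (subst (M ℚ.* ½^ n ℚ.≤_) (ℚ.*-identityʳ M)
                (*-monoˡ 0≤M (½^≤1 n))))))

-- Continued fractions

ι : ℤ → ℚ
ι i = i ℚ./ 1

ι-+ : ∀ i j → ι (i ℤ.+ j) ≡ ι i ℚ.+ ι j
ι-+ i j = ℚ.toℚᵘ-injective (ℚᵘ.≃-trans (ℚ.toℚᵘ-fromℚᵘ (mkℚᵘ (i ℤ.+ j) 0))
  (ℚᵘ.≃-sym (ℚᵘ.≃-trans (ℚ.toℚᵘ-homo-+ (ι i) (ι j))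
    (ℚᵘ.≃-trans (ℚᵘ.+-cong (ℚ.toℚᵘ-fromℚᵘ (mkℚᵘ i 0)) (ℚ.toℚᵘ-fromℚᵘ (mkℚᵘ j 0)))
      (*≡* (cong₂ (λ a b → (a ℤ.+ b) ℤ.* ℤ.+ 1) (ℤ.*-identityʳ i) (ℤ.*-identityʳ j)))))))

/-*-cancel : ∀ i n .{{_ : ℕ.NonZero n}} → (i ℚ./ n) ℚ.* fromℕ n ≡ ι i
/-*-cancel i n@(suc m) = ℚ.toℚᵘ-injective (ℚᵘ.≃-trans (ℚ.toℚᵘ-homo-* (i ℚ./ n) (fromℕ n))
  (ℚᵘ.≃-trans (ℚᵘ.*-cong (ℚ.toℚᵘ-fromℚᵘ (mkℚᵘ i m)) (ℚ.toℚᵘ-fromℚᵘ (mkℚᵘ (ℤ.+ n) 0)))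
    (ℚᵘ.≃-trans (*≡* (trans (ℤ.*-identityʳ (i ℤ.* ℤ.+ n))
        (cong (λ k → i ℤ.* ℤ.+ suc k) (sym (ℕ.*-identityʳ m)))))
      (ℚᵘ.≃-sym (ℚ.toℚᵘ-fromℚᵘ (mkℚᵘ i 0))))))

ι-* : ∀ i j → ι (i ℤ.* j) ≡ ι i ℚ.* ι j
ι-* i j = ℚ.toℚᵘ-injective (ℚᵘ.≃-trans (ℚ.toℚᵘ-fromℚᵘ (mkℚᵘ (i ℤ.* j) 0))
  (ℚᵘ.≃-sym (ℚᵘ.≃-trans (ℚ.toℚᵘ-homo-* (ι i) (ι j))
    (ℚᵘ.*-cong (ℚ.toℚᵘ-fromℚᵘ (mkℚᵘ i 0)) (ℚ.toℚᵘ-fromℚᵘ (mkℚᵘ j 0))))))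

ι-neg : ∀ i → ι (ℤ.- i) ≡ ℚ.- ι i
ι-neg i = trans (solve 2 (λ a b → b := (a :+ b) :- a) refl (ι i) (ι (ℤ.- i)))
  (trans (cong (ℚ._- ι i) (trans (sym (ι-+ i (ℤ.- i))) (cong ι (ℤ.+-inverseʳ i))))
    (ℚ.+-identityˡ (ℚ.- ι i)))

ι-- : ∀ i j → ι (i ℤ.- j) ≡ ι i ℚ.- ι j
ι-- i j = trans (ι-+ i (ℤ.- j)) (cong (ι i ℚ.+_) (ι-neg j))

∣ι∣ : ∀ i → ℚ.∣ ι i ∣ ≡ fromℕ ℤ.∣ i ∣
∣ι∣ (ℤ.+ n)      = ℚ.0≤p⇒∣p∣≡p (0≤fromℕ n)
∣ι∣ (ℤ.-[1+ n ]) = trans (cong ℚ.∣_∣ (ι-neg (ℤ.+ suc n)))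
  (trans (ℚ.∣-p∣≡∣p∣ (fromℕ (suc n))) (ℚ.0≤p⇒∣p∣≡p (0≤fromℕ (suc n))))

fromℕ-* : ∀ m n → fromℕ (m ℕ.* n) ≡ fromℕ m ℚ.* fromℕ n
fromℕ-* m n = trans (cong ι (ℤ.pos-* m n)) (ι-* (ℤ.+ m) (ℤ.+ n))

-- If e₀ and e₁ had opposite signs then ∣ e₀ Q₁ - e₁ Q₀ ∣ would be at least Q₁.
same-sign-bound⁺ : ∀ e₀ j {Q₀ Q₁} u v →
  ℤ.∣ e₀ ℤ.* ℤ.+ Q₁ ℤ.- ℤ.+ suc j ℤ.* ℤ.+ Q₀ ∣ ℕ.< Q₁ →
  v ℕ.≤ ℤ.∣ ℤ.+ u ℤ.* e₀ ℤ.+ ℤ.+ v ℤ.* ℤ.+ suc j ∣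
same-sign-bound⁺ (ℤ.+ i) j u v _ = subst (v ℕ.≤_)
  (cong ℤ.∣_∣ (cong₂ ℤ._+_ (ℤ.pos-* u i) (ℤ.pos-* v (suc j))))
  (ℕ.≤-trans (ℕ.m≤m*n v (suc j)) (ℕ.m≤n+m (v ℕ.* suc j) (u ℕ.* i)))
same-sign-bound⁺ (ℤ.-[1+ i ]) j {Q₀} {Q₁} u v small = contradiction small
  (ℕ.≤⇒≯ (subst (Q₁ ℕ.≤_) (sym abs)
    (ℕ.≤-trans (ℕ.m≤m+n Q₁ (i ℕ.* Q₁)) (ℕ.m≤m+n (suc i ℕ.* Q₁) (suc j ℕ.* Q₀)))))
  where
  abs : ℤ.∣ ℤ.-[1+ i ] ℤ.* ℤ.+ Q₁ ℤ.- ℤ.+ suc j ℤ.* ℤ.+ Q₀ ∣ ≡ suc i ℕ.* Q₁ ℕ.+ suc j ℕ.* Q₀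
  abs = trans
    (cong ℤ.∣_∣ (trans
      (solveℤ 4 (λ a b c d → (⊟ a) ⊠ b ⊟ c ⊠ d ⊜ ⊟ (a ⊠ b ⊞ c ⊠ d)) refl
        (ℤ.+ suc i) (ℤ.+ Q₁) (ℤ.+ suc j) (ℤ.+ Q₀))
      (cong ℤ.-_ (sym (cong₂ ℤ._+_ (ℤ.pos-* (suc i) Q₁) (ℤ.pos-* (suc j) Q₀))))))
    (ℤ.∣-i∣≡∣i∣ (ℤ.+ (suc i ℕ.* Q₁ ℕ.+ suc j ℕ.* Q₀)))

-- If e₁ = 0, the determinant is a positive multiple of Q₁ and cannot be below Q₁. A negative e₁ is
-- reduced to a positive one by negating both integers.
same-sign-bound : ∀ e₀ e₁ {Q₀ Q₁} u v →
  0 ℕ.< ℤ.∣ e₀ ℤ.* ℤ.+ Q₁ ℤ.- e₁ ℤ.* ℤ.+ Q₀ ∣ →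
  ℤ.∣ e₀ ℤ.* ℤ.+ Q₁ ℤ.- e₁ ℤ.* ℤ.+ Q₀ ∣ ℕ.< Q₁ →
  v ℕ.≤ ℤ.∣ ℤ.+ u ℤ.* e₀ ℤ.+ ℤ.+ v ℤ.* e₁ ∣
same-sign-bound e₀ (ℤ.+ zero) {Q₀} {Q₁} u v 0<k k<Q₁ = contradiction (subst (ℕ._< Q₁) k≡ k<Q₁)
  (ℕ.≤⇒≯ (ℕ.m≤n*m Q₁ ℤ.∣ e₀ ∣ {{ℕ.≢-nonZero ∣e₀∣≢0}}))
  where
  k≡ : ℤ.∣ e₀ ℤ.* ℤ.+ Q₁ ℤ.- ℤ.+ 0 ℤ.* ℤ.+ Q₀ ∣ ≡ ℤ.∣ e₀ ∣ ℕ.* Q₁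
  k≡ = trans (cong ℤ.∣_∣ (ℤ.+-identityʳ (e₀ ℤ.* ℤ.+ Q₁))) (ℤ.abs-* e₀ (ℤ.+ Q₁))
  ∣e₀∣≢0 : ℤ.∣ e₀ ∣ ≢ 0
  ∣e₀∣≢0 ∣e₀∣≡0 = ℕ.<⇒≢ 0<k (sym (trans k≡ (cong (ℕ._* Q₁) ∣e₀∣≡0)))
same-sign-bound e₀ (ℤ.+ suc j) u v _ = same-sign-bound⁺ e₀ j u v
same-sign-bound e₀ (ℤ.-[1+ j ]) {Q₀} {Q₁} u v _ k<Q₁ = subst (v ℕ.≤_)
  (trans
    (cong ℤ.∣_∣ (solveℤ 4 (λ u e v f → u ⊠ (⊟ e) ⊞ v ⊠ f ⊜ ⊟ (u ⊠ e ⊞ v ⊠ (⊟ f))) refl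
      (ℤ.+ u) e₀ (ℤ.+ v) (ℤ.+ suc j)))
    (ℤ.∣-i∣≡∣i∣ (ℤ.+ u ℤ.* e₀ ℤ.+ ℤ.+ v ℤ.* ℤ.-[1+ j ])))
  (same-sign-bound⁺ (ℤ.- e₀) j u v (subst (ℕ._< Q₁)
    (trans (sym (ℤ.∣-i∣≡∣i∣ (e₀ ℤ.* ℤ.+ Q₁ ℤ.- ℤ.-[1+ j ] ℤ.* ℤ.+ Q₀)))
      (cong ℤ.∣_∣ (solveℤ 4 (λ e p f q → ⊟ (e ⊠ p ⊟ (⊟ f) ⊠ q) ⊜ (⊟ e) ⊠ p ⊟ f ⊠ q) refl
        e₀ (ℤ.+ Q₁) (ℤ.+ suc j) (ℤ.+ Q₀))))
    k<Q₁))

-- Euler's continuants, peeled from the front to match `fractionalPart`. The usual recurrence acts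
-- at the far end and has to be proved, jointly for both, as `num` is a shifted `den`.
num den : (ℕ → ℕ) → ℕ → ℕ
num b zero    = 0
num b (suc n) = den (λ k → b (suc k)) n
den b zero    = 1
den b (suc n) = b 0 ℕ.* den (λ k → b (suc k)) n ℕ.+ num (λ k → b (suc k)) n

den-rec : ∀ b n → den b (suc (suc n)) ≡ b (suc n) ℕ.* den b (suc n) ℕ.+ den b n
num-rec : ∀ b n → num b (suc (suc n)) ≡ b (suc n) ℕ.* num b (suc n) ℕ.+ num b n

den-rec b zero    = solveℕ 2
  (λ x y → x ∙ (y ∙ conℕ 1 ⊹ conℕ 0) ⊹ conℕ 1 ≐ y ∙ (x ∙ conℕ 1 ⊹ conℕ 0) ⊹ conℕ 1) refl
  (b 0) (b 1)
den-rec b (suc n) = trans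
  (cong₂ (λ x y → b 0 ℕ.* x ℕ.+ y) (den-rec (λ k → b (suc k)) n) (num-rec (λ k → b (suc k)) n))
  (solveℕ 6 (λ a c d₁ d₀ n₁ n₀ → a ∙ (c ∙ d₁ ⊹ d₀) ⊹ (c ∙ n₁ ⊹ n₀)
      ≐ c ∙ (a ∙ d₁ ⊹ n₁) ⊹ (a ∙ d₀ ⊹ n₀)) refl
    (b 0) (b (suc (suc n))) (den b′ (suc n)) (den b′ n) (num b′ (suc n)) (num b′ n))
  where
  b′ : ℕ → ℕ
  b′ k = b (suc k)

num-rec b zero    = refl
num-rec b (suc n) = den-rec (λ k → b (suc k)) n

-- Prepending a partial quotient is a substitution of determinant -1, which only flips the sign; the
-- absolute value spares the bookkeeping of (-1)ⁿ.
det : ∀ b n → ℤ.∣ ℤ.+ num b n ℤ.* ℤ.+ den b (suc n) ℤ.- ℤ.+ num b (suc n) ℤ.* ℤ.+ den b n ∣ ≡ 1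
det b zero    = refl
det b (suc n) = trans
  (cong ℤ.∣_∣ (trans
    (cong₂ (λ x y → ℤ.+ d₀ ℤ.* x ℤ.- ℤ.+ d₁ ℤ.* y) (expand d₁ n₁) (expand d₀ n₀))
    (solveℤ 5 (λ a d₀ d₁ n₀ n₁ → d₀ ⊠ (a ⊠ d₁ ⊞ n₁) ⊟ d₁ ⊠ (a ⊠ d₀ ⊞ n₀)
        ⊜ ⊟ (n₀ ⊠ d₁ ⊟ n₁ ⊠ d₀)) refl
      (ℤ.+ b 0) (ℤ.+ d₀) (ℤ.+ d₁) (ℤ.+ n₀) (ℤ.+ n₁))))
  (trans (ℤ.∣-i∣≡∣i∣ (ℤ.+ n₀ ℤ.* ℤ.+ d₁ ℤ.- ℤ.+ n₁ ℤ.* ℤ.+ d₀)) (det (λ k → b (suc k)) n))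
  where
  n₀ n₁ d₀ d₁ : ℕ
  n₀ = num (λ k → b (suc k)) n
  n₁ = num (λ k → b (suc k)) (suc n)
  d₀ = den (λ k → b (suc k)) n
  d₁ = den (λ k → b (suc k)) (suc n)
  expand : ∀ x y → ℤ.+ (b 0 ℕ.* x ℕ.+ y) ≡ ℤ.+ b 0 ℤ.* ℤ.+ x ℤ.+ ℤ.+ y
  expand x y = cong (ℤ._+ ℤ.+ y) (ℤ.pos-* (b 0) x)

0<den : ∀ b → (∀ n → 0 ℕ.< b n) → ∀ n → 0 ℕ.< den b n
0<den b 0<b zero    = ℕ.s≤s ℕ.z≤n
0<den b 0<b (suc n) = ℕ.≤-trans
  (ℕ.*-mono-≤ (0<b 0) (0<den (λ k → b (suc k)) (λ k → 0<b (suc k)) n)) (ℕ.m≤m+n _ _)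

fractionalPart-*-den : ∀ b → (∀ n → 0 ℕ.< b n) → ∀ n →
                       fractionalPart b n ℚ.* fromℕ (den b n) ≡ fromℕ (num b n)
fractionalPart-*-den b 0<b zero    = refl
fractionalPart-*-den b 0<b (suc n) = trans (cong (inv z ℚ.*_) (sym z*d≡))
  (trans (solve 3 (λ i z d → i :* (z :* d) := z :* i :* d) refl (inv z) z (fromℕ d))
    (trans (cong (ℚ._* fromℕ d) (inv-inverse z≢0)) (ℚ.*-identityˡ (fromℕ d))))
  where
  b′ : ℕ → ℕ
  b′ k = b (suc k)
  d : ℕ
  d = den b′ n
  z : ℚ
  z = fromℕ (b 0) ℚ.+ fractionalPart b′ n
  z*d≡ : z ℚ.* fromℕ d ≡ fromℕ (den b (suc n))
  z*d≡ = trans (ℚ.*-distribʳ-+ (fromℕ d) (fromℕ (b 0)) (fractionalPart b′ n))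
    (trans (cong₂ ℚ._+_ (sym (fromℕ-* (b 0) d)) (fractionalPart-*-den b′ (λ k → 0<b (suc k)) n))
      (sym (fromℕ-+ (b 0 ℕ.* d) (num b′ n))))
  0<D : 0ℚ ℚ.< fromℕ (den b (suc n))
  0<D = ℚ.<-≤-trans (0<fromℕ 0) (fromℕ-mono (0<den b 0<b (suc n)))
  -- `inv` sends 0 to 0, so z ≠ 0 must be established first; it follows because z d is a positive
  -- integer.
  z≢0 : z ≢ 0ℚ
  z≢0 z≡0 = >⇒≢ 0<D (trans (sym z*d≡) (trans (cong (ℚ._* fromℕ d) z≡0) (ℚ.*-zeroˡ (fromℕ d))))

module Linear (b : ℕ → ℕ) (n : ℕ) where

  -- The solution of the recurrence of the continuants with values x at n and
  -- y at suc n, indexed by the distance from n.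
  solution : ℕ → ℕ → ℕ → ℕ
  solution x y zero          = x
  solution x y (suc zero)    = y
  solution x y (suc (suc d)) = b (suc (d ℕ.+ n)) ℕ.* solution x y (suc d) ℕ.+ solution x y d

  u v : ℕ → ℕ
  u = solution 1 0
  v = solution 0 1

  combination : (X : ℕ → ℤ) →
    (∀ k → X (suc (suc k)) ≡ ℤ.+ b (suc k) ℤ.* X (suc k) ℤ.+ X k) →
    ∀ d → X (d ℕ.+ n) ≡ ℤ.+ u d ℤ.* X n ℤ.+ ℤ.+ v d ℤ.* X (suc n)
        × X (suc d ℕ.+ n) ≡ ℤ.+ u (suc d) ℤ.* X n ℤ.+ ℤ.+ v (suc d) ℤ.* X (suc n)
  combination X X-rec zero    =
    solveℤ 2 (λ x y → x ⊜ conℤ (ℤ.+ 1) ⊠ x ⊞ conℤ (ℤ.+ 0) ⊠ y) refl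
      (X n) (X (suc n)) ,
    solveℤ 2 (λ x y → y ⊜ conℤ (ℤ.+ 0) ⊠ x ⊞ conℤ (ℤ.+ 1) ⊠ y) refl
      (X n) (X (suc n))
  combination X X-rec (suc d) with combination X X-rec d
  ... | e₀ , e₁ = e₁ , trans (X-rec (d ℕ.+ n))
    (trans (cong₂ (λ x y → ℤ.+ β ℤ.* x ℤ.+ y) e₁ e₀)
      (trans
        (solveℤ 7 (λ b u₀ u₁ v₀ v₁ x y → b ⊠ (u₁ ⊠ x ⊞ v₁ ⊠ y) ⊞ (u₀ ⊠ x ⊞ v₀ ⊠ y)
            ⊜ (b ⊠ u₁ ⊞ u₀) ⊠ x ⊞ (b ⊠ v₁ ⊞ v₀) ⊠ y) refl
          (ℤ.+ β) (ℤ.+ u d) (ℤ.+ u (suc d)) (ℤ.+ v d) (ℤ.+ v (suc d)) (X n) (X (suc n)))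
        (cong₂ (λ p q → (p ℤ.+ ℤ.+ u d) ℤ.* X n ℤ.+ (q ℤ.+ ℤ.+ v d) ℤ.* X (suc n))
          (sym (ℤ.pos-* β (u (suc d)))) (sym (ℤ.pos-* β (v (suc d)))))))
    where
    β : ℕ
    β = b (suc (d ℕ.+ n))

  module _ (0<b : ∀ k → 0 ℕ.< b k) where

    -- The indices start at 1 because at 0 the values are 1 and 0. Two consecutive inequalities are
    -- carried along since the recurrence has order two.
    u≤v : ∀ d → u (suc d) ℕ.≤ v (suc d) × u (suc (suc d)) ℕ.≤ v (suc (suc d))
    u≤v zero    = ℕ.z≤n , subst₂ ℕ._≤_ (cong (ℕ._+ 1) (sym (ℕ.*-zeroʳ (b (suc n)))))
      (sym (trans (ℕ.+-identityʳ (b (suc n) ℕ.* 1)) (ℕ.*-identityʳ (b (suc n))))) (0<b (suc n))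
    u≤v (suc d) with u≤v d
    ... | p , q = q , ℕ.+-mono-≤ (ℕ.*-monoʳ-≤ (b (suc (suc d ℕ.+ n))) q) p

    0<v : ∀ d → 0 ℕ.< v (suc d)
    0<v zero    = ℕ.s≤s ℕ.z≤n
    0<v (suc d) = ℕ.≤-trans (ℕ.*-mono-≤ (0<b (suc (d ℕ.+ n))) (0<v d)) (ℕ.m≤m+n _ _)

*-cancelʳ-≡ : ∀ {p q r} → 0ℚ ℚ.< r → p ℚ.* r ≡ q ℚ.* r → p ≡ q
*-cancelʳ-≡ {r = r} 0<r e = ℚ.≤-antisym
  (ℚ.*-cancelʳ-≤-pos r {{ℚ.positive 0<r}} (ℚ.≤-reflexive e))
  (ℚ.*-cancelʳ-≤-pos r {{ℚ.positive 0<r}} (ℚ.≤-reflexive (sym e)))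

0<fromℕ′ : ∀ {n} → 0 ℕ.< n → 0ℚ ℚ.< fromℕ n
0<fromℕ′ {suc n} _ = 0<fromℕ n

↧ₙ-coprime : ∀ i n .{{_ : ℕ.NonZero n}} → .(Coprime ℤ.∣ i ∣ n) → ℚ.↧ₙ (i ℚ./ n) ≡ n
↧ₙ-coprime i (suc n) c = cong ℚ.↧ₙ_ (ℚ.↥p/↧p≡p (mkℚ i n c))

-- Convergents and their distance to other fractions and to α

module Convergents (c : ContinuedFraction) where

  open ContinuedFraction c

  0<b : ∀ n → 0 ℕ.< b⁺ n
  0<b n = ℕ.>-nonZero⁻¹ (b⁺ n)

  C : ℕ → ℚ
  C = convergent c

  Q : ℕ → ℕ
  Q = q c

  private
    D N : ℕ → ℕ
    D = den b⁺
    N = num b⁺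

    0<D : ∀ n → 0 ℕ.< D n
    0<D = 0<den b⁺ 0<b

  P : ℕ → ℤ
  P n = b₀ ℤ.* ℤ.+ den b⁺ n ℤ.+ ℤ.+ num b⁺ n

  private
    C*D : ∀ n → C n ℚ.* fromℕ (D n) ≡ ι (P n)
    C*D n = trans (ℚ.*-distribʳ-+ (fromℕ (D n)) (ι b₀) (fractionalPart b⁺ n))
      (trans (cong₂ ℚ._+_ (sym (ι-* b₀ (ℤ.+ D n))) (fractionalPart-*-den b⁺ 0<b n))
        (sym (ι-+ (b₀ ℤ.* ℤ.+ D n) (ℤ.+ N n))))

    det-D : ∀ n → ℤ.∣ P n ℤ.* ℤ.+ D (suc n) ℤ.- P (suc n) ℤ.* ℤ.+ D n ∣ ≡ 1
    det-D n = trans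
      (cong ℤ.∣_∣ (solveℤ 5 (λ b d₀ d₁ n₀ n₁ → (b ⊠ d₀ ⊞ n₀) ⊠ d₁ ⊟ (b ⊠ d₁ ⊞ n₁) ⊠ d₀
          ⊜ n₀ ⊠ d₁ ⊟ n₁ ⊠ d₀) refl
        b₀ (ℤ.+ D n) (ℤ.+ D (suc n)) (ℤ.+ N n) (ℤ.+ N (suc n))))
      (det b⁺ n)

    coprime : ∀ n → Coprime ℤ.∣ P n ∣ (D n)
    coprime n {d} (d∣P , d∣D) = ℕ.∣1⇒≡1 (subst (d ℕ.∣_) (det-D n) (ℤ.∣⇒∣ᵤ {ℤ.+ d}
      (ℤ.∣m∣n⇒∣m-n
        (ℤ.∣m⇒∣m*n {ℤ.+ d} {P n} (ℤ.+ D (suc n)) (ℤ.∣ᵤ⇒∣ d∣P))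
        (ℤ.∣n⇒∣m*n {ℤ.+ d} (P (suc n)) {ℤ.+ D n} (ℤ.∣ᵤ⇒∣ d∣D)))))

    -- `q` is the denominator of a reduced rational. The determinant ±1 makes P n and D n coprime,
    -- so the fraction P n / D n is already reduced and the recurrence of the continuants passes to
    -- `q`.
    Q≡D : ∀ n → Q n ≡ D n
    Q≡D n = trans (cong ℚ.↧ₙ_ C≡) (↧ₙ-coprime (P n) (D n) (coprime n))
      where
      instance
        D≢0 : ℕ.NonZero (D n)
        D≢0 = ℕ.>-nonZero (0<D n)
      C≡ : C n ≡ P n ℚ./ D n
      C≡ = *-cancelʳ-≡ (0<fromℕ′ (0<D n)) (trans (C*D n) (sym (/-*-cancel (P n) (D n))))

  0<Q : ∀ n → 0 ℕ.< Q n
  0<Q n = subst (0 ℕ.<_) (sym (Q≡D n)) (0<D n)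

  C*Q : ∀ n → C n ℚ.* fromℕ (Q n) ≡ ι (P n)
  C*Q n = trans (cong (λ m → C n ℚ.* fromℕ m) (Q≡D n)) (C*D n)

  det-Q : ∀ n → ℤ.∣ P n ℤ.* ℤ.+ Q (suc n) ℤ.- P (suc n) ℤ.* ℤ.+ Q n ∣ ≡ 1
  det-Q n = trans (cong₂ (λ x y → ℤ.∣ P n ℤ.* ℤ.+ x ℤ.- P (suc n) ℤ.* ℤ.+ y ∣) (Q≡D (suc n)) (Q≡D n))
    (det-D n)

  Q-1 : Q 1 ≡ b⁺ 0
  Q-1 = trans (Q≡D 1) (trans (ℕ.+-identityʳ (b⁺ 0 ℕ.* 1)) (ℕ.*-identityʳ (b⁺ 0)))

  Q-0 : Q 0 ≡ 1
  Q-0 = Q≡D 0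

  Q-rec : ∀ n → Q (suc (suc n)) ≡ b⁺ (suc n) ℕ.* Q (suc n) ℕ.+ Q n
  Q-rec n = trans (Q≡D (suc (suc n))) (trans (den-rec b⁺ n)
    (cong₂ (λ x y → b⁺ (suc n) ℕ.* x ℕ.+ y) (sym (Q≡D (suc n))) (sym (Q≡D n))))

  Q-recℤ : ∀ n → ℤ.+ Q (suc (suc n)) ≡ ℤ.+ b⁺ (suc n) ℤ.* ℤ.+ Q (suc n) ℤ.+ ℤ.+ Q n
  Q-recℤ n = trans (cong ℤ.+_ (Q-rec n)) (cong (ℤ._+ ℤ.+ Q n) (ℤ.pos-* (b⁺ (suc n)) (Q (suc n))))

  P-rec : ∀ n → P (suc (suc n)) ≡ ℤ.+ b⁺ (suc n) ℤ.* P (suc n) ℤ.+ P n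
  P-rec n = trans
    (cong₂ (λ x y → b₀ ℤ.* x ℤ.+ y) (cast (D (suc n)) (D n) (den-rec b⁺ n))
      (cast (N (suc n)) (N n) (num-rec b⁺ n)))
    (solveℤ 6 (λ a b d₁ d₀ n₁ n₀ → a ⊠ (b ⊠ d₁ ⊞ d₀) ⊞ (b ⊠ n₁ ⊞ n₀)
        ⊜ b ⊠ (a ⊠ d₁ ⊞ n₁) ⊞ (a ⊠ d₀ ⊞ n₀)) refl
      b₀ (ℤ.+ b⁺ (suc n)) (ℤ.+ D (suc n)) (ℤ.+ D n) (ℤ.+ N (suc n)) (ℤ.+ N n))
    where
    cast : ∀ {x} y z → x ≡ b⁺ (suc n) ℕ.* y ℕ.+ z →
           ℤ.+ x ≡ ℤ.+ b⁺ (suc n) ℤ.* ℤ.+ y ℤ.+ ℤ.+ z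
    cast y z e = trans (cong ℤ.+_ e) (cong (ℤ._+ ℤ.+ z) (ℤ.pos-* (b⁺ (suc n)) y))

  b*Q≤Q : ∀ n → b⁺ n ℕ.* Q n ℕ.≤ Q (suc n)
  b*Q≤Q zero    = ℕ.≤-reflexive
    (trans (cong (b⁺ 0 ℕ.*_) Q-0) (trans (ℕ.*-identityʳ (b⁺ 0)) (sym Q-1)))
  b*Q≤Q (suc n) = subst (b⁺ (suc n) ℕ.* Q (suc n) ℕ.≤_) (sym (Q-rec n)) (ℕ.m≤m+n _ (Q n))

  Q≤b*Q : ∀ n → Q n ℕ.≤ b⁺ n ℕ.* Q n
  Q≤b*Q n = ℕ.m≤n*m (Q n) (b⁺ n)

  Q≤Q : ∀ n → Q n ℕ.≤ Q (suc n)
  Q≤Q n = ℕ.≤-trans (Q≤b*Q n) (b*Q≤Q n)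

  Q≤2*b*Q : ∀ n → Q (suc n) ℕ.≤ 2 ℕ.* (b⁺ n ℕ.* Q n)
  Q≤2*b*Q zero    = ℕ.≤-trans (ℕ.≤-reflexive (trans Q-1 (sym
    (trans (cong (b⁺ 0 ℕ.*_) Q-0) (ℕ.*-identityʳ (b⁺ 0)))))) (ℕ.m≤m+n _ _)
  Q≤2*b*Q (suc n) = subst (ℕ._≤ 2 ℕ.* (b⁺ (suc n) ℕ.* Q (suc n))) (sym (Q-rec n))
    (ℕ.+-monoʳ-≤ (b⁺ (suc n) ℕ.* Q (suc n))
      (ℕ.≤-trans (ℕ.≤-trans (Q≤Q n) (Q≤b*Q (suc n))) (ℕ.≤-reflexive (sym (ℕ.+-identityʳ _)))))

  n≤Q : ∀ n → n ℕ.≤ Q n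
  n≤Q zero          = ℕ.z≤n
  n≤Q (suc zero)    = 0<Q 1
  n≤Q (suc (suc n)) = subst₂ ℕ._≤_ (ℕ.+-comm (suc n) 1) (sym (Q-rec n))
    (ℕ.+-mono-≤ (ℕ.≤-trans (n≤Q (suc n)) (Q≤b*Q (suc n))) (0<Q n))

  module _ (n d : ℕ) where

    private
      m u v : ℕ
      m = suc d ℕ.+ n
      u = Linear.u b⁺ n (suc d)
      v = Linear.v b⁺ n (suc d)

      0<v : 0 ℕ.< v
      0<v = Linear.0<v b⁺ n 0<b d

      Pm : P m ≡ ℤ.+ u ℤ.* P n ℤ.+ ℤ.+ v ℤ.* P (suc n)
      Pm = proj₂ (Linear.combination b⁺ n P P-rec d)

      Qmℤ : ℤ.+ Q m ≡ ℤ.+ u ℤ.* ℤ.+ Q n ℤ.+ ℤ.+ v ℤ.* ℤ.+ Q (suc n)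
      Qmℤ = proj₂ (Linear.combination b⁺ n (λ k → ℤ.+ Q k) Q-recℤ d)

      Qm : Q m ≡ u ℕ.* Q n ℕ.+ v ℕ.* Q (suc n)
      Qm = ℤ.+-injective (trans Qmℤ
        (sym (cong₂ ℤ._+_ (ℤ.pos-* u (Q n)) (ℤ.pos-* v (Q (suc n))))))

      cancel : ∀ {x y : ℚ} → x ℚ.* fromℕ v ℚ.≤ y ℚ.* fromℕ v → x ℚ.≤ y
      cancel = ℚ.*-cancelʳ-≤-pos (fromℕ v) {{ℚ.positive (0<fromℕ′ 0<v)}}

      cross : ∀ x y i j k l → x ℚ.* fromℕ k ≡ ι i → y ℚ.* fromℕ l ≡ ι j →
              ℚ.∣ x ℚ.- y ∣ ℚ.* (fromℕ k ℚ.* fromℕ l)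
              ≡ fromℕ ℤ.∣ i ℤ.* ℤ.+ l ℤ.- j ℤ.* ℤ.+ k ∣
      cross x y i j k l ex ey = trans
        (trans (cong (ℚ.∣ x ℚ.- y ∣ ℚ.*_)
            (sym (ℚ.0≤p⇒∣p∣≡p (0≤* (0≤fromℕ k) (0≤fromℕ l)))))
          (sym (ℚ.∣p*q∣≡∣p∣*∣q∣ (x ℚ.- y) (fromℕ k ℚ.* fromℕ l))))
        (trans (cong ℚ.∣_∣ (trans
          (solve 4 (λ x y k l → (x :- y) :* (k :* l) := x :* k :* l :- y :* l :* k) refl
            x y (fromℕ k) (fromℕ l))
          (trans (cong₂ (λ p q → p ℚ.* fromℕ l ℚ.- q ℚ.* fromℕ k) ex ey)
            (trans (cong₂ ℚ._-_ (sym (ι-* i (ℤ.+ l))) (sym (ι-* j (ℤ.+ k))))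
              (sym (ι-- (i ℤ.* ℤ.+ l) (j ℤ.* ℤ.+ k)))))))
          (∣ι∣ (i ℤ.* ℤ.+ l ℤ.- j ℤ.* ℤ.+ k)))

    -- The cross difference of C m and p / k is at least v, while Q m is at most 2 v Q (n + 1). The
    -- factor v grows with d but cancels, so the bound is uniform in d and survives the passage to
    -- α.
    fraction-far : ∀ p k .{{_ : ℕ.NonZero k}} → k ℕ.< Q (suc n) →
      1ℚ ℚ.≤ ℚ.∣ C m ℚ.- p ℚ./ k ∣ ℚ.* fromℕ (2 ℕ.* (k ℕ.* Q (suc n)))
    fraction-far p k k<Q = cancel (ℚ.≤-trans
      (ℚ.≤-reflexive (ℚ.*-identityˡ (fromℕ v)))
      (ℚ.≤-trans (fromℕ-mono v≤)
        (ℚ.≤-trans (ℚ.≤-reflexive (sym (cross (C m) (p ℚ./ k) (P m) p (Q m) k (C*Q m)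
            (/-*-cancel p k))))
          (ℚ.≤-trans (*-monoˡ (ℚ.0≤∣p∣ (C m ℚ.- p ℚ./ k))
              (ℚ.≤-trans (ℚ.≤-reflexive (sym (fromℕ-* (Q m) k))) (fromℕ-mono Qm*k≤)))
            (ℚ.≤-reflexive (trans (cong (ℚ.∣ C m ℚ.- p ℚ./ k ∣ ℚ.*_) (fromℕ-* (2 ℕ.* (k ℕ.* Q (suc n))) v))
              (sym (ℚ.*-assoc ℚ.∣ C m ℚ.- p ℚ./ k ∣ (fromℕ (2 ℕ.* (k ℕ.* Q (suc n)))) (fromℕ v)))))))))
      where
      e₀ e₁ : ℤ
      e₀ = P n ℤ.* ℤ.+ k ℤ.- p ℤ.* ℤ.+ Q n
      e₁ = P (suc n) ℤ.* ℤ.+ k ℤ.- p ℤ.* ℤ.+ Q (suc n)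

      abs≡k : ℤ.∣ e₀ ℤ.* ℤ.+ Q (suc n) ℤ.- e₁ ℤ.* ℤ.+ Q n ∣ ≡ k
      abs≡k = trans
        (cong ℤ.∣_∣ (solveℤ 6 (λ p₀ p₁ q₀ q₁ p k →
            (p₀ ⊠ k ⊟ p ⊠ q₀) ⊠ q₁ ⊟ (p₁ ⊠ k ⊟ p ⊠ q₁) ⊠ q₀ ⊜ (p₀ ⊠ q₁ ⊟ p₁ ⊠ q₀) ⊠ k) refl
          (P n) (P (suc n)) (ℤ.+ Q n) (ℤ.+ Q (suc n)) p (ℤ.+ k)))
        (trans (ℤ.abs-* (P n ℤ.* ℤ.+ Q (suc n) ℤ.- P (suc n) ℤ.* ℤ.+ Q n) (ℤ.+ k))
          (trans (cong (ℕ._* k) (det-Q n)) (ℕ.*-identityˡ k)))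

      v≤ : v ℕ.≤ ℤ.∣ P m ℤ.* ℤ.+ k ℤ.- p ℤ.* ℤ.+ Q m ∣
      v≤ = subst (v ℕ.≤_)
        (cong ℤ.∣_∣ (trans
          (solveℤ 8 (λ u v p₀ p₁ q₀ q₁ p k →
              u ⊠ (p₀ ⊠ k ⊟ p ⊠ q₀) ⊞ v ⊠ (p₁ ⊠ k ⊟ p ⊠ q₁)
              ⊜ (u ⊠ p₀ ⊞ v ⊠ p₁) ⊠ k ⊟ p ⊠ (u ⊠ q₀ ⊞ v ⊠ q₁)) refl
            (ℤ.+ u) (ℤ.+ v) (P n) (P (suc n)) (ℤ.+ Q n) (ℤ.+ Q (suc n)) p (ℤ.+ k))
          (cong₂ (λ x y → x ℤ.* ℤ.+ k ℤ.- p ℤ.* y) (sym Pm) (sym Qmℤ))))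
        (same-sign-bound e₀ e₁ u v
          (subst (0 ℕ.<_) (sym abs≡k) (ℕ.>-nonZero⁻¹ k)) (subst (ℕ._< Q (suc n)) (sym abs≡k) k<Q))

      Qm≤ : Q m ℕ.≤ v ℕ.* Q (suc n) ℕ.+ v ℕ.* Q (suc n)
      Qm≤ = subst (ℕ._≤ v ℕ.* Q (suc n) ℕ.+ v ℕ.* Q (suc n)) (sym Qm)
        (ℕ.+-monoˡ-≤ (v ℕ.* Q (suc n)) (ℕ.*-mono-≤ (proj₁ (Linear.u≤v b⁺ n 0<b d)) (Q≤Q n)))

      Qm*k≤ : Q m ℕ.* k ℕ.≤ 2 ℕ.* (k ℕ.* Q (suc n)) ℕ.* v
      Qm*k≤ = ℕ.≤-trans (ℕ.*-monoˡ-≤ k Qm≤) (ℕ.≤-reflexive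
        (solveℕ 3 (λ v q k → (v ∙ q ⊹ v ∙ q) ∙ k ≐ conℕ 2 ∙ (k ∙ q) ∙ v) refl v (Q (suc n)) k))

    -- The cross difference of the convergents m and n is exactly v, by the determinant, and Q m ≥ v
    -- Q (n + 1); again v cancels.
    convergent-near : ℚ.∣ C m ℚ.- C n ∣ ℚ.* fromℕ (Q n ℕ.* Q (suc n)) ℚ.≤ 1ℚ
    convergent-near = cancel (ℚ.≤-trans
      (ℚ.≤-reflexive (trans (ℚ.*-assoc ℚ.∣ C m ℚ.- C n ∣ (fromℕ (Q n ℕ.* Q (suc n))) (fromℕ v))
        (cong (ℚ.∣ C m ℚ.- C n ∣ ℚ.*_) (sym (fromℕ-* (Q n ℕ.* Q (suc n)) v)))))
      (ℚ.≤-trans (*-monoˡ (ℚ.0≤∣p∣ (C m ℚ.- C n))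
          (ℚ.≤-trans (fromℕ-mono ≤Qm*Qn) (ℚ.≤-reflexive (fromℕ-* (Q m) (Q n)))))
        (ℚ.≤-reflexive (trans (cross (C m) (C n) (P m) (P n) (Q m) (Q n) (C*Q m) (C*Q n))
          (trans (cong fromℕ abs≡v) (sym (ℚ.*-identityˡ (fromℕ v))))))))
      where
      ≤Qm*Qn : Q n ℕ.* Q (suc n) ℕ.* v ℕ.≤ Q m ℕ.* Q n
      ≤Qm*Qn = ℕ.≤-trans
        (ℕ.≤-reflexive (solveℕ 3 (λ q₀ q₁ v → q₀ ∙ q₁ ∙ v ≐ (v ∙ q₁) ∙ q₀) refl
          (Q n) (Q (suc n)) v))
        (ℕ.*-monoˡ-≤ (Q n) (subst (v ℕ.* Q (suc n) ℕ.≤_) (sym Qm)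
          (ℕ.m≤n+m (v ℕ.* Q (suc n)) (u ℕ.* Q n))))

      abs≡v : ℤ.∣ P m ℤ.* ℤ.+ Q n ℤ.- P n ℤ.* ℤ.+ Q m ∣ ≡ v
      abs≡v = trans
        (cong ℤ.∣_∣ (trans (cong₂ (λ x y → x ℤ.* ℤ.+ Q n ℤ.- P n ℤ.* y) Pm Qmℤ)
          (solveℤ 6 (λ u v p₀ p₁ q₀ q₁ →
              (u ⊠ p₀ ⊞ v ⊠ p₁) ⊠ q₀ ⊟ p₀ ⊠ (u ⊠ q₀ ⊞ v ⊠ q₁)
              ⊜ ⊟ (v ⊠ (p₀ ⊠ q₁ ⊟ p₁ ⊠ q₀))) refl
            (ℤ.+ u) (ℤ.+ v) (P n) (P (suc n)) (ℤ.+ Q n) (ℤ.+ Q (suc n)))))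
        (trans (ℤ.∣-i∣≡∣i∣ (ℤ.+ v ℤ.* det₀))
          (trans (ℤ.abs-* (ℤ.+ v) det₀) (trans (cong (v ℕ.*_) (det-Q n)) (ℕ.*-identityʳ v))))
        where
        det₀ : ℤ
        det₀ = P n ℤ.* ℤ.+ Q (suc n) ℤ.- P (suc n) ℤ.* ℤ.+ Q n

  module Approximation (α : ℝ) (expansion : HasExpansion α c) where

    private
      close : ∀ ε → 0ℚ ℚ.< ε → Eventually (λ n → ∣ fromℚ (C n) - α ∣ ⩽ fromℚ ε)
      close ε 0<ε = ev-map (λ n h → ≺⇒⩽ (≺⁺ h)) (expansion (fromℚ ε) (0<fromℚ 0<ε))

    -- K does not depend on d, so replacing a convergent within η of α by α itself costs at most K
    -- η, which is made smaller than any ε.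
    limit-lower : ∀ r {K} n → 0 ℕ.< K →
      (∀ d → 1ℚ ℚ.≤ ℚ.∣ C (suc d ℕ.+ n) ℚ.- r ∣ ℚ.* fromℕ K) →
      1ℝ ⩽ ∣ α - fromℚ r ∣ * natural K
    limit-lower r {K} n 0<K far = ⩽-limit λ ε 0<ε → go ε (shrink (0≤fromℕ K) 0<ε)
      where
      go : ∀ ε → ∃[ η ] 0ℚ ℚ.< η × fromℕ K ℚ.* η ℚ.≤ ε →
           1ℝ ⩽ ∣ α - fromℚ r ∣ * natural K + fromℚ ε
      go ε (η , 0<η , Kη≤ε) = from (close η 0<η)
        where
        from : Eventually (λ m → ∣ fromℚ (C m) - α ∣ ⩽ fromℚ η) →
               1ℝ ⩽ ∣ α - fromℚ r ∣ * natural K + fromℚ ε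
        from (M , near) = ⩽-trans {y = fromℚ ℚ.∣ C m ℚ.- r ∣ * natural K} (⩽-ptwise λ _ → far M)
          (⩽-trans {y = (∣ α - fromℚ r ∣ + fromℚ η) * natural K}
            (*-monoʳ-⩽ {z = natural K} (≺⁺ (0<fromℚ (0<fromℕ′ 0<K)))
              (⩽-trans {y = ∣ fromℚ (C m) - α ∣ + ∣ α - fromℚ r ∣}
                (⩽-ptwise λ k → ∣-∣-triangle (C m) (seq α k) r)
                (⩽-trans (+-mono-⩽ (near m (ℕ.m≤n⇒m≤1+n (ℕ.m≤m+n M n))) ⩽-refl)
                  (⩽-reflexive (≈-ptwise λ k → ℚ.+-comm η ℚ.∣ seq α k ℚ.- r ∣)))))
            (⩽-ptwise λ k → lin Kη≤ε
              (solve 4 (λ a e K h → (a :* K :+ e) :- (a :+ h) :* K := e :- K :* h) refl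
                ℚ.∣ seq α k ℚ.- r ∣ ε (fromℕ K) η)))
          where
          m : ℕ
          m = suc M ℕ.+ n

    limit-upper : ∀ r {K} n → 0 ℕ.< K →
      (∀ d → ℚ.∣ C (suc d ℕ.+ n) ℚ.- r ∣ ℚ.* fromℕ K ℚ.≤ 1ℚ) →
      ∣ α - fromℚ r ∣ * natural K ⩽ 1ℝ
    limit-upper r {K} n 0<K nearby = ⩽-limit λ ε 0<ε → go ε (shrink (0≤fromℕ K) 0<ε)
      where
      go : ∀ ε → ∃[ η ] 0ℚ ℚ.< η × fromℕ K ℚ.* η ℚ.≤ ε →
           ∣ α - fromℚ r ∣ * natural K ⩽ 1ℝ + fromℚ ε
      go ε (η , 0<η , Kη≤ε) = from (close η 0<η)
        where
        from : Eventually (λ m → ∣ fromℚ (C m) - α ∣ ⩽ fromℚ η) →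
               ∣ α - fromℚ r ∣ * natural K ⩽ 1ℝ + fromℚ ε
        from (M , near) = ⩽-trans {y = (fromℚ η + fromℚ ℚ.∣ C m ℚ.- r ∣) * natural K}
          (*-monoʳ-⩽ {z = natural K} (≺⁺ (0<fromℚ (0<fromℕ′ 0<K)))
            (⩽-trans {y = ∣ fromℚ (C m) - α ∣ + fromℚ ℚ.∣ C m ℚ.- r ∣}
              (⩽-ptwise λ k → subst (λ z → ℚ.∣ seq α k ℚ.- r ∣ ℚ.≤ z ℚ.+ ℚ.∣ C m ℚ.- r ∣)
                (∣p-q∣-sym (seq α k) (C m)) (∣-∣-triangle (seq α k) (C m) r))
              (+-mono-⩽ (near m (ℕ.m≤n⇒m≤1+n (ℕ.m≤m+n M n))) ⩽-refl)))
          (⩽-ptwise λ _ → (lin (ℚ.+-mono-≤ (nearby M) Kη≤ε)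
              (solve 4 (λ a e K h → (con 1ℚ :+ e) :- (h :+ a) :* K
                  := (con 1ℚ :+ e) :- (a :* K :+ K :* h)) refl
                ℚ.∣ C m ℚ.- r ∣ ε (fromℕ K) η)))
          where
          m : ℕ
          m = suc M ℕ.+ n

    approx-lower : ∀ n p k .{{_ : ℕ.NonZero k}} → k ℕ.< Q (suc n) →
      1ℝ ⩽ ∣ α - fromℚ (p ℚ./ k) ∣ * natural (2 ℕ.* (k ℕ.* Q (suc n)))
    approx-lower n p k k<Q = limit-lower (p ℚ./ k) n
      (ℕ.*-mono-≤ (ℕ.s≤s (ℕ.z≤n {1})) (ℕ.*-mono-≤ (ℕ.>-nonZero⁻¹ k) (0<Q (suc n))))
      (λ d → fraction-far n d p k k<Q)

    approx-upper : ∀ n →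
      ∣ α - fromℚ (ℚ.↥ C n ℚ./ Q n) ∣ * natural (Q n ℕ.* Q (suc n)) ⩽ 1ℝ
    approx-upper n = limit-upper (ℚ.↥ C n ℚ./ Q n) n (ℕ.*-mono-≤ (0<Q n) (0<Q (suc n)))
      (λ d → subst (λ z → ℚ.∣ C (suc d ℕ.+ n) ℚ.- z ∣ ℚ.* fromℕ (Q n ℕ.* Q (suc n)) ℚ.≤ 1ℚ)
        (sym (ℚ.↥p/↧p≡p (C n))) (convergent-near n d))

-- Reciprocals, powers and logarithms of natural numbers

module _ {r z : ℝ} (0≺r : 0ℝ ≺ r) (r*z≈1 : r * z ≈ 1ℝ) where

  -- In use, r is the value of a comparison function at a denominator, z its reciprocal, D a
  -- distance from α and x an integer such as 2 k q (n + 1). Bounds on distances thereby become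
  -- bounds on integers.
  reciprocal-below : ∀ {D x} → 0ℝ ≺ x → x ≺ z → 1ℝ ⩽ D * x → r ≺ D
  reciprocal-below 0≺x x≺z 1⩽Dx = *-cancelʳ-≺ 0≺x
    (≺-⩽-trans (≺-≈-trans (*-monoˡ-≺ 0≺r x≺z) r*z≈1) 1⩽Dx)

  reciprocal-above : ∀ {D x} → 0ℝ ≺ x → r ≺ D → D * x ⩽ 1ℝ → x ⩽ z
  reciprocal-above 0≺x r≺D Dx⩽1 = *-cancelˡ-⩽ 0≺r (⩽-trans (≺⇒⩽ (*-monoʳ-≺ 0≺x r≺D))
    (⩽-≈-trans Dx⩽1 (≈-sym r*z≈1)))

exp-opposite : ∀ {x y} → (∀ n → seq x n ℚ.+ seq y n ≡ 0ℚ) → exp x * exp y ≈ 1ℝ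
exp-opposite {x} {y} e = ≈-trans (≈-sym (exp-+ x y)) (exp-0 {x + y} e)

exp-0⩽ : ∀ {x} → 0ℝ ⩽ x → 1ℝ ⩽ exp x
exp-0⩽ p = ≈-⩽-trans (≈-sym (exp-0 {0ℝ} λ _ → refl)) (exp-mono-⩽ p)

exp-reflects-0⩽ : ∀ {x} → 1ℝ ⩽ exp x → 0ℝ ⩽ x
exp-reflects-0⩽ p = exp-reflects-⩽ (≈-⩽-trans (exp-0 {0ℝ} λ _ → refl) p)

0≺^ : ∀ {x} → 0ℝ ≺ x → ∀ n → 0ℝ ≺ x ^ n
0≺^ {x} (≺⁺ 0<x) n = ≺⁺ (0<-^ {x} 0<x n)

^-mono : ∀ {x y} → 0ℝ ≺ x → x ⩽ y → ∀ n → x ^ n ⩽ y ^ n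
^-mono 0≺x x⩽y zero    = ⩽-refl
^-mono 0≺x x⩽y (suc n) = ⩽-trans (*-monoʳ-⩽ (0≺^ 0≺x n) x⩽y)
  (*-monoˡ-⩽ (≺-⩽-trans 0≺x x⩽y) (^-mono 0≺x x⩽y n))

exp-^ : ∀ x n → exp x ^ n ≈ exp (x * natural n)
exp-^ x zero    = ≈-sym (exp-0 {x * natural 0} λ n → ℚ.*-zeroʳ (seq x n))
exp-^ x (suc n) = ≈-trans (*-congˡ (exp x) (exp-^ x n))
  (≈-trans (≈-sym (exp-+ x (x * natural n)))
    (exp-ptwise {x + x * natural n} {x * natural (suc n)} λ k → trans
      (solve 2 (λ x m → x :+ x :* m := x :* (con 1ℚ :+ m)) refl (seq x k) (fromℕ n))
      (cong (seq x k ℚ.*_) (sym (fromℕ-suc n)))))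

0≺natural : ∀ n .{{_ : ℕ.NonZero n}} → 0ℝ ≺ natural n
0≺natural n = ≺⁺ (0<natural n)

natural-mono : ∀ {m n} → m ℕ.≤ n → natural m ⩽ natural n
natural-mono m≤n = fromℚ-mono (fromℕ-mono m≤n)

natural-* : ∀ m n → natural (m ℕ.* n) ≈ natural m * natural n
natural-* m n = ≈-ptwise λ _ → fromℕ-* m n

*-natural-mono : ∀ {x} → 0ℝ ⩽ x → ∀ {m n} → m ℕ.≤ n → x * natural m ⩽ x * natural n
*-natural-mono {x} 0⩽x {m} {n} m≤n = ⩽-lin (0⩽ (n ℕ.∸ m)) λ k → trans
  (cong (λ z → seq x k ℚ.* z ℚ.- seq x k ℚ.* fromℕ m)
    (trans (cong fromℕ (sym (ℕ.m+[n∸m]≡n m≤n))) (fromℕ-+ m (n ℕ.∸ m))))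
  (solve 3 (λ x m d → x :* (m :+ d) :- x :* m := x :* d :- con 0ℚ) refl
    (seq x k) (fromℕ m) (fromℕ (n ℕ.∸ m)))
  where
  0⩽ : ∀ d → 0ℝ ⩽ x * natural d
  0⩽ zero    = ⩽-reflexive (≈-ptwise λ k → sym (ℚ.*-zeroʳ (seq x k)))
  0⩽ (suc d) = ≈-⩽-trans (≈-ptwise λ k → sym (ℚ.*-zeroˡ (fromℕ (suc d))))
    (*-monoʳ-⩽ (0≺natural (suc d)) 0⩽x)

module _ (m : ℕ) .{{_ : ℕ.NonZero m}} where

  exp-lnℕ : exp (lnℕ m) ≈ natural m
  exp-lnℕ = exp-ln (natural m) (0<natural m)

  lnℕ-⩽ : ∀ {x} → natural m ⩽ exp x → lnℕ m ⩽ x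
  lnℕ-⩽ p = exp-reflects-⩽ (≈-⩽-trans exp-lnℕ p)

  ⩽-exp : ∀ {x} → lnℕ m ⩽ x → natural m ⩽ exp x
  ⩽-exp p = ≈-⩽-trans (≈-sym exp-lnℕ) (exp-mono-⩽ p)

  0⩽lnℕ : 0ℝ ⩽ lnℕ m
  0⩽lnℕ = exp-reflects-0⩽ (⩽-≈-trans (natural-mono {1} (ℕ.>-nonZero⁻¹ m)) (≈-sym exp-lnℕ))

  module _ (n : ℕ) .{{_ : ℕ.NonZero n}} where

    lnℕ-mono : m ℕ.≤ n → lnℕ m ⩽ lnℕ n
    lnℕ-mono m≤n = lnℕ-⩽ (⩽-≈-trans (natural-mono m≤n) (≈-sym (exp-ln (natural n) (0<natural n))))

    exp-lnℕ-+ : exp (lnℕ m + lnℕ n) ≈ natural (m ℕ.* n)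
    exp-lnℕ-+ = ≈-trans (exp-+ (lnℕ m) (lnℕ n))
      (≈-trans (*-cong exp-lnℕ (exp-ln (natural n) (0<natural n))) (≈-sym (natural-* m n)))

0≺lnℕ : ∀ {m} .{{_ : ℕ.NonZero m}} → 1 ℕ.< m → 0ℝ ≺ lnℕ m
0≺lnℕ 1<m = ≺⁺ (0<lnℕ 1<m)

module _ {m n k : ℕ} .{{_ : ℕ.NonZero m}} .{{_ : ℕ.NonZero n}} .{{_ : ℕ.NonZero k}} where

  lnℕ-subadditive : k ℕ.≤ m ℕ.* n → lnℕ k ⩽ lnℕ m + lnℕ n
  lnℕ-subadditive k≤mn = lnℕ-⩽ k (⩽-≈-trans (natural-mono k≤mn) (≈-sym (exp-lnℕ-+ m n)))

  lnℕ-superadditive : m ℕ.* n ℕ.≤ k → lnℕ m + lnℕ n ⩽ lnℕ k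
  lnℕ-superadditive mn≤k = exp-reflects-⩽ (≈-⩽-trans (exp-lnℕ-+ m n)
    (⩽-≈-trans (natural-mono mn≤k) (≈-sym (exp-lnℕ k))))

lnℕ-2^ : ∀ j .{{_ : ℕ.NonZero (2 ℕ.^ j)}} → natural j * lnℕ 2 ⩽ lnℕ (2 ℕ.^ j)
lnℕ-2^ zero    = ≈-⩽-trans (≈-ptwise λ n → ℚ.*-zeroˡ (seq (lnℕ 2) n)) (0⩽lnℕ 1)
lnℕ-2^ (suc j) = ⩽-trans
  (⩽-reflexive (≈-ptwise λ n → trans (cong (ℚ._* seq (lnℕ 2) n) (fromℕ-suc j))
    (solve 2 (λ j l → (con 1ℚ :+ j) :* l := l :+ j :* l) refl (fromℕ j) (seq (lnℕ 2) n))))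
  (⩽-trans (+-mono-⩽ (⩽-refl {lnℕ 2}) (lnℕ-2^ j)) (lnℕ-superadditive {2} {2 ℕ.^ j} ℕ.≤-refl))
  where
  instance
    2^j≢0 : ℕ.NonZero (2 ℕ.^ j)
    2^j≢0 = ℕ.m^n≢0 2 j

archimedeanℝ : ∀ {x} → 0ℝ ≺ x → ∃[ j ] 1ℝ ≺ x * natural j
archimedeanℝ {x} (≺⁺ 0<x) = from (0<⇒eventually x 0<x)
  where
  from : ∃[ δ ] 0ℚ ℚ.< δ × Eventually (λ n → δ ℚ.≤ seq x n) → ∃[ j ] 1ℝ ≺ x * natural j
  from (δ , 0<δ , ev) = suc j , ≺⁺ (δ , 0<δ , ev-map
    (λ n δ≤x → ℚ.≤-trans (lin (*-monoˡ (ℚ.<⇒≤ 0<δ) (proj₂ (archimedean (inv δ))))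
        (trans (cong (λ z → δ ℚ.* z ℚ.- (1ℚ ℚ.+ δ)) (fromℕ-suc j))
          (trans (solve 2 (λ d j → d :* (con 1ℚ :+ j) :- (con 1ℚ :+ d) := d :* j :- con 1ℚ) refl
              δ (fromℕ j))
            (cong (λ z → δ ℚ.* fromℕ j ℚ.- z) (sym (inv-inverse (>⇒≢ 0<δ)))))))
      (*-monoʳ (0≤fromℕ (suc j)) δ≤x))
    ev)
    where
    j : ℕ
    j = proj₁ (archimedean (inv δ))

-- Absorbs the constant 2 of the estimates for distances and for q (n + 1): if ε j > 1 and k ≥ 2ʲ,
-- then ε ln k ≥ ε j ln 2 > ln 2.
ln2-negligible : ∀ {ε} → 0ℝ ≺ ε →
  ∃[ K ] ∀ k .{{_ : ℕ.NonZero k}} → K ℕ.≤ k → lnℕ 2 ≺ ε * lnℕ k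
ln2-negligible {ε} 0≺ε = from (archimedeanℝ 0≺ε)
  where
  from : ∃[ j ] 1ℝ ≺ ε * natural j →
         ∃[ K ] ∀ k .{{_ : ℕ.NonZero k}} → K ℕ.≤ k → lnℕ 2 ≺ ε * lnℕ k
  from (j , 1≺εj) = 2 ℕ.^ j , bound
    where
    instance
      2^j≢0 : ℕ.NonZero (2 ℕ.^ j)
      2^j≢0 = ℕ.m^n≢0 2 j
    bound : ∀ k .{{_ : ℕ.NonZero k}} → 2 ℕ.^ j ℕ.≤ k → lnℕ 2 ≺ ε * lnℕ k
    bound k 2^j≤k = ≈-≺-trans (≈-sym (*-identityˡ (lnℕ 2)))
      (≺-⩽-trans (*-monoʳ-≺ 0≺ln2 1≺εj)
        (≈-⩽-trans (*-assoc ε (natural j) (lnℕ 2))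
          (*-monoˡ-⩽ 0≺ε (⩽-trans (lnℕ-2^ j) (lnℕ-mono (2 ℕ.^ j) k 2^j≤k)))))
      where
      0≺ln2 : 0ℝ ≺ lnℕ 2
      0≺ln2 = 0≺lnℕ (ℕ.s≤s (ℕ.s≤s ℕ.z≤n))

-- exp (k γ) = exp (k γ / 2)² ≥ (1 + k γ / 2)², which is quadratic in k.
linear≺exp : ∀ {γ} → 0ℝ ≺ γ →
  ∃[ K ] ∀ k .{{_ : ℕ.NonZero k}} → K ℕ.≤ k → natural (2 ℕ.* k) ≺ exp (γ * natural k)
linear≺exp {γ} (≺⁺ 0<γ) = from (0<⇒eventually γ 0<γ)
  where
  from : ∃[ δ ] 0ℚ ℚ.< δ × Eventually (λ n → δ ℚ.≤ seq γ n) →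
    ∃[ K ] ∀ k .{{_ : ℕ.NonZero k}} → K ℕ.≤ k → natural (2 ℕ.* k) ≺ exp (γ * natural k)
  from (δ , 0<δ , ev) = K , bound
    where
    e : ℚ
    -- With h = δ k / 2 one has h² = δ² k² / 4 ≥ 2 k as soon as k ≥ 8 / δ².
    e = fromℕ 8 ℚ.* inv (δ ℚ.* δ)
    K : ℕ
    K = proj₁ (archimedean e)
    0<δδ : 0ℚ ℚ.< δ ℚ.* δ
    0<δδ = 0<* 0<δ 0<δ
    bound : ∀ k .{{_ : ℕ.NonZero k}} → K ℕ.≤ k → natural (2 ℕ.* k) ≺ exp (γ * natural k)
    bound k K≤k = ≺-⩽-trans 2k≺ (⩽-trans square
        (exp-mono-⩽ (*-monoʳ-⩽ (0≺natural k) (⩽-ev ev))))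
      where
      κ h : ℚ
      κ = fromℕ k
      h = ½ ℚ.* (δ ℚ.* κ)
      0≤h : 0ℚ ℚ.≤ h
      0≤h = 0≤* 0≤½ (0≤* (ℚ.<⇒≤ 0<δ) (0≤fromℕ k))
      8≤δδκ : fromℕ 8 ℚ.≤ δ ℚ.* δ ℚ.* κ
      8≤δδκ = subst (ℚ._≤ δ ℚ.* δ ℚ.* κ)
        (trans (solve 2 (λ d i → d :* (con (fromℕ 8) :* i) := con (fromℕ 8) :* (d :* i)) refl
            (δ ℚ.* δ) (inv (δ ℚ.* δ)))
          (trans (cong (fromℕ 8 ℚ.*_) (inv-inverse (>⇒≢ 0<δδ))) (ℚ.*-identityʳ (fromℕ 8))))
        (*-monoˡ (ℚ.<⇒≤ 0<δδ) (ℚ.≤-trans (proj₂ (archimedean e)) (fromℕ-mono K≤k)))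
      2k≺ : natural (2 ℕ.* k) ≺ (1ℝ + fromℚ h) * (1ℝ + fromℚ h)
      2k≺ = ≺⁺ (1ℚ , 0<1 , 0 , λ _ _ → lin
        (ℚ.+-mono-≤ (*-monoʳ (0≤* 0≤½ (0≤* 0≤½ (0≤fromℕ k))) 8≤δδκ) (ℚ.+-mono-≤ 0≤h 0≤h))
        (trans (cong (λ z → (1ℚ ℚ.+ h) ℚ.* (1ℚ ℚ.+ h) ℚ.- (z ℚ.+ 1ℚ)) (fromℕ-double k))
          (solve 2 (λ d k → let h = con ½ :* (d :* k) in
              (con 1ℚ :+ h) :* (con 1ℚ :+ h) :- (k :+ k :+ con 1ℚ)
              := (d :* d :* k :* (con ½ :* (con ½ :* k)) :+ (h :+ h))
                 :- (con (fromℕ 8) :* (con ½ :* (con ½ :* k)) :+ (con 0ℚ :+ con 0ℚ))) refl δ κ)))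
      0≺1+h : 0ℝ ≺ 1ℝ + fromℚ h
      0≺1+h = 1⩽⇒0≺ (⩽-ptwise λ _ → p≤p+ 0≤h)
      square : (1ℝ + fromℚ h) * (1ℝ + fromℚ h) ⩽ exp (fromℚ δ * natural k)
      square = ⩽-trans (*-monoʳ-⩽ 0≺1+h (1+x⩽exp (fromℚ h)))
        (⩽-trans (*-monoˡ-⩽ (0≺exp (fromℚ h)) (1+x⩽exp (fromℚ h)))
          (≈-⩽-trans (≈-sym (exp-+ (fromℚ h) (fromℚ h)))
            (⩽-reflexive (exp-ptwise {fromℚ h + fromℚ h} {fromℚ δ * natural k} λ _ → half+half (δ ℚ.* κ)))))

-- With γ = ε / (β + ε), the bound (1 - γ) exp γ ≤ 1 reads β exp γ ≤ β + ε.
exp-increment : ∀ {β ε} → 0ℝ ≺ β → 0ℝ ≺ ε → ∃[ γ ] 0ℝ ≺ γ × β * exp γ ⩽ β + ε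
exp-increment {β} {ε} 0≺β 0≺ε = γ , 0≺* 0≺ε (0≺recip 0<s) , ≈-⩽-trans
  (≈-trans (*-congʳ (exp γ) β≈) (*-assoc s (1ℝ - γ) (exp γ)))
  (⩽-≈-trans (*-monoˡ-⩽ (≺⁺ 0<s) (exp*1-x⩽1 γ)) (*-identityʳ s))
  where
  s : ℝ
  s = β + ε
  0<s : 0ℝ < s
  0<s = ≺⁻ (≺-trans 0≺β (≺-of-pos 0≺ε))
  γ : ℝ
  γ = ε ÷ s ⟨ 0<s ⟩
  β≈ : β ≈ s * (1ℝ - γ)
  β≈ = ≈-trans (≈-ptwise λ n → solve 2 (λ b e → b := (b :+ e) :+ (con 0ℚ :- e)) refl (seq β n) (seq ε n))
    (≈-trans (+-cong (≈-refl {s}) (neg≈ {ε} {γ * s} (≈-sym (÷-*-cancel 0<s ε))))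
      (≈-ptwise λ n → solve 2 (λ s g → s :+ (con 0ℚ :- g :* s) := s :* (con 1ℚ :- g)) refl (seq s n) (seq γ n)))
    where
    neg≈ : ∀ {x y} → x ≈ y → 0ℝ - x ≈ 0ℝ - y
    neg≈ {x} {y} p = ⩽-antisym
      (⩽-lin (⩽-reflexive (≈-sym p)) λ n →
        solve 2 (λ x y → (con 0ℚ :- y) :- (con 0ℚ :- x) := x :- y) refl (seq x n) (seq y n))
      (⩽-lin (⩽-reflexive p) λ n →
        solve 2 (λ x y → (con 0ℚ :- x) :- (con 0ℚ :- y) := y :- x) refl (seq x n) (seq y n))

-- Irrationality measures and the growth of the convergents

ev-witness : ∀ {P : ℕ → Set} → Eventually P → ∃[ n ] P n
ev-witness (N , p) = N , p N ℕ.≤-refl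

module _ (x : ℝ) (m : ℕ) .{{_ : ℕ.NonZero m}} (1<m : 1 ℕ.< m) where

  /ln-⩽⇒ : ∀ {u} → x /ln m ⩽ u → x ⩽ u * lnℕ m
  /ln-⩽⇒ p with 1 ℕ.<? m
  ... | yes 1<m′ = ÷-⩽⇒ (0<lnℕ 1<m′) p
  ... | no  1≮m  = contradiction 1<m 1≮m

  ⇒/ln-⩽ : ∀ {u} → x ⩽ u * lnℕ m → x /ln m ⩽ u
  ⇒/ln-⩽ p with 1 ℕ.<? m
  ... | yes 1<m′ = ⇒÷-⩽ (0<lnℕ 1<m′) p
  ... | no  1≮m  = contradiction 1<m 1≮m

recip-antitone : ∀ {x y} (0<x : 0ℝ < x) (0<y : 0ℝ < y) → x ⩽ y → recip y 0<y ⩽ recip x 0<x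
recip-antitone {x} {y} 0<x 0<y x⩽y = *-cancelʳ-⩽ (≺⁺ 0<x)
  (⩽-trans (*-monoˡ-⩽ (0≺recip 0<y) x⩽y)
    (⩽-reflexive (≈-trans (recip-* 0<y) (≈-sym (recip-* 0<x)))))

Gauge : Set
Gauge = (k : ℕ) .{{_ : ℕ.NonZero k}} → ℝ

powerGauge : ℝ → Gauge
powerGauge μ k = rpow (natural k) (0<natural k) (- μ)

geometricGauge : (s : ℝ) → 0ℝ < s → Gauge
geometricGauge s 0<s k = recip (s ^ k) (0<-^ {s} 0<s k)

powerGauge-antitone : ∀ {μ ν} → μ ⩽ ν → ∀ k .{{_ : ℕ.NonZero k}} → 2 ℕ.≤ k →
                      powerGauge ν k ⩽ powerGauge μ k
powerGauge-antitone {μ} {ν} μ⩽ν k 1<k = exp-mono-⩽ (*-monoʳ-⩽ (0≺lnℕ 1<k)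
  (⩽-lin {u = - ν} {v = - μ} μ⩽ν λ n →
    solve 2 (λ m n → :- m :- :- n := n :- m) refl (seq μ n) (seq ν n)))

geometricGauge-antitone : ∀ {s t} (0<s : 0ℝ < s) (0<t : 0ℝ < t) → s ⩽ t →
  ∀ k .{{_ : ℕ.NonZero k}} → geometricGauge t 0<t k ⩽ geometricGauge s 0<s k
geometricGauge-antitone {s} {t} 0<s 0<t s⩽t k =
  recip-antitone (0<-^ {s} 0<s k) (0<-^ {t} 0<t k) (^-mono (≺⁺ 0<s) s⩽t k)

half-step : ∀ {y z ε} → y ≺ z + half ε → y + half ε ⩽ z + ε
half-step {y} {z} {ε} y≺ = ⩽-lin (≺⇒⩽ y≺) λ n →
  solve 3 (λ y z e → (z :+ e) :- (y :+ con ½ :* e) := (z :+ con ½ :* e) :- y) refl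
    (seq y n) (seq z n) (seq ε n)

module _ (α : ℝ) where

  distance : ℤ → Gauge
  distance p k = ∣ α - fromℚ (p ℚ./ k) ∣

  Separated : Gauge → Set
  Separated f = ∃[ K ] 0 ℕ.< K ×
    (∀ (p : ℤ) (k : ℕ) .{{_ : ℕ.NonZero k}} → K ℕ.≤ k → f k < distance p k)

module _ {α : ℝ} where

  separated : ∀ {f : Gauge} K →
    (∀ p k .{{_ : ℕ.NonZero k}} → K ℕ.≤ k → f k ≺ distance α p k) → Separated α f
  separated {f} K far = suc K , ℕ.s≤s ℕ.z≤n , far′
    where
    far′ : ∀ p k .{{_ : ℕ.NonZero k}} → suc K ℕ.≤ k → f k < distance α p k
    far′ p k K<k = ≺⁻ (far p k (ℕ.<⇒≤ K<k))

  separated-weaken : ∀ {f g : Gauge} K →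
    (∀ k .{{_ : ℕ.NonZero k}} → K ℕ.≤ k → g k ⩽ f k) → Separated α f → Separated α g
  separated-weaken {f} {g} K g⩽f (L , _ , far) = separated {g} (K ℕ.+ L) far′
    where
    far′ : ∀ p k .{{_ : ℕ.NonZero k}} → K ℕ.+ L ℕ.≤ k → g k ≺ distance α p k
    far′ p k le = ⩽-≺-trans (g⩽f k (ℕ.m+n≤o⇒m≤o K le)) (≺⁺ (far p k (ℕ.m+n≤o⇒n≤o K le)))

  -- The ε inside the definition is split in two: half pays for y exceeding z, the other half is
  -- used in the bound at y. This closure lets an infimum of bounds be a least bound.
  ExponentBound-approx : ∀ {z} → 0ℝ ≺ z →
    (∀ ε → 0ℝ ≺ ε → ∃[ y ] ExponentBound α y × y ≺ z + ε) → ExponentBound α z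
  ExponentBound-approx {z} (≺⁺ 0<z) approx = 0<z , λ ε 0<ε →
    bound ε (≺⁺ 0<ε) (approx (half ε) (0≺half (≺⁺ 0<ε)))
    where
    bound : ∀ ε → 0ℝ ≺ ε → ∃[ y ] ExponentBound α y × y ≺ z + half ε →
            Separated α (powerGauge (z + ε))
    bound ε 0≺ε (y , (_ , y-bound) , y≺) = separated-weaken {powerGauge (y + half ε)} 2
      (powerGauge-antitone (half-step {y} {z} {ε} y≺)) (y-bound (half ε) (≺⁻ (0≺half 0≺ε)))

  BaseBound-approx : ∀ {z} → 1ℝ ⩽ z →
    (∀ ε → 0ℝ ≺ ε → ∃[ y ] BaseBound α y × y ≺ z + ε) → BaseBound α z
  BaseBound-approx {z} (⩽⁺ 1≤z) approx = 1≤z , λ ε 0<ε →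
    bound ε 0<ε (approx (half ε) (0≺half (≺⁺ 0<ε)))
    where
    bound : ∀ ε (0<ε : 0ℝ < ε) → ∃[ y ] BaseBound α y × y ≺ z + half ε →
            Separated α (geometricGauge (z + ε) (0<-+ {z} {ε} 1≤z 0<ε))
    bound ε 0<ε (y , (1≤y , y-bound) , y≺) =
      separated-weaken {geometricGauge (y + half ε) 0<s} 0
        (λ k _ → geometricGauge-antitone 0<s (0<-+ {z} {ε} 1≤z 0<ε) (half-step {y} {z} {ε} y≺) k)
        (y-bound (half ε) 0<½ε)
      where
      0<½ε : 0ℝ < half ε
      0<½ε = ≺⁻ (0≺half {ε} (≺⁺ 0<ε))
      0<s : 0ℝ < y + half ε
      0<s = 0<-+ {y} {half ε} 1≤y 0<½ε

module Bounds {α : ℝ} (c : ContinuedFraction) (expansion : HasExpansion α c) where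

  open ContinuedFraction c
  open Convergents c
  open Approximation α expansion

  LnQ≤LnQ LnB≤LnQ LnQ≤Q LnB≤Q : ℝ → Set
  LnQ≤LnQ u = Eventually λ n → lnℕ (Q (suc n)) ⩽ u * lnℕ (Q n)
  LnB≤LnQ u = Eventually λ n → lnℕ (b⁺ n) ⩽ u * lnℕ (Q n)
  LnQ≤Q u = Eventually λ n → lnℕ (Q (suc n)) ⩽ u * natural (Q n)
  LnB≤Q u = Eventually λ n → lnℕ (b⁺ n) ⩽ u * natural (Q n)

  ev-Q≥ : ∀ K → Eventually (λ n → K ℕ.≤ Q n)
  ev-Q≥ K = K , λ n K≤n → ℕ.≤-trans K≤n (n≤Q n)

  -- The search climbs from N and must stop, because n ≤ Q n rules out Q n ≤ k once n exceeds k;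
  -- this justifies the fuel k + 1.
  between : ∀ {N k} → Q N ℕ.≤ k → ∃[ n ] N ℕ.≤ n × Q n ℕ.≤ k × k ℕ.< Q (suc n)
  between {N} {k} QN≤k = search (suc k) N ℕ.≤-refl QN≤k (ℕ.m≤m+n (suc k) N)
    where
    search : ∀ fuel n → N ℕ.≤ n → Q n ℕ.≤ k → suc k ℕ.≤ fuel ℕ.+ n →
             ∃[ n ] N ℕ.≤ n × Q n ℕ.≤ k × k ℕ.< Q (suc n)
    search zero       n N≤n Qn≤k k<n =
      contradiction (ℕ.≤-trans k<n (ℕ.≤-trans (n≤Q n) Qn≤k)) (ℕ.<-irrefl refl)
    search (suc fuel) n N≤n Qn≤k k< with k ℕ.<? Q (suc n)
    ... | yes k<Q = n , N≤n , Qn≤k , k<Q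
    ... | no  k≮Q = search fuel (suc n) (ℕ.m≤n⇒m≤1+n N≤n) (ℕ.≮⇒≥ k≮Q)
      (subst (suc k ℕ.≤_) (sym (ℕ.+-suc fuel n)) k<)

  lnb+lnQ⩽lnQ : ∀ n → lnℕ (b⁺ n) + lnℕ (Q n) ⩽ lnℕ (Q (suc n))
  lnb+lnQ⩽lnQ n = lnℕ-superadditive {b⁺ n} {Q n} {Q (suc n)} (b*Q≤Q n)

  lnQ⩽ln2Q+lnb : ∀ n → lnℕ (Q (suc n)) ⩽ lnℕ (2 ℕ.* Q n) + lnℕ (b⁺ n)
  lnQ⩽ln2Q+lnb n = lnℕ-subadditive {2 ℕ.* Q n} {b⁺ n} (subst (Q (suc n) ℕ.≤_)
    (trans (cong (2 ℕ.*_) (ℕ.*-comm (b⁺ n) (Q n))) (sym (ℕ.*-assoc 2 (Q n) (b⁺ n)))) (Q≤2*b*Q n))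

  module _ {x : ℕ → ℝ} where

    coefficient-lower : ∀ {u v} (y : ℕ → ℝ) → Eventually (λ n → 0ℝ ≺ y n) →
      (∀ n → v * y n ⩽ x n) → Eventually (λ n → x n ⩽ u * y n) → v ⩽ u
    coefficient-lower {u} {v} y pos lower upper = from (ev-witness (ev-zip (λ _ → _,_) pos upper))
      where
      from : ∃[ n ] 0ℝ ≺ y n × x n ⩽ u * y n → v ⩽ u
      from (n , 0≺y , le) = *-cancelʳ-⩽ 0≺y (⩽-trans (lower n) le)

    0⩽coefficient : ∀ {u} (y : ℕ → ℝ) → Eventually (λ n → 0ℝ ≺ y n) →
      (∀ n → 0ℝ ⩽ x n) → Eventually (λ n → x n ⩽ u * y n) → 0ℝ ⩽ u
    0⩽coefficient y pos 0⩽x = coefficient-lower y pos λ n →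
      ≈-⩽-trans (≈-ptwise λ k → ℚ.*-zeroˡ (seq (y n) k)) (0⩽x n)

  ev-0≺lnQ : Eventually (λ n → 0ℝ ≺ lnℕ (Q n))
  ev-0≺lnQ = ev-map (λ n 1<Q → 0≺lnℕ 1<Q) (ev-Q≥ 2)

  -- The denominators do not decrease. The sign of u is needed to replace ln q n by the larger ln k
  -- in u ln q n, and for the positivity built into an exponent bound.
  1⩽LnQ≤LnQ : ∀ {u} → LnQ≤LnQ u → 1ℝ ⩽ u
  1⩽LnQ≤LnQ = coefficient-lower (λ n → lnℕ (Q n)) ev-0≺lnQ λ n →
    ≈-⩽-trans (*-identityˡ (lnℕ (Q n))) (lnℕ-mono (Q n) (Q (suc n)) (Q≤Q n))

  0⩽LnB≤LnQ : ∀ {u} → LnB≤LnQ u → 0ℝ ⩽ u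
  0⩽LnB≤LnQ = 0⩽coefficient (λ n → lnℕ (Q n)) ev-0≺lnQ λ n → 0⩽lnℕ (b⁺ n)

  0⩽LnQ≤Q : ∀ {u} → LnQ≤Q u → 0ℝ ⩽ u
  0⩽LnQ≤Q = 0⩽coefficient (λ n → natural (Q n)) (ev-all λ n → 0≺natural (Q n)) λ n →
    0⩽lnℕ (Q (suc n))

  0⩽LnB≤Q : ∀ {u} → LnB≤Q u → 0ℝ ⩽ u
  0⩽LnB≤Q = 0⩽coefficient (λ n → natural (Q n)) (ev-all λ n → 0≺natural (Q n)) λ n →
    0⩽lnℕ (b⁺ n)

  nonZero-2kQ : ∀ k n .{{_ : ℕ.NonZero k}} → ℕ.NonZero (2 ℕ.* (k ℕ.* Q (suc n)))
  nonZero-2kQ k n = ℕ.m*n≢0 2 (k ℕ.* Q (suc n)) {{_}} {{ℕ.m*n≢0 k (Q (suc n))}}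

  natural-2kQ : ∀ k n .{{_ : ℕ.NonZero k}} →
    natural (2 ℕ.* (k ℕ.* Q (suc n))) ≈ exp (lnℕ 2 + (lnℕ k + lnℕ (Q (suc n))))
  natural-2kQ k n = ≈-trans (natural-* 2 (k ℕ.* Q (suc n)))
    (≈-trans (*-cong (≈-sym (exp-lnℕ 2)) (≈-sym (exp-lnℕ-+ k (Q (suc n)))))
      (≈-sym (exp-+ (lnℕ 2) (lnℕ k + lnℕ (Q (suc n))))))

  powerGauge-inverse : ∀ μ k .{{_ : ℕ.NonZero k}} → powerGauge μ k * exp (μ * lnℕ k) ≈ 1ℝ
  powerGauge-inverse μ k = exp-opposite {(- μ) * lnℕ k} {μ * lnℕ k} λ n →
    solve 2 (λ m l → (:- m) :* l :+ m :* l := con 0ℚ) refl (seq μ n) (seq (lnℕ k) n)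

  LnQ≤LnQ⇒ExponentBound : ∀ {u} → LnQ≤LnQ u → ExponentBound α (1ℝ + u)
  LnQ≤LnQ⇒ExponentBound {u} h@(N , le) = ≺⁻ 0≺1+u , λ ε 0<ε →
    bound ε (ln2-negligible (≺⁺ 0<ε))
    where
    0≺u : 0ℝ ≺ u
    0≺u = 1⩽⇒0≺ (1⩽LnQ≤LnQ h)
    0≺1+u : 0ℝ ≺ 1ℝ + u
    0≺1+u = ≺-trans 0≺1 (≺-of-pos 0≺u)
    bound : ∀ ε → ∃[ K ] (∀ k .{{_ : ℕ.NonZero k}} → K ℕ.≤ k → lnℕ 2 ≺ ε * lnℕ k) →
            Separated α (powerGauge ((1ℝ + u) + ε))
    bound ε (K , ln2≺) = separated (Q N ℕ.+ K) far
      where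
      far : ∀ p k .{{_ : ℕ.NonZero k}} → Q N ℕ.+ K ℕ.≤ k →
            powerGauge ((1ℝ + u) + ε) k ≺ distance α p k
      far p k le′ = from (between (ℕ.m+n≤o⇒m≤o (Q N) le′))
        where
        from : ∃[ n ] N ℕ.≤ n × Q n ℕ.≤ k × k ℕ.< Q (suc n) →
               powerGauge ((1ℝ + u) + ε) k ≺ distance α p k
        -- The inequality to check is ln 2 + ln k + ln q (n + 1) < (1 + u + ε) ln k: here ε ln k
        -- exceeds ln 2, and ln q (n + 1) ≤ u ln q n ≤ u ln k.
        from (n , N≤n , Q≤k , k<Q) = reciprocal-below
          (0≺exp (- ((1ℝ + u) + ε) * lnℕ k)) (powerGauge-inverse ((1ℝ + u) + ε) k)
          (0≺natural (2 ℕ.* (k ℕ.* Q (suc n))) {{nonZero-2kQ k n}})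
          (≈-≺-trans (natural-2kQ k n) (exp-mono-≺ (≺-lin
            (+-mono-≺-⩽ (ln2≺ k (ℕ.m+n≤o⇒n≤o (Q N) le′)) (⩽-trans (le n N≤n)
              (*-monoˡ-⩽ 0≺u (lnℕ-mono (Q n) k Q≤k))))
            λ m → solve 5 (λ u e l t q → ((con 1ℚ :+ u) :+ e) :* l :- (t :+ (l :+ q))
                := (e :* l :+ u :* l) :- (t :+ q)) refl
              (seq u m) (seq ε m) (seq (lnℕ k) m) (seq (lnℕ 2) m) (seq (lnℕ (Q (suc n))) m))))
          (approx-lower n p k k<Q)

  ExponentBound⇒LnQ≤LnQ : ∀ {y ε} → 0ℝ ≺ ε → ExponentBound α y → LnQ≤LnQ ((y - 1ℝ) + ε)
  ExponentBound⇒LnQ≤LnQ {y} {ε} (≺⁺ 0<ε) (_ , bound) = from (bound ε 0<ε)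
    where
    near : ∀ n → powerGauge (y + ε) (Q n) ≺ distance α (ℚ.↥ C n) (Q n) →
           lnℕ (Q (suc n)) ⩽ ((y - 1ℝ) + ε) * lnℕ (Q n)
    near n close = ⩽-lin
      (exp-reflects-⩽ {lnℕ (Q n) + lnℕ (Q (suc n))} {(y + ε) * lnℕ (Q n)}
        (≈-⩽-trans (exp-lnℕ-+ (Q n) (Q (suc n)))
          (reciprocal-above (0≺exp (- (y + ε) * lnℕ (Q n))) (powerGauge-inverse (y + ε) (Q n))
            (0≺natural (Q n ℕ.* Q (suc n)) {{ℕ.m*n≢0 (Q n) (Q (suc n))}})
            close (approx-upper n))))
      λ m → solve 4 (λ y e l q → ((y :- con 1ℚ) :+ e) :* l :- q := (y :+ e) :* l :- (l :+ q)) refl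
        (seq y m) (seq ε m) (seq (lnℕ (Q n)) m) (seq (lnℕ (Q (suc n))) m)
    from : Separated α (powerGauge (y + ε)) → LnQ≤LnQ ((y - 1ℝ) + ε)
    from (K , _ , far) = ev-map (λ n K≤Q → near n (≺⁺ (far (ℚ.↥ C n) (Q n) K≤Q))) (ev-Q≥ K)

  LnB≤LnQ⇒LnQ≤LnQ : ∀ {u ε} → 0ℝ ≺ ε → LnB≤LnQ u → LnQ≤LnQ ((1ℝ + u) + ε)
  LnB≤LnQ⇒LnQ≤LnQ {u} {ε} 0≺ε h = from (ln2-negligible 0≺ε)
    where
    step : ∀ n → lnℕ (b⁺ n) ⩽ u * lnℕ (Q n) → lnℕ 2 ≺ ε * lnℕ (Q n) →
           lnℕ (Q (suc n)) ⩽ ((1ℝ + u) + ε) * lnℕ (Q n)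
    step n le ln2≺ = ⩽-trans (lnQ⩽ln2Q+lnb n) (⩽-lin
      (+-mono-⩽ (lnℕ-subadditive {2} {Q n} {2 ℕ.* Q n} ℕ.≤-refl) (+-mono-⩽ le (≺⇒⩽ ln2≺)))
      λ m → solve 6 (λ u e l t s b → ((con 1ℚ :+ u) :+ e) :* l :- (s :+ b)
          := (t :+ l) :+ (u :* l :+ e :* l) :- (s :+ (b :+ t))) refl
        (seq u m) (seq ε m) (seq (lnℕ (Q n)) m) (seq (lnℕ 2) m) (seq (lnℕ (2 ℕ.* Q n)) m)
        (seq (lnℕ (b⁺ n)) m))
    from : ∃[ K ] (∀ k .{{_ : ℕ.NonZero k}} → K ℕ.≤ k → lnℕ 2 ≺ ε * lnℕ k) →
           LnQ≤LnQ ((1ℝ + u) + ε)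
    from (K , ln2≺) = ev-zip (λ n le K≤Q → step n le (ln2≺ (Q n) K≤Q)) h (ev-Q≥ K)

  -- v is tied to u - 1 only termwise, so that it can be supplied in a rearranged form such as (y -
  -- 2) + ε.
  LnQ≤LnQ⇒LnB≤LnQ : ∀ {u v} → (∀ n → seq v n ≡ seq u n ℚ.- 1ℚ) → LnQ≤LnQ u → LnB≤LnQ v
  LnQ≤LnQ⇒LnB≤LnQ {u} {v} e = ev-map λ n le → ⩽-lin (⩽-trans (lnb+lnQ⩽lnQ n) le) λ m →
    trans (cong (λ z → z ℚ.* seq (lnℕ (Q n)) m ℚ.- seq (lnℕ (b⁺ n)) m) (e m))
      (solve 3 (λ u l b → (u :- con 1ℚ) :* l :- b := u :* l :- (b :+ l)) refl
        (seq u m) (seq (lnℕ (Q n)) m) (seq (lnℕ (b⁺ n)) m))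

  LnQ≤Q⇒BaseBound : ∀ {u} → LnQ≤Q u → BaseBound α (exp u)
  LnQ≤Q⇒BaseBound {u} h@(N , le) = ⩽⁻ 1⩽expu , λ ε 0<ε →
    bound ε 0<ε (exp-increment (0≺exp u) (≺⁺ 0<ε))
    where
    0⩽u : 0ℝ ⩽ u
    0⩽u = 0⩽LnQ≤Q h
    1⩽expu : 1ℝ ⩽ exp u
    1⩽expu = exp-0⩽ 0⩽u
    bound : ∀ ε (0<ε : 0ℝ < ε) → ∃[ γ ] 0ℝ ≺ γ × exp u * exp γ ⩽ exp u + ε →
            Separated α (geometricGauge (exp u + ε) (0<-+ {exp u} {ε} (⩽⁻ 1⩽expu) 0<ε))
    bound ε 0<ε (γ , 0≺γ , step) = from (linear≺exp 0≺γ)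
      where
      s : ℝ
      s = exp u + ε
      0<s : 0ℝ < s
      0<s = 0<-+ {exp u} {ε} (⩽⁻ 1⩽expu) 0<ε
      from : ∃[ K ] (∀ k .{{_ : ℕ.NonZero k}} → K ℕ.≤ k → natural (2 ℕ.* k) ≺ exp (γ * natural k)) →
             Separated α (geometricGauge s 0<s)
      from (K , 2k≺) = separated (Q N ℕ.+ K) far
        where
        far : ∀ p k .{{_ : ℕ.NonZero k}} → Q N ℕ.+ K ℕ.≤ k →
              geometricGauge s 0<s k ≺ distance α p k
        far p k le′ = near (between (ℕ.m+n≤o⇒m≤o (Q N) le′))
          where
          -- The base s exceeds exp u by enough to hold exp (u + γ). In its k-th power exp (γ k)
          -- dominates 2 k and exp (u k) dominates q (n + 1).
          exp-uγ : exp (γ * natural k) * exp (u * natural k) ⩽ s ^ k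
          exp-uγ = ≈-⩽-trans
            (≈-trans (≈-sym (exp-+ (γ * natural k) (u * natural k)))
              (≈-trans
                (exp-ptwise {γ * natural k + u * natural k} {(u + γ) * natural k} λ m →
                  solve 3 (λ g u k → g :* k :+ u :* k := (u :+ g) :* k) refl
                    (seq γ m) (seq u m) (fromℕ k))
                (≈-sym (exp-^ (u + γ) k))))
            (^-mono (0≺exp (u + γ)) (≈-⩽-trans (exp-+ u γ) step) k)
          near : ∃[ n ] N ℕ.≤ n × Q n ℕ.≤ k × k ℕ.< Q (suc n) →
                 geometricGauge s 0<s k ≺ distance α p k
          near (n , N≤n , Q≤k , k<Q) = reciprocal-below
            (0≺recip (0<-^ {s} 0<s k)) (recip-* (0<-^ {s} 0<s k))
            (0≺natural (2 ℕ.* (k ℕ.* Q (suc n))) {{nonZero-2kQ k n}})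
            (≈-≺-trans
              (≈-trans (≈-ptwise λ _ → cong fromℕ (sym (ℕ.*-assoc 2 k (Q (suc n)))))
                (natural-* (2 ℕ.* k) (Q (suc n))))
              (≺-⩽-trans
                (*-monoʳ-≺ (0≺natural (Q (suc n))) (2k≺ k (ℕ.m+n≤o⇒n≤o (Q N) le′)))
                (⩽-trans (*-monoˡ-⩽ (0≺exp (γ * natural k))
                    (⩽-exp (Q (suc n)) (⩽-trans (le n N≤n) (*-natural-mono 0⩽u Q≤k))))
                  exp-uγ)))
            (approx-lower n p k k<Q)

  BaseBound⇒LnQ≤Q : ∀ {y ε} (0<y : 0ℝ < y) → 0ℝ ≺ ε → BaseBound α y → LnQ≤Q (ln y 0<y + ε)
  BaseBound⇒LnQ≤Q {y} {ε} 0<y 0≺ε (1≤y , bound) = from (bound η 0<η)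
    where
    η s t : ℝ
    -- Chosen so that y + η = exp (ln y + ε): an additive ε on the logarithm is a multiplicative
    -- change of the base.
    η = y * exp ε - y
    s = y + η
    t = ln y 0<y + ε
    0<η : 0ℝ < η
    0<η = ≺⁻ (≺⇒0≺- (≈-≺-trans (≈-sym (*-identityʳ y)) (*-monoˡ-≺ (≺⁺ 0<y)
      (≺-⩽-trans (≺-of-pos 0≺ε) (1+x⩽exp ε)))))
    0<s : 0ℝ < s
    0<s = 0<-+ {y} {η} 1≤y 0<η
    s≈ : s ≈ exp t
    s≈ = ≈-trans
      (≈-ptwise λ m → solve 2 (λ y e → y :+ (y :* e :- y) := y :* e) refl (seq y m) (seq (exp ε) m))
      (≈-trans (*-congʳ (exp ε) (≈-sym (exp-ln y 0<y))) (≈-sym (exp-+ (ln y 0<y) ε)))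
    near : ∀ n → geometricGauge s 0<s (Q n) ≺ distance α (ℚ.↥ C n) (Q n) →
           lnℕ (Q (suc n)) ⩽ t * natural (Q n)
    -- The factor q n in q n q (n + 1) ≤ s ^ q n is simply dropped.
    near n close = lnℕ-⩽ (Q (suc n)) (⩽-trans (natural-mono (ℕ.m≤n*m (Q (suc n)) (Q n)))
      (⩽-trans
        (reciprocal-above (0≺recip (0<-^ {s} 0<s (Q n))) (recip-* (0<-^ {s} 0<s (Q n)))
          (0≺natural (Q n ℕ.* Q (suc n)) {{ℕ.m*n≢0 (Q n) (Q (suc n))}}) close (approx-upper n))
        (⩽-≈-trans (^-mono (≺⁺ 0<s) (⩽-reflexive s≈) (Q n)) (exp-^ t (Q n)))))
    from : Separated α (geometricGauge s 0<s) → LnQ≤Q t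
    from (K , _ , far) = ev-map (λ n K≤Q → near n (≺⁺ (far (ℚ.↥ C n) (Q n) K≤Q))) (ev-Q≥ K)

  LnB≤Q⇒LnQ≤Q : ∀ {u ε} → 0ℝ ≺ ε → LnB≤Q u → LnQ≤Q (u + ε)
  LnB≤Q⇒LnQ≤Q {u} {ε} 0≺ε h = from (linear≺exp 0≺ε)
    where
    step : ∀ n → lnℕ (b⁺ n) ⩽ u * natural (Q n) → natural (2 ℕ.* Q n) ≺ exp (ε * natural (Q n)) →
           lnℕ (Q (suc n)) ⩽ (u + ε) * natural (Q n)
    step n le 2Q≺ = ⩽-trans (lnQ⩽ln2Q+lnb n) (⩽-lin
      (+-mono-⩽ (lnℕ-⩽ (2 ℕ.* Q n) (≺⇒⩽ 2Q≺)) le)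
      λ m → solve 5 (λ u e q s b → (u :+ e) :* q :- (s :+ b)
          := (e :* q :+ u :* q) :- (s :+ b)) refl
        (seq u m) (seq ε m) (fromℕ (Q n)) (seq (lnℕ (2 ℕ.* Q n)) m) (seq (lnℕ (b⁺ n)) m))
    from : ∃[ K ] (∀ k .{{_ : ℕ.NonZero k}} → K ℕ.≤ k → natural (2 ℕ.* k) ≺ exp (ε * natural k)) →
           LnQ≤Q (u + ε)
    from (K , 2k≺) = ev-zip (λ n le K≤Q → step n le (2k≺ (Q n) K≤Q)) h (ev-Q≥ K)

  LnQ≤Q⇒LnB≤Q : ∀ {u} → LnQ≤Q u → LnB≤Q u
  LnQ≤Q⇒LnB≤Q = ev-map λ n → ⩽-trans (lnℕ-mono (b⁺ n) (Q (suc n))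
    (ℕ.≤-trans (ℕ.m≤m*n (b⁺ n) (Q n)) (b*Q≤Q n)))

-- Least bounds and infima

⩽-limit′ : ∀ {x y} → (∀ ε → 0ℝ ≺ ε → x ⩽ y + ε) → x ⩽ y
⩽-limit′ h = ⩽-limit λ ε 0<ε → h (fromℚ ε) (≺⁺ (0<fromℚ 0<ε))

ApproximatedFromAbove : (ℝ → Set) → ℝ → Set
ApproximatedFromAbove P x = ∀ ε → 0ℝ ≺ ε → ∃[ u ] P u × u ≺ x + ε

0⩽-infimum : ∀ {E x} → (∀ {u} → E u → 0ℝ ⩽ u) → ApproximatedFromAbove E x → 0ℝ ⩽ x
0⩽-infimum {E} {x} 0⩽E approx = ⩽-limit′ λ ε 0≺ε → from (approx ε 0≺ε)
  where
  from : ∀ {ε} → ∃[ u ] E u × u ≺ x + ε → 0ℝ ⩽ x + ε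
  from (u , Eu , u≺) = ⩽-trans (0⩽E Eu) (≺⇒⩽ u≺)

-- φ and ψ are inverse order isomorphisms, as far as they are defined, that
-- carry E to P up to an arbitrarily small loss.
module LeastInfimum {P E : ℝ → Set} (φ : ℝ → ℝ) (ψ : ∀ {y} → P y → ℝ)
  (E⇒P : ∀ {u} → E u → P (φ u))
  (P⇒E : ∀ {y} (p : P y) {ε} → 0ℝ ≺ ε → E (ψ p + ε)) where

  +∞-⇔ : IsLeastOr∞ P +∞ ⇔ IsInfimum E +∞
  +∞-⇔ = mk⇔ (λ none u Eu → none (φ u) (E⇒P Eu))
    (λ none y Py → none (ψ Py + 1ℝ) (P⇒E Py 0≺1))

  -- From left to right, elements of E just above ψ z = x show that x is the infimum. From right to
  -- left, the last hypothesis, closure under approximation, supplies the attainment that an infimum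
  -- lacks; minimality follows by letting ε tend to 0 in x ≤ ψ y + ε.
  fin-⇔ : ∀ {x z} →
    (∀ {u} → z ⩽ φ u → x ⩽ u) →
    (∀ {y} (p : P y) → x ⩽ ψ p → z ⩽ y) →
    (∀ (p : P z) → ψ p ≈ x) →
    (ApproximatedFromAbove E x → P z) →
    IsLeastOr∞ P (fin z) ⇔ IsInfimum E (fin x)
  fin-⇔ {x} {z} φ-reflects ψ-reflects ψz≈x closed = mk⇔
    (λ (Pz , least) →
      (λ u Eu → ⩽⁻ (φ-reflects (⩽⁺ (least (φ u) (E⇒P Eu))))) ,
      -- Half of ε, because the infimum asks for an element strictly below x + ε.
      λ ε 0<ε → ψ Pz + half ε , P⇒E Pz (0≺half {ε} (≺⁺ 0<ε)) , ≺⁻ (approx Pz {ε} (≺⁺ 0<ε)))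
    (λ (lower , approx) →
      closed (λ ε 0≺ε → wrap (approx ε (≺⁻ 0≺ε))) ,
      λ y Py → ⩽⁻ (ψ-reflects Py (⩽-limit′ λ ε 0≺ε → ⩽⁺ (lower (ψ Py + ε) (P⇒E Py 0≺ε)))))
    where
    wrap : ∀ {ε} → ∃[ u ] E u × u < x + ε → ∃[ u ] E u × u ≺ x + ε
    wrap (u , Eu , u<x+ε) = u , Eu , ≺⁺ u<x+ε
    approx : ∀ (Pz : P z) {ε} → 0ℝ ≺ ε → ψ Pz + half ε ≺ x + ε
    approx Pz {ε} 0≺ε = ≈-≺-trans (+-cong (ψz≈x Pz) ≈-refl)
      (≺-lin (half≺ 0≺ε) λ n → solve 3 (λ x h e → (x :+ e) :- (x :+ h) := e :- h) refl
        (seq x n) (seq (half ε) n) (seq ε n))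

module _ (α : ℝ) (E : ℝ → Set) {c : ℝ} (0≺c : 0ℝ ≺ c)
  (0⩽E : ∀ {u} → E u → 0ℝ ⩽ u)
  (E⇒P : ∀ {u} → E u → ExponentBound α (c + u))
  (P⇒E : ∀ {y ε} → 0ℝ ≺ ε → ExponentBound α y → E ((y - c) + ε)) where

  private
    open LeastInfimum {ExponentBound α} {E} (c +_) (λ {y} _ → y - c) E⇒P (λ p 0≺ε → P⇒E 0≺ε p)

    bounded-below : ¬ IsInfimum E -∞
    bounded-below below = from (below 0ℝ)
      where
      from : ¬ (∃[ u ] E u × u < 0ℝ)
      from (u , Eu , u<0) = ⩽⇒⊀ (0⩽E Eu) (≺⁺ {u} {0ℝ} u<0)

    shift-approximation : ∀ {x} → ApproximatedFromAbove E x →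
                          ApproximatedFromAbove (ExponentBound α) (c + x)
    shift-approximation {x} approx ε 0≺ε = from (approx ε 0≺ε)
      where
      from : ∃[ u ] E u × u ≺ x + ε → ∃[ y ] ExponentBound α y × y ≺ (c + x) + ε
      from (u , Eu , u≺) = c + u , E⇒P Eu , ≺-lin u≺ λ n →
        solve 4 (λ c x u e → ((c :+ x) :+ e) :- (c :+ u) := (x :+ e) :- u) refl
          (seq c n) (seq x n) (seq u n) (seq ε n)

  -- The shift c is 1 for the quotients with ln q (n + 1) and 2 for those with ln b (n + 1). At -∞
  -- both sides are false: no least bound is -∞, and E has no negative element.
  exponent-⇔ : ∀ x → IsIrrationalityExponent α (c ⊕ x) ⇔ IsInfimum E x
  exponent-⇔ -∞      = mk⇔ ⊥-elim bounded-below
  exponent-⇔ (fin x) = fin-⇔ {x} {c + x}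
    (λ {u} z⩽φu → ⩽-lin z⩽φu λ n →
      solve 3 (λ c x u → u :- x := (c :+ u) :- (c :+ x)) refl (seq c n) (seq x n) (seq u n))
    (λ {y} _ x⩽ψy → ⩽-lin x⩽ψy λ n →
      solve 3 (λ c x y → y :- (c :+ x) := (y :- c) :- x) refl (seq c n) (seq x n) (seq y n))
    (λ _ → ≈-ptwise λ n → solve 2 (λ c x → (c :+ x) :- c := x) refl (seq c n) (seq x n))
    (λ approx → ExponentBound-approx {α} {c + x}
      (≺-⩽-trans 0≺c (⩽-lin (0⩽-infimum {E} {x} 0⩽E approx) λ n →
        solve 2 (λ c x → (c :+ x) :- c := x :- con 0ℚ) refl (seq c n) (seq x n)))
      (shift-approximation {x} approx))
  exponent-⇔ +∞      = +∞-⇔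

module _ (α : ℝ) (E : ℝ → Set)
  (0⩽E : ∀ {u} → E u → 0ℝ ⩽ u)
  (E⇒P : ∀ {u} → E u → BaseBound α (exp u))
  (P⇒E : ∀ {y ε} (0<y : 0ℝ < y) → 0ℝ ≺ ε → BaseBound α y → E (ln y 0<y + ε)) where

  private
    0<base : ∀ {y} → BaseBound α y → 0ℝ < y
    0<base {y} (1≤y , _) = ≺⁻ (1⩽⇒0≺ {y} (⩽⁺ 1≤y))

    open LeastInfimum {BaseBound α} {E} exp (λ {y} p → ln y (0<base p)) E⇒P
      (λ p 0≺ε → P⇒E (0<base p) 0≺ε p)

    exp-approximation : ∀ {β} (0<β : 0ℝ < β) → ApproximatedFromAbove E (ln β 0<β) →
                        ApproximatedFromAbove (BaseBound α) β
    exp-approximation {β} 0<β approx ε 0≺ε = from (exp-increment {β} (≺⁺ 0<β) 0≺ε)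
      where
      from : ∃[ γ ] 0ℝ ≺ γ × β * exp γ ⩽ β + ε → ∃[ y ] BaseBound α y × y ≺ β + ε
      from (γ , 0≺γ , step) = from′ (approx γ 0≺γ)
        where
        from′ : ∃[ u ] E u × u ≺ ln β 0<β + γ → ∃[ y ] BaseBound α y × y ≺ β + ε
        from′ (u , Eu , u≺) = exp u , E⇒P Eu , ≺-⩽-trans (exp-mono-≺ u≺)
          (≈-⩽-trans (≈-trans (exp-+ (ln β 0<β) γ) (*-congʳ (exp γ) (exp-ln β 0<β))) step)

  base-⇔ : ∀ β (0<β : Positive β) → IsIrrationalityBase α β ⇔ IsInfimum E (ln∞ β 0<β)
  base-⇔ (fin β) 0<β = fin-⇔ {ln β 0<β} {β}
    (λ β⩽expu → exp-reflects-⩽ (≈-⩽-trans (exp-ln β 0<β) β⩽expu))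
    (λ {y} p lnβ⩽lny → ≈-⩽-trans (≈-sym (exp-ln β 0<β))
      (⩽-≈-trans (exp-mono-⩽ lnβ⩽lny) (exp-ln y (0<base p))))
    -- The two logarithms of β carry different positivity proofs, but their terms do not depend on
    -- them.
    (λ _ → ≈-ptwise λ _ → refl)
    (λ approx → BaseBound-approx {α} {β}
      (⩽-≈-trans (exp-0⩽ (0⩽-infimum {E} {ln β 0<β} 0⩽E approx)) (exp-ln β 0<β))
      (exp-approximation {β} 0<β approx))
  base-⇔ +∞ _ = +∞-⇔

theorem1 : (α : ℝ) (c : ContinuedFraction) → Irrational α → HasExpansion α c →
    let open ContinuedFraction c in
    (∀ x → IsIrrationalityExponent α (1ℝ ⊕ x) ⇔
    IsLimsup (λ n → lnℕ (q c (suc n)) /ln q c n) x)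
    × (∀ x → IsIrrationalityExponent α (2ℝ ⊕ x) ⇔
    IsLimsup (λ n → lnℕ (b⁺ n) /ln q c n) x)
    × (∀ β (0<β : Positive β) → IsIrrationalityBase α β ⇔
    IsLimsup (λ n → lnℕ (q c (suc n)) ÷ natural (q c n) ⟨ 0<natural (q c n) ⟩)
    (ln∞ β 0<β))
    × (∀ β (0<β : Positive β) → IsIrrationalityBase α β ⇔
    IsLimsup (λ n → lnℕ (b⁺ n) ÷ natural (q c n) ⟨ 0<natural (q c n) ⟩)
    (ln∞ β 0<β))
theorem1 α c _ expansion =
  exponent-⇔ α (/lnBound lnQ) 0≺1
    (λ {u} h → ⩽-trans (≺⇒⩽ 0≺1) (1⩽LnQ≤LnQ {u} (/ln-multiply lnQ {u} h)))
    (λ {u} h → LnQ≤LnQ⇒ExponentBound {u} (/ln-multiply lnQ {u} h))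
    (λ {y} {ε} 0≺ε p → /ln-divide lnQ {(y - 1ℝ) + ε} (ExponentBound⇒LnQ≤LnQ {y} {ε} 0≺ε p)) ,
  exponent-⇔ α (/lnBound lnB) (0≺natural 2)
    (λ {u} h → 0⩽LnB≤LnQ {u} (/ln-multiply lnB {u} h))
    (λ {u} h → LnB≤LnQ⇒ExponentBound {u} (/ln-multiply lnB {u} h))
    (λ {y} {ε} 0≺ε p → /ln-divide lnB {(y - 2ℝ) + ε} (ExponentBound⇒LnB≤LnQ {y} {ε} 0≺ε p)) ,
  base-⇔ α (÷Bound lnQ)
    (λ {u} h → 0⩽LnQ≤Q {u} (÷-multiply lnQ {u} h))
    (λ {u} h → LnQ≤Q⇒BaseBound {u} (÷-multiply lnQ {u} h))
    (λ {y} {ε} 0<y 0≺ε p → ÷-divide lnQ {ln y 0<y + ε} (BaseBound⇒LnQ≤Q {y} {ε} 0<y 0≺ε p)) ,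
  base-⇔ α (÷Bound lnB)
    (λ {u} h → 0⩽LnB≤Q {u} (÷-multiply lnB {u} h))
    (λ {u} h → LnB≤Q⇒BaseBound {u} (÷-multiply lnB {u} h))
    (λ {y} {ε} 0<y 0≺ε p → ÷-divide lnB {ln y 0<y + ε}
      (LnQ≤Q⇒LnB≤Q {ln y 0<y + ε} (BaseBound⇒LnQ≤Q {y} {ε} 0<y 0≺ε p)))
  where
  open ContinuedFraction c
  open Convergents c
  open Bounds {α} c expansion

  lnQ lnB : ℕ → ℝ
  lnQ n = lnℕ (Q (suc n))
  lnB n = lnℕ (b⁺ n)

  /lnBound ÷Bound : (ℕ → ℝ) → ℝ → Set
  /lnBound x = EventuallyBoundedBy (λ n → x n /ln Q n)
  ÷Bound x = EventuallyBoundedBy (λ n → x n ÷ natural (Q n) ⟨ 0<natural (Q n) ⟩)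

  module _ (x : ℕ → ℝ) {u : ℝ} where

    -- Restricting to q n ≥ 2 keeps clear of the default value 0 that `/ln` takes at 1; this
    -- excludes only finitely many n.
    /ln-multiply : /lnBound x u → Eventually (λ n → x n ⩽ u * lnℕ (Q n))
    /ln-multiply h = ev-zip (λ n le 1<Q → /ln-⩽⇒ (x n) (Q n) 1<Q {u} (⩽⁺ le)) h (ev-Q≥ 2)

    /ln-divide : Eventually (λ n → x n ⩽ u * lnℕ (Q n)) → /lnBound x u
    /ln-divide h = ev-zip (λ n le 1<Q → ⩽⁻ (⇒/ln-⩽ (x n) (Q n) 1<Q {u} le)) h (ev-Q≥ 2)

    ÷-multiply : ÷Bound x u → Eventually (λ n → x n ⩽ u * natural (Q n))
    ÷-multiply = ev-map λ n le → ÷-⩽⇒ (0<natural (Q n)) (⩽⁺ le)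

    ÷-divide : Eventually (λ n → x n ⩽ u * natural (Q n)) → ÷Bound x u
    ÷-divide = ev-map λ n le → ⩽⁻ (⇒÷-⩽ (0<natural (Q n)) le)

  -- Passing from b (n + 1) to q (n + 1) costs an arbitrarily small amount because of the factor 2;
  -- closure under approximation recovers the exact value 2 + u.
  LnB≤LnQ⇒ExponentBound : ∀ {u} → LnB≤LnQ u → ExponentBound α (2ℝ + u)
  LnB≤LnQ⇒ExponentBound {u} h = ExponentBound-approx {α} {2ℝ + u}
    (≺-⩽-trans (0≺natural 2) (⩽-lin (0⩽LnB≤LnQ {u} h) λ n →
      solve 2 (λ t u → (t :+ u) :- t := u :- con 0ℚ) refl (fromℕ 2) (seq u n)))
    (λ ε 0≺ε → 1ℝ + ((1ℝ + u) + half ε) ,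
      LnQ≤LnQ⇒ExponentBound {(1ℝ + u) + half ε}
        (LnB≤LnQ⇒LnQ≤LnQ {u} (0≺half 0≺ε) h) ,
      ≺-lin (half≺ 0≺ε) λ n →
        solve 3 (λ u h e → ((con (fromℕ 2) :+ u) :+ e) :- (con 1ℚ :+ ((con 1ℚ :+ u) :+ h)) := e :- h)
          refl (seq u n) (seq (half ε) n) (seq ε n))

  ExponentBound⇒LnB≤LnQ : ∀ {y ε} → 0ℝ ≺ ε → ExponentBound α y → LnB≤LnQ ((y - 2ℝ) + ε)
  ExponentBound⇒LnB≤LnQ {y} {ε} 0≺ε p = LnQ≤LnQ⇒LnB≤LnQ {(y - 1ℝ) + ε} {(y - 2ℝ) + ε}
    (λ n → solve 2 (λ y e → (y :- con (fromℕ 2)) :+ e := ((y :- con 1ℚ) :+ e) :- con 1ℚ) refl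
      (seq y n) (seq ε n))
    (ExponentBound⇒LnQ≤LnQ {y} {ε} 0≺ε p)

  -- The loss is now in the exponent: exp (u + γ / 2) < exp u exp γ ≤ exp u + ε, so the bases exp (u
  -- + γ / 2) approximate exp u from above.
  LnB≤Q⇒BaseBound : ∀ {u} → LnB≤Q u → BaseBound α (exp u)
  LnB≤Q⇒BaseBound {u} h = BaseBound-approx {α} {exp u} (exp-0⩽ (0⩽LnB≤Q {u} h)) λ ε 0≺ε →
    from (exp-increment (0≺exp u) 0≺ε)
    where
    from : ∀ {ε} → ∃[ γ ] 0ℝ ≺ γ × exp u * exp γ ⩽ exp u + ε →
           ∃[ y ] BaseBound α y × y ≺ exp u + ε
    from (γ , 0≺γ , step) = exp (u + half γ) ,
      LnQ≤Q⇒BaseBound {u + half γ} (LnB≤Q⇒LnQ≤Q {u} (0≺half 0≺γ) h) ,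
      ≺-⩽-trans
        (exp-mono-≺ (≺-lin (half≺ 0≺γ) λ n →
          solve 3 (λ u h g → (u :+ g) :- (u :+ h) := g :- h) refl
            (seq u n) (seq (half γ) n) (seq γ n)))
        (≈-⩽-trans (exp-+ u γ) step)
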